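{- There exists an absolute constant $c>0$ such that for all integers $n,m\ge1$ and all (possibly partial) Boolean functions $f_1,f_2,\dots,f_n$ on $\{ -1,+1\}^m$, $$T_{\frac12-2^{ -n}}\left(\bigotimes_{i=1}^nf_i\right)\ \ge\ c\min_{S\subseteq\{1,\dots,n\},\ |S|=\lceil0.99n\rceil}\left\{\sum_{i\in S}\deg_{1/3}(f_i)\right\}.$$
   Context: A (possibly partial) Boolean function $f$ on a finite set $X$ is a map $f:\operatorname{dom}f\to\{ -1,+1\}$ with $\varnothing\ne\operatorname{dom}f\subseteq X$. For finite $X\subset\mathbb{R}^N$, $\deg_\epsilon(f)$ is the least degree of a real polynomial $p$ such that $|f(x)-p(x)|\le\epsilon$ for $x\in\operatorname{dom}f$ and $|p(x)|\le1+\epsilon$ for $x\in X\setminus\operatorname{dom}f$; here $X=\{ -1,+1\}^m$. $\bigotimes_{i=1}^n f_i$ is the (possibly partial) Boolean function on $(\{ -1,+1\}^m)^n$ with domain $\prod\operatorname{dom}f_i$ and value $\prod_{i=1}^n f_i(x_i)$. A quantum query algorithm with $T$ queries on unknown input $x\in\{ -1,+1\}^N$ starts in a fixed state, applies $U_TO_xU_{T-1}O_x\cdots U_1O_xU_0$, where the $U_j$ are input-independent unitaries and $O_x$ is the input oracle (mapping $|i,b,w\rangle$ to $|i,b\oplus b_i,w\rangle$ with $b_i=1$ if $x_i=-1$ and $b_i=0$ if $x_i=+1$), and outputs the result of a measurement. Its cost is the number $T$ of queries. $T_\epsilon(f)$ is the least cost of a quantum query algorithm that outputs $f(x)$ with probability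 at least $1-\epsilon$ on every $x\in\operatorname{dom}f$. -}

module Defs where

open import Algebra.Bundles.Raw using (RawRing)
import Algebra.Definitions.RawSemiring as RawSemiringOps
open import Data.Bool.Base using (Bool; true; false; if_then_else_; _xor_)
import Data.Bool.Properties as Bool
open import Data.Fin.Base using (Fin; zero; suc; combine; remQuot)
import Data.Fin.Properties as Fin
open import Data.Fin.Subset using (Subset)
import Data.Integer.Base as ℤ
open import Data.List.Base as List using (List)
open import Data.List.Relation.Unary.All using (All)
open import Data.Maybe.Base as Maybe using (Maybe; just; nothing)
open import Data.Nat.Base as ℕ using (ℕ; zero; suc)
import Data.Nat.Properties as ℕ
open import Data.Product.Base using (∃; _×_; _,_; proj₁; proj₂; uncurry)
open import Data.Product.Properties using (≡-dec)
open import Data.Rational.Base as ℚ using (ℚ; 0ℚ; 1ℚ)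
import Data.Rational.Properties as ℚ
open import Data.Rational.Solver using (module +-*-Solver)
open import Data.Sign.Base as Sign using (Sign)
open import Data.Sum.Base using (inj₁; inj₂)
open import Data.Vec.Base as Vec using (Vec; lookup; tabulate)
open import Data.Vec.Properties
  using (lookup∘tabulate; tabulate-cong; tabulate∘lookup)
open import Level using (0ℓ)
open import Relation.Binary.Definitions using (DecidableEquality)
open import Relation.Binary.PropositionalEquality
  using (_≡_; refl; sym; trans; cong; cong₂; subst; subst₂)
open import Relation.Nullary.Decidable using (does)

------------------------------------------------------------------------
-- Real numbers: Cauchy sequences of rationals (with modulus), up to the
-- setoid equality _≈ℝ_.  The operations act termwise.

IsCauchy : (ℕ → ℚ) → Set
IsCauchy x = ∀ ε → 0ℚ ℚ.< ε →
  ∃ λ N → ∀ i j → N ℕ.≤ i → N ℕ.≤ j → ℚ.∣ x i ℚ.- x j ∣ ℚ.≤ ε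

record ℝ : Set where
  constructor mkℝ
  field
    seq    : ℕ → ℚ
    cauchy : IsCauchy seq

open ℝ public

Eventually : (ℕ → Set) → Set
Eventually P = ∃ λ N → ∀ i → N ℕ.≤ i → P i

infix 4 _≈ℝ_ _≤ℝ_ _<ℝ_

_≈ℝ_ : ℝ → ℝ → Set
x ≈ℝ y = ∀ ε → 0ℚ ℚ.< ε → Eventually λ i → ℚ.∣ seq x i ℚ.- seq y i ∣ ℚ.≤ ε

_≤ℝ_ : ℝ → ℝ → Set
x ≤ℝ y = ∀ ε → 0ℚ ℚ.< ε → Eventually λ i → seq x i ℚ.≤ seq y i ℚ.+ ε

_<ℝ_ : ℝ → ℝ → Set
x <ℝ y = ∃ λ ε → 0ℚ ℚ.< ε × Eventually λ i → seq x i ℚ.+ ε ℚ.≤ seq y i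

private
  open +-*-Solver using (solve; _:+_; _:*_; _:-_; :-_; _:=_)

  half-pos : ∀ {ε} → 0ℚ ℚ.< ε → 0ℚ ℚ.< ℚ.½ ℚ.* ε
  half-pos {ε} 0<ε = ℚ.positive⁻¹ (ℚ.½ ℚ.* ε)
    {{ℚ.pos*pos⇒pos ℚ.½ ε {{ℚ.positive 0<ε}}}}

  halves : ∀ ε → ℚ.½ ℚ.* ε ℚ.+ ℚ.½ ℚ.* ε ≡ ε
  halves ε = trans (sym (ℚ.*-distribʳ-+ ε ℚ.½ ℚ.½)) (ℚ.*-identityˡ ε)

  ∣-∣-sym : ∀ a b → ℚ.∣ a ℚ.- b ∣ ≡ ℚ.∣ b ℚ.- a ∣
  ∣-∣-sym a b = trans
    (cong ℚ.∣_∣ (solve 2 (λ a b → a :- b := :- (b :- a)) refl a b))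
    (ℚ.∣-p∣≡∣p∣ (b ℚ.- a))

  ∣∣-≤ : ∀ a b → ℚ.∣ a ∣ ℚ.≤ ℚ.∣ a ℚ.- b ∣ ℚ.+ ℚ.∣ b ∣
  ∣∣-≤ a b = subst (λ z → ℚ.∣ z ∣ ℚ.≤ ℚ.∣ a ℚ.- b ∣ ℚ.+ ℚ.∣ b ∣)
    (solve 2 (λ a b → (a :- b) :+ b := a) refl a b)
    (ℚ.∣p+q∣≤∣p∣+∣q∣ (a ℚ.- b) b)

  ∣∣-∣∣≤ : ∀ a b → ℚ.∣ a ∣ ℚ.- ℚ.∣ b ∣ ℚ.≤ ℚ.∣ a ℚ.- b ∣
  ∣∣-∣∣≤ a b = subst (ℚ.∣ a ∣ ℚ.- ℚ.∣ b ∣ ℚ.≤_)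
    (solve 2 (λ d b → (d :+ b) :- b := d) refl ℚ.∣ a ℚ.- b ∣ ℚ.∣ b ∣)
    (ℚ.+-monoˡ-≤ (ℚ.- ℚ.∣ b ∣) (∣∣-≤ a b))

  reverse-triangle : ∀ a b → ℚ.∣ ℚ.∣ a ∣ ℚ.- ℚ.∣ b ∣ ∣ ℚ.≤ ℚ.∣ a ℚ.- b ∣
  reverse-triangle a b with ℚ.∣p∣≡p∨∣p∣≡-p (ℚ.∣ a ∣ ℚ.- ℚ.∣ b ∣)
  ... | inj₁ eq = subst (ℚ._≤ ℚ.∣ a ℚ.- b ∣) (sym eq) (∣∣-∣∣≤ a b)
  ... | inj₂ eq = subst₂ ℚ._≤_
    (trans (solve 2 (λ p q → q :- p := :- (p :- q)) refl ℚ.∣ a ∣ ℚ.∣ b ∣) (sym eq))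
    (∣-∣-sym b a)
    (∣∣-∣∣≤ b a)

  bounded : ∀ x → IsCauchy x →
    ∃ λ B → 0ℚ ℚ.< B × Eventually λ i → ℚ.∣ x i ∣ ℚ.≤ B
  bounded x xc with xc 1ℚ (ℚ.positive⁻¹ 1ℚ)
  ... | N , close =
    1ℚ ℚ.+ ℚ.∣ x N ∣ ,
    ℚ.<-≤-trans (ℚ.positive⁻¹ 1ℚ)
      (subst (ℚ._≤ 1ℚ ℚ.+ ℚ.∣ x N ∣) (ℚ.+-identityʳ 1ℚ)
        (ℚ.+-monoʳ-≤ 1ℚ (ℚ.0≤∣p∣ (x N)))) ,
    N , λ i N≤i → ℚ.≤-trans (∣∣-≤ (x i) (x N))
      (ℚ.+-monoˡ-≤ ℚ.∣ x N ∣ (close i N N≤i ℕ.≤-refl))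

  +-cauchy : ∀ x y → IsCauchy x → IsCauchy y → IsCauchy (λ i → x i ℚ.+ y i)
  +-cauchy x y xc yc ε 0<ε
    with xc (ℚ.½ ℚ.* ε) (half-pos 0<ε) | yc (ℚ.½ ℚ.* ε) (half-pos 0<ε)
  ... | M , xclose | N , yclose = M ℕ.⊔ N , λ i j p q →
    subst₂ ℚ._≤_
      (cong ℚ.∣_∣ (solve 4 (λ a b c d → (a :- c) :+ (b :- d) := (a :+ b) :- (c :+ d))
        refl (x i) (y i) (x j) (y j)))
      (halves ε)
      (ℚ.≤-trans (ℚ.∣p+q∣≤∣p∣+∣q∣ (x i ℚ.- x j) (y i ℚ.- y j))
        (ℚ.+-mono-≤
          (xclose i j (ℕ.m⊔n≤o⇒m≤o M N p) (ℕ.m⊔n≤o⇒m≤o M N q))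
          (yclose i j (ℕ.m⊔n≤o⇒n≤o M N p) (ℕ.m⊔n≤o⇒n≤o M N q))))

  neg-cauchy : ∀ x → IsCauchy x → IsCauchy (λ i → ℚ.- x i)
  neg-cauchy x xc ε 0<ε with xc ε 0<ε
  ... | N , close = N , λ i j p q →
    subst (ℚ._≤ ε)
      (cong ℚ.∣_∣ (solve 2 (λ a b → b :- a := (:- a) :- (:- b)) refl (x i) (x j)))
      (close j i q p)

  abs-cauchy : ∀ x → IsCauchy x → IsCauchy (λ i → ℚ.∣ x i ∣)
  abs-cauchy x xc ε 0<ε with xc ε 0<ε
  ... | N , close = N , λ i j p q →
    ℚ.≤-trans (reverse-triangle (x i) (x j)) (close i j p q)

  *-cauchy-bounded : ∀ x y A B .{{_ : ℚ.Positive A}} .{{_ : ℚ.Positive B}} →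
    (Eventually λ i → ℚ.∣ x i ∣ ℚ.≤ A) → (Eventually λ i → ℚ.∣ y i ∣ ℚ.≤ B) →
    IsCauchy x → IsCauchy y → IsCauchy (λ i → x i ℚ.* y i)
  *-cauchy-bounded x y A B (Nx , x≤A) (Ny , y≤B) xc yc ε 0<ε =
    close-with δ total (xc δ 0<δ) (yc δ 0<δ)
    where
    instance
      AB-pos : ℚ.Positive (A ℚ.+ B)
      AB-pos = ℚ.pos+pos⇒pos A B
      AB-nonZero : ℚ.NonZero (A ℚ.+ B)
      AB-nonZero = ℚ.pos⇒nonZero (A ℚ.+ B)

    δ : ℚ
    δ = ℚ.1/ (A ℚ.+ B) ℚ.* ε

    0<δ : 0ℚ ℚ.< δ
    0<δ = ℚ.positive⁻¹ δ
      {{ℚ.pos*pos⇒pos (ℚ.1/ (A ℚ.+ B)) {{ℚ.1/pos⇒pos (A ℚ.+ B)}} ε {{ℚ.positive 0<ε}}}}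

    total : A ℚ.* δ ℚ.+ B ℚ.* δ ≡ ε
    total = trans (sym (ℚ.*-distribʳ-+ δ A B))
      (trans (sym (ℚ.*-assoc (A ℚ.+ B) (ℚ.1/ (A ℚ.+ B)) ε))
        (trans (cong (ℚ._* ε) (ℚ.*-inverseʳ (A ℚ.+ B))) (ℚ.*-identityˡ ε)))

    *-mono : ∀ a b p d → .{{ℚ.Positive p}} → ℚ.∣ a ∣ ℚ.≤ p → ℚ.∣ b ∣ ℚ.≤ d →
      ℚ.∣ a ℚ.* b ∣ ℚ.≤ p ℚ.* d
    *-mono a b p d a≤p b≤d = subst (ℚ._≤ p ℚ.* d) (sym (ℚ.∣p*q∣≡∣p∣*∣q∣ a b))
      (ℚ.≤-trans
        (ℚ.*-monoʳ-≤-nonNeg ℚ.∣ b ∣ {{ℚ.∣-∣-nonNeg b}} a≤p)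
        (ℚ.*-monoˡ-≤-nonNeg p {{ℚ.pos⇒nonNeg p}} b≤d))

    split : ∀ a b c d → a ℚ.* (b ℚ.- d) ℚ.+ d ℚ.* (a ℚ.- c) ≡ a ℚ.* b ℚ.- c ℚ.* d
    split = solve 4
      (λ a b c d → a :* (b :- d) :+ d :* (a :- c) := a :* b :- c :* d) refl

    close-with : ∀ d → A ℚ.* d ℚ.+ B ℚ.* d ≡ ε →
      (∃ λ M → ∀ i j → M ℕ.≤ i → M ℕ.≤ j → ℚ.∣ x i ℚ.- x j ∣ ℚ.≤ d) →
      (∃ λ M → ∀ i j → M ℕ.≤ i → M ℕ.≤ j → ℚ.∣ y i ℚ.- y j ∣ ℚ.≤ d) →
      ∃ λ M → ∀ i j → M ℕ.≤ i → M ℕ.≤ j → ℚ.∣ x i ℚ.* y i ℚ.- x j ℚ.* y j ∣ ℚ.≤ ε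
    close-with d eq (Mx , xclose) (My , yclose) =
      (Nx ℕ.⊔ Ny) ℕ.⊔ (Mx ℕ.⊔ My) , λ i j p q →
      subst₂ ℚ._≤_ (cong ℚ.∣_∣ (split (x i) (y i) (x j) (y j))) eq
        (ℚ.≤-trans
          (ℚ.∣p+q∣≤∣p∣+∣q∣ (x i ℚ.* (y i ℚ.- y j)) (y j ℚ.* (x i ℚ.- x j)))
          (ℚ.+-mono-≤
            (*-mono (x i) (y i ℚ.- y j) A d
              (x≤A i (ℕ.m⊔n≤o⇒m≤o Nx Ny (low p)))
              (yclose i j (ℕ.m⊔n≤o⇒n≤o Mx My (high p)) (ℕ.m⊔n≤o⇒n≤o Mx My (high q))))
            (*-mono (y j) (x i ℚ.- x j) B d
              (y≤B j (ℕ.m⊔n≤o⇒n≤o Nx Ny (low q)))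
              (xclose i j (ℕ.m⊔n≤o⇒m≤o Mx My (high p)) (ℕ.m⊔n≤o⇒m≤o Mx My (high q))))))
      where
      low : ∀ {k} → (Nx ℕ.⊔ Ny) ℕ.⊔ (Mx ℕ.⊔ My) ℕ.≤ k → Nx ℕ.⊔ Ny ℕ.≤ k
      low = ℕ.m⊔n≤o⇒m≤o (Nx ℕ.⊔ Ny) (Mx ℕ.⊔ My)
      high : ∀ {k} → (Nx ℕ.⊔ Ny) ℕ.⊔ (Mx ℕ.⊔ My) ℕ.≤ k → Mx ℕ.⊔ My ℕ.≤ k
      high = ℕ.m⊔n≤o⇒n≤o (Nx ℕ.⊔ Ny) (Mx ℕ.⊔ My)

  *-cauchy : ∀ x y → IsCauchy x → IsCauchy y → IsCauchy (λ i → x i ℚ.* y i)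
  *-cauchy x y xc yc = from (bounded x xc) (bounded y yc)
    where
    from : (∃ λ A → 0ℚ ℚ.< A × Eventually λ i → ℚ.∣ x i ∣ ℚ.≤ A) →
           (∃ λ B → 0ℚ ℚ.< B × Eventually λ i → ℚ.∣ y i ∣ ℚ.≤ B) →
           IsCauchy (λ i → x i ℚ.* y i)
    from (A , 0<A , x≤A) (B , 0<B , y≤B) =
      *-cauchy-bounded x y A B {{ℚ.positive 0<A}} {{ℚ.positive 0<B}} x≤A y≤B xc yc

infixl 7 _*ℝ_
infixl 6 _+ℝ_ _-ℝ_
infix  8 -ℝ_

fromℚ : ℚ → ℝ
fromℚ q .seq _  = q
fromℚ q .cauchy ε 0<ε = 0 , λ _ _ _ _ →
  subst (λ z → ℚ.∣ z ∣ ℚ.≤ ε) (sym (ℚ.+-inverseʳ q)) (ℚ.<⇒≤ 0<ε)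

fromℕ : ℕ → ℝ
fromℕ n = fromℚ (ℤ.+ n ℚ./ 1)

0ℝ 1ℝ ½ℝ ⅓ℝ : ℝ
0ℝ = fromℚ 0ℚ
1ℝ = fromℚ 1ℚ
½ℝ = fromℚ ℚ.½
⅓ℝ = fromℚ (ℤ.+ 1 ℚ./ 3)

_+ℝ_ _*ℝ_ : ℝ → ℝ → ℝ
(x +ℝ y) .seq i  = seq x i ℚ.+ seq y i
(x +ℝ y) .cauchy = +-cauchy (seq x) (seq y) (cauchy x) (cauchy y)
(x *ℝ y) .seq i  = seq x i ℚ.* seq y i
(x *ℝ y) .cauchy = *-cauchy (seq x) (seq y) (cauchy x) (cauchy y)

-ℝ_ ∣_∣ℝ : ℝ → ℝ
(-ℝ x)   .seq i  = ℚ.- seq x i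
(-ℝ x)   .cauchy = neg-cauchy (seq x) (cauchy x)
(∣ x ∣ℝ) .seq i  = ℚ.∣ seq x i ∣
(∣ x ∣ℝ) .cauchy = abs-cauchy (seq x) (cauchy x)

_-ℝ_ : ℝ → ℝ → ℝ
x -ℝ y = x +ℝ (-ℝ y)

ℝ-rawRing : RawRing 0ℓ 0ℓ
ℝ-rawRing = record
  { Carrier = ℝ ; _≈_ = _≈ℝ_ ; _+_ = _+ℝ_ ; _*_ = _*ℝ_ ; -_ = -ℝ_
  ; 0# = 0ℝ ; 1# = 1ℝ }

open RawSemiringOps (RawRing.rawSemiring ℝ-rawRing) public
  using () renaming (_^_ to infixr 8 _^ℝ_; product to ∏ℝ)

------------------------------------------------------------------------
-- Complex numbers

infix 4 _≈ℂ_
infixl 7 _*ℂ_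
infixl 6 _+ℂ_

record ℂ : Set where
  constructor _+i_
  field
    re im : ℝ

open ℂ public

_≈ℂ_ : ℂ → ℂ → Set
z ≈ℂ w = re z ≈ℝ re w × im z ≈ℝ im w

0ℂ 1ℂ : ℂ
0ℂ = 0ℝ +i 0ℝ
1ℂ = 1ℝ +i 0ℝ

_+ℂ_ _*ℂ_ : ℂ → ℂ → ℂ
(z +ℂ w) .re = re z +ℝ re w
(z +ℂ w) .im = im z +ℝ im w
(z *ℂ w) .re = re z *ℝ re w -ℝ im z *ℝ im w
(z *ℂ w) .im = re z *ℝ im w +ℝ im z *ℝ re w

-ℂ_ conj : ℂ → ℂ
(-ℂ z)   .re = -ℝ re z
(-ℂ z)   .im = -ℝ im z
(conj z) .re = re z
(conj z) .im = -ℝ im z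

ℂ-rawRing : RawRing 0ℓ 0ℓ
ℂ-rawRing = record
  { Carrier = ℂ ; _≈_ = _≈ℂ_ ; _+_ = _+ℂ_ ; _*_ = _*ℂ_ ; -_ = -ℂ_
  ; 0# = 0ℂ ; 1# = 1ℂ }

open RawSemiringOps (RawRing.rawSemiring ℂ-rawRing) public
  using () renaming (sum to ∑ℂ)

------------------------------------------------------------------------
-- Partial Boolean functions

IsLeast : (ℕ → Set) → ℕ → Set
IsLeast P k = P k × (∀ l → P l → k ℕ.≤ l)

-- eval x ≡ nothing means that x lies outside the domain.
record PartialBoolean (m : ℕ) : Set where
  field
    eval     : Vec Sign m → Maybe Sign
    nonempty : ∃ λ x → ∃ λ s → eval x ≡ just s

open PartialBoolean public

-- ({-1,+1}^m)^n is identified with {-1,+1}^(nm).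
block : ∀ {n m} → Vec Sign (n ℕ.* m) → Fin n → Vec Sign m
block x i = tabulate λ j → lookup x (combine i j)

-- The product of all values, undefined if any of them is.
productMaybe : ∀ {n} → (Fin n → Maybe Sign) → Maybe Sign
productMaybe g = Vec.foldr′ (Maybe.zipWith Sign._*_) (just Sign.+) (tabulate g)

private
  productMaybe-just : ∀ {n} (g : Fin n → Maybe Sign) →
    (∀ i → ∃ λ s → g i ≡ just s) → ∃ λ s → productMaybe g ≡ just s
  productMaybe-just {zero}  g h = Sign.+ , refl
  productMaybe-just {suc n} g h
    with h zero | productMaybe-just (λ i → g (suc i)) (λ i → h (suc i))
  ... | s , eq | t , eq′ = s Sign.* t , cong₂ (Maybe.zipWith Sign._*_) eq eq′

  glue : ∀ {n m} → (Fin n → Vec Sign m) → Vec Sign (n ℕ.* m)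
  glue {n} {m} y = tabulate λ k → uncurry (λ i j → lookup (y i) j) (remQuot {n} m k)

  block-glue : ∀ {n m} (y : Fin n → Vec Sign m) i → block (glue y) i ≡ y i
  block-glue {n} {m} y i = trans
    (tabulate-cong λ j → trans
      (lookup∘tabulate (λ k → uncurry (λ i j → lookup (y i) j) (remQuot {n} m k))
        (combine i j))
      (cong (uncurry (λ i j → lookup (y i) j)) (Fin.remQuot-combine i j)))
    (tabulate∘lookup (y i))

⨂ : ∀ {n m} → (Fin n → PartialBoolean m) → PartialBoolean (n ℕ.* m)
⨂ f .eval x   = productMaybe λ i → eval (f i) (block x i)
⨂ f .nonempty = glue y , productMaybe-just _ λ i →
  subst (λ z → ∃ λ s → eval (f i) z ≡ just s) (sym (block-glue y i))
    (proj₂ (nonempty (f i)))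
  where y = λ i → proj₁ (nonempty (f i))

signℝ : Sign → ℝ
signℝ Sign.+ = 1ℝ
signℝ Sign.- = -ℝ 1ℝ

------------------------------------------------------------------------
-- Approximate degree

-- A finite sum of terms a · x₁^e₁ ⋯ x_m^e_m.
Polynomial : ℕ → Set
Polynomial m = List (ℝ × Vec ℕ m)

evalPoly : ∀ {m} → Polynomial m → Vec ℝ m → ℝ
evalPoly p x = List.foldr (λ (a , e) r →
  a *ℝ ∏ℝ (λ j → lookup x j ^ℝ lookup e j) +ℝ r) 0ℝ p

-- Coefficients may vanish, so this bounds the degree from above; a
-- polynomial function has degree at most d iff it has such a
-- representation, hence the least d below is the least degree.
DegreeAtMost : ∀ {m} → ℕ → Polynomial m → Set
DegreeAtMost d = All λ (_ , e) → Vec.sum e ℕ.≤ d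

Approximates : ∀ {m} → ℝ → PartialBoolean m → Polynomial m → Set
Approximates ε f p =
    (∀ x s → eval f x ≡ just s → ∣ signℝ s -ℝ evalPoly p (Vec.map signℝ x) ∣ℝ ≤ℝ ε)
  × (∀ x → eval f x ≡ nothing → ∣ evalPoly p (Vec.map signℝ x) ∣ℝ ≤ℝ 1ℝ +ℝ ε)

-- deg_ε(f) = d
ApproxDegree : ∀ {m} → ℝ → PartialBoolean m → ℕ → Set
ApproxDegree {m} ε f = IsLeast λ d →
  ∃ λ (p : Polynomial m) → DegreeAtMost d p × Approximates ε f p

------------------------------------------------------------------------
-- Quantum query algorithms

-- The computational basis |i,b,w⟩, with a workspace register of any
-- finite size W.
Basis : ℕ → ℕ → Set
Basis N W = Fin N × Bool × Fin W

State : ℕ → ℕ → Set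
State N W = Basis N W → ℂ

Operator : ℕ → ℕ → Set
Operator N W = Basis N W → Basis N W → ℂ

module _ {N W : ℕ} where

  _≟ᵇ_ : DecidableEquality (Basis N W)
  _≟ᵇ_ = ≡-dec Fin._≟_ (≡-dec Bool._≟_ Fin._≟_)

  ∑ : (Basis N W → ℂ) → ℂ
  ∑ g = ∑ℂ λ i → ∑ℂ (λ w → g (i , false , w)) +ℂ ∑ℂ (λ w → g (i , true , w))

  ⟨_∣_⟩ : State N W → State N W → ℂ
  ⟨ φ ∣ ψ ⟩ = ∑ λ a → conj (φ a) *ℂ ψ a

  _·_ : Operator N W → State N W → State N W
  (A · ψ) a = ∑ λ b → A a b *ℂ ψ b

  _⊙_ _⊞_ : Operator N W → Operator N W → Operator N W
  (A ⊙ B) a c = ∑ λ b → A a b *ℂ B b c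
  (A ⊞ B) a b = A a b +ℂ B a b

  _† : Operator N W → Operator N W
  (A †) a b = conj (A b a)

  I : Operator N W
  I a b = if does (a ≟ᵇ b) then 1ℂ else 0ℂ

  _≈ᵒ_ : Operator N W → Operator N W → Set
  A ≈ᵒ B = ∀ a b → A a b ≈ℂ B a b

  Unitary : Operator N W → Set
  Unitary U = ((U †) ⊙ U) ≈ᵒ I × (U ⊙ (U †)) ≈ᵒ I

  PositiveSemidefinite : Operator N W → Set
  PositiveSemidefinite E = ∀ v →
    0ℝ ≤ℝ re ⟨ v ∣ E · v ⟩ × im ⟨ v ∣ E · v ⟩ ≈ℝ 0ℝ

  bit : Sign → Bool
  bit Sign.- = true
  bit Sign.+ = false

  -- The map |i,b,w⟩ ↦ |i,b⊕bᵢ,w⟩ is an involution on basis vectors, so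
  -- the amplitude of O_x ψ at |i,b,w⟩ is that of ψ at |i,b⊕bᵢ,w⟩.
  oracle : Vec Sign N → State N W → State N W
  oracle x ψ (i , b , w) = ψ (i , b xor bit (lookup x i) , w)

  -- U_T O_x U_{T-1} O_x ⋯ U_1 O_x U_0 ψ
  run : ∀ T → (Fin (suc T) → Operator N W) → Vec Sign N → State N W → State N W
  run zero    U x ψ = U zero · ψ
  run (suc T) U x ψ = run T (λ j → U (suc j)) x (oracle x (U zero · ψ))

record QueryAlgorithm (N T : ℕ) : Set where
  field
    W          : ℕ
    start      : State N W
    start-unit : ⟨ start ∣ start ⟩ ≈ℂ 1ℂ
    U          : Fin (suc T) → Operator N W
    U-unitary  : ∀ j → Unitary (U j)
    -- A general (POVM) measurement with outcomes in {-1,+1}.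
    E          : Sign → Operator N W
    E-psd      : ∀ s → PositiveSemidefinite (E s)
    E-complete : (E Sign.- ⊞ E Sign.+) ≈ᵒ I

  final : Vec Sign N → State N W
  final x = run T U x start

  probability : Vec Sign N → Sign → ℝ
  probability x s = re ⟨ final x ∣ E s · final x ⟩

Computes : ∀ {N T} → ℝ → PartialBoolean N → QueryAlgorithm N T → Set
Computes ε f A = ∀ x s → eval f x ≡ just s →
  1ℝ -ℝ ε ≤ℝ QueryAlgorithm.probability A x s

-- T_ε(f) = t
QueryComplexity : ∀ {N} → ℝ → PartialBoolean N → ℕ → Set
QueryComplexity {N} ε f = IsLeast λ T →
  ∃ λ (A : QueryAlgorithm N T) → Computes ε f A

------------------------------------------------------------------------

sumOver : ∀ {n} → Subset n → (Fin n → ℕ) → ℕ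
sumOver S d = Vec.sum (tabulate λ i → if lookup S i then d i else 0)

{-# OPTIONS --safe #-}
-- The proof works with the i-th terms of all Cauchy sequences at once, for one large i,
-- hence with rational numbers only.  A T-query algorithm with advantage 2^-n yields a
-- polynomial p of degree at most 2T with |p| ≲ 1 on the cube and F·p ≳ 2·2^-n on dom F,
-- where F = ⨂ fᵢ.
--
-- Conversely, let δ = 6^-100.  A polynomial p with fᵢ·p ≥ 1 on dom fᵢ and |p| ≤ 1/δ on
-- the cube, composed with an iterate of u ↦ (3u - u³)/2, approximates fᵢ within 1/3; so
-- its degree is at least a constant multiple of deg_{1/3}(fᵢ).  Below that degree
-- linear programming duality provides a dual polynomial λᵢfᵢ + νᵢ, where λᵢ is a
-- probability measure on dom fᵢ and ‖νᵢ‖₁ ≤ δ, which is orthogonal to low degree.  For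
-- r = ⌊n/100⌋ consider
--   Ψ = Σ_{|B| ≤ r} (-1)^|B| ⨂_{i ∈ B} νᵢ ⊗ ⨂_{i ∉ B} (λᵢfᵢ + νᵢ).
-- Every term keeps at least 0.99n orthogonal factors, so Ψ annihilates all polynomials
-- of degree less than the minimum over S.  On the other hand the terms with 1 to r
-- factors ν cancel in Ψ, which therefore differs from ⨂ λᵢfᵢ by at most
-- 3^n δ^(r+1) < 2^-n in norm.  Pairing with p gives the bound.
module Submission where

open import Defs
open import Algebra.Bundles using (Semiring)
open import Algebra.Bundles.Raw using (RawRing)
import Algebra.Definitions.RawSemiring as RawSemiringOps
import Algebra.Properties.Semiring.Sum as SemiringSum
open import Algebra.Structures using (IsSemiring)
open import Data.Bool.Base using (Bool; true; false; _xor_; if_then_else_)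
open import Data.Empty using (⊥-elim)
open import Data.Fin.Base using (Fin; zero; suc; combine)
open import Data.Fin.Subset using (Subset; ∣_∣; inside; outside)
open import Data.Fin.Subset.Properties using (∣p∣≤n)
open import Data.Integer.Base as ℤ using (ℤ; +_)
import Data.Integer.DivMod as ℤ
import Data.Integer.Properties as ℤ
import Data.Integer.Solver as ℤSolver
open import Data.List.Base as List using (List; []; _∷_; _++_)
open import Data.List.Relation.Unary.All as All using (All; []; _∷_)
open import Data.List.Relation.Unary.All.Properties
  using (++⁺; ++⁻ˡ; ++⁻ʳ; map⁺; map⁻; concat⁺; concat⁻)
open import Data.Maybe.Base as Maybe using (Maybe; just; nothing)
open import Data.Nat.Base as ℕ using (ℕ; zero; suc; _≤_; z≤n; s≤s)
import Data.Nat.Properties as ℕ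
import Data.Nat.Solver as ℕSolver
open import Data.Product.Base using (∃; _×_; _,_; proj₁; proj₂)
open import Data.Rational.Base as ℚ using (ℚ; 0ℚ; 1ℚ; ½)
import Data.Rational.Properties as ℚ
open import Data.Rational.Solver using (module +-*-Solver)
open import Data.Rational.Unnormalised.Base as ℚᵘ using (ceiling)
import Data.Rational.Unnormalised.Properties as ℚᵘ
open import Data.Sign.Base as Sign using (Sign)
open import Data.Sum.Base as Sum using (_⊎_; inj₁; inj₂)
open import Data.Vec.Base as Vec using (Vec; []; _∷_; lookup)
open import Data.Vec.Properties using (lookup-++ˡ; lookup-++ʳ; tabulate-cong; tabulate∘lookup)
open import Function.Base using (_∘_)
open import Level using (0ℓ)
open import Relation.Binary.Core using (Rel)
open import Relation.Binary.Definitions using (tri<; tri≈; tri>)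
open import Relation.Binary.PropositionalEquality
  using (_≡_; refl; sym; trans; cong; cong₂; subst; subst₂; module ≡-Reasoning)
import Relation.Binary.Reasoning.Setoid as SetoidReasoning
open import Relation.Binary.Structures using (IsEquivalence)
open import Relation.Nullary.Decidable using (yes; no; does; dec-true; dec-false)
open import Relation.Nullary.Negation using (¬_)

open RawSemiringOps (RawRing.rawSemiring ℚ.+-*-rawRing) using (_^_)
open +-*-Solver using (solve; _:+_; _:*_; _:-_; :-_; _:=_; con)

-- Ordered-field arithmetic

-- The untruncated product ⨂ (λᵢfᵢ + νᵢ) is orthogonal up to the sum of all the degrees, but the
-- natural bound on its distance from ⨂ λᵢfᵢ is (1 + δ)^n - 1, hopeless against an advantage of
-- 2^-n. Sacrificing the orthogonality of up to r blocks buys an inclusion-exclusion that removes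
-- noise of orders 1 to r; the price is the one per cent of blocks missing from S. The value of δ
-- comes from counting. After expansion each block carries a signal, a ν from its dual polynomial,
-- or a ν because it lies in B, which gives at most 3^n terms, and each surviving error term has
-- norm at most δ^(r+1). Since 100(r+1) > n and ⅙·3 = ½, the total is at most ⅙·2^-n. As δ is
-- absolute, amplification costs only a constant factor in the degree, however large. Elimination
-- has to decide the signs of coefficients, which is possible for rationals but not for Cauchy
-- reals. One index of the sequences suffices because the cube is finite and the final comparison is
-- strict, with room for the slack η. The claim reduces to an inequality of natural numbers, which
-- is decidable, so it may be proved by contradiction.

0≤1 : 0ℚ ℚ.≤ 1ℚ
0≤1 = ℚ.nonNegative⁻¹ 1ℚ

≤-by : ∀ {a b} d → a ℚ.+ d ≡ b → 0ℚ ℚ.≤ d → a ℚ.≤ b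
≤-by {a} d eq 0≤d = subst₂ ℚ._≤_ (ℚ.+-identityʳ a) eq (ℚ.+-monoʳ-≤ a 0≤d)

0≤-diff : ∀ {a b} → a ℚ.≤ b → 0ℚ ℚ.≤ b ℚ.- a
0≤-diff {a} {b} a≤b =
  subst (ℚ._≤ b ℚ.- a) (ℚ.+-inverseʳ a) (ℚ.+-monoˡ-≤ (ℚ.- a) a≤b)

0≤+ : ∀ {a b} → 0ℚ ℚ.≤ a → 0ℚ ℚ.≤ b → 0ℚ ℚ.≤ a ℚ.+ b
0≤+ {a} {b} 0≤a 0≤b = subst (ℚ._≤ a ℚ.+ b) (ℚ.+-identityʳ 0ℚ) (ℚ.+-mono-≤ 0≤a 0≤b)

0≤* : ∀ {a b} → 0ℚ ℚ.≤ a → 0ℚ ℚ.≤ b → 0ℚ ℚ.≤ a ℚ.* b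
0≤* {a} {b} 0≤a 0≤b =
  subst (ℚ._≤ a ℚ.* b) (ℚ.*-zeroʳ a) (ℚ.*-monoˡ-≤-nonNeg a {{ℚ.nonNegative 0≤a}} 0≤b)

0<* : ∀ {a b} → 0ℚ ℚ.< a → 0ℚ ℚ.< b → 0ℚ ℚ.< a ℚ.* b
0<* {a} {b} 0<a 0<b =
  subst (ℚ._< a ℚ.* b) (ℚ.*-zeroʳ a) (ℚ.*-monoʳ-<-pos a {{ℚ.positive 0<a}} 0<b)

*-monoˡ : ∀ {c a b} → 0ℚ ℚ.≤ c → a ℚ.≤ b → c ℚ.* a ℚ.≤ c ℚ.* b
*-monoˡ {c} 0≤c = ℚ.*-monoˡ-≤-nonNeg c {{ℚ.nonNegative 0≤c}}

*-monoʳ : ∀ {c a b} → 0ℚ ℚ.≤ c → a ℚ.≤ b → a ℚ.* c ℚ.≤ b ℚ.* c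
*-monoʳ {c} 0≤c = ℚ.*-monoʳ-≤-nonNeg c {{ℚ.nonNegative 0≤c}}

*-mono : ∀ {a b c d} → 0ℚ ℚ.≤ a → 0ℚ ℚ.≤ d → a ℚ.≤ b → c ℚ.≤ d → a ℚ.* c ℚ.≤ b ℚ.* d
*-mono 0≤a 0≤d a≤b c≤d = ℚ.≤-trans (*-monoˡ 0≤a c≤d) (*-monoʳ 0≤d a≤b)

∣+∣≤ : ∀ {a b c d} → ℚ.∣ a ∣ ℚ.≤ c → ℚ.∣ b ∣ ℚ.≤ d → ℚ.∣ a ℚ.+ b ∣ ℚ.≤ c ℚ.+ d
∣+∣≤ {a} {b} p q = ℚ.≤-trans (ℚ.∣p+q∣≤∣p∣+∣q∣ a b) (ℚ.+-mono-≤ p q)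

∣*∣≤ : ∀ a {b c} → ℚ.∣ b ∣ ℚ.≤ c → ℚ.∣ a ℚ.* b ∣ ℚ.≤ ℚ.∣ a ∣ ℚ.* c
∣*∣≤ a {b} p = subst (ℚ._≤ _) (sym (ℚ.∣p*q∣≡∣p∣*∣q∣ a b)) (*-monoˡ (ℚ.0≤∣p∣ a) p)

p≤∣p∣ : ∀ p → p ℚ.≤ ℚ.∣ p ∣
p≤∣p∣ p with ℚ.≤-total 0ℚ p
... | inj₁ 0≤p = ℚ.≤-reflexive (sym (ℚ.0≤p⇒∣p∣≡p 0≤p))
... | inj₂ p≤0 = ℚ.≤-trans p≤0 (ℚ.0≤∣p∣ p)

-p≤∣p∣ : ∀ p → ℚ.- p ℚ.≤ ℚ.∣ p ∣
-p≤∣p∣ p = subst (ℚ.- p ℚ.≤_) (ℚ.∣-p∣≡∣p∣ p) (p≤∣p∣ (ℚ.- p))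

∣∣≤-from : ∀ {p b} → p ℚ.≤ b → ℚ.- p ℚ.≤ b → ℚ.∣ p ∣ ℚ.≤ b
∣∣≤-from {p} {b} p≤b -p≤b with ℚ.∣p∣≡p∨∣p∣≡-p p
... | inj₁ eq = subst (ℚ._≤ b) (sym eq) p≤b
... | inj₂ eq = subst (ℚ._≤ b) (sym eq) -p≤b

1/-scale : ∀ a → 0ℚ ℚ.< a → ∃ λ a⁻¹ → 0ℚ ℚ.< a⁻¹ × a⁻¹ ℚ.* a ≡ 1ℚ
1/-scale a 0<a = ℚ.1/ a , ℚ.positive⁻¹ (ℚ.1/ a) {{ℚ.1/pos⇒pos a}} , ℚ.*-inverseˡ a
  where instance
    a-pos = ℚ.positive 0<a
    a-nonZero = ℚ.pos⇒nonZero a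

^-+ : ∀ a j k → a ^ (j ℕ.+ k) ≡ a ^ j ℚ.* a ^ k
^-+ a zero    k = sym (ℚ.*-identityˡ _)
^-+ a (suc j) k = trans (cong (a ℚ.*_) (^-+ a j k)) (sym (ℚ.*-assoc a _ _))

0≤^ : ∀ {a} → 0ℚ ℚ.≤ a → ∀ k → 0ℚ ℚ.≤ a ^ k
0≤^ 0≤a zero    = 0≤1
0≤^ 0≤a (suc k) = 0≤* 0≤a (0≤^ 0≤a k)

0<^ : ∀ {a} → 0ℚ ℚ.< a → ∀ k → 0ℚ ℚ.< a ^ k
0<^ 0<a zero    = ℚ.positive⁻¹ 1ℚ
0<^ 0<a (suc k) = 0<* 0<a (0<^ 0<a k)

-- Functions on the cube of bounded degree

Fun : ℕ → Set
Fun N = Vec Sign N → ℚ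

sgn : Sign → ℚ
sgn Sign.+ = 1ℚ
sgn Sign.- = ℚ.- 1ℚ

mono : ∀ {N} → Vec ℕ N → Fun N
mono []      []      = 1ℚ
mono (k ∷ e) (s ∷ x) = sgn s ^ k ℚ.* mono e x

-- The bound on the degree is strict, so that only the zero function
-- satisfies Deg 0.
data Deg {N} (d : ℕ) : Fun N → Set where
  monomial : ∀ e → Vec.sum e ℕ.< d → Deg d (mono e)
  null     : Deg d (λ _ → 0ℚ)
  add      : ∀ {g h} → Deg d g → Deg d h → Deg d (λ x → g x ℚ.+ h x)
  scale    : ∀ c {g} → Deg d g → Deg d (λ x → c ℚ.* g x)
  ext      : ∀ {g h} → (∀ x → g x ≡ h x) → Deg d g → Deg d h

Deg-mono : ∀ {N d d′} {g : Fun N} → d ℕ.≤ d′ → Deg d g → Deg d′ g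
Deg-mono d≤d′ (monomial e lt) = monomial e (ℕ.<-≤-trans lt d≤d′)
Deg-mono d≤d′ null            = null
Deg-mono d≤d′ (add p q)       = add (Deg-mono d≤d′ p) (Deg-mono d≤d′ q)
Deg-mono d≤d′ (scale c p)     = scale c (Deg-mono d≤d′ p)
Deg-mono d≤d′ (ext eq p)      = ext eq (Deg-mono d≤d′ p)

Deg0⇒≡0 : ∀ {N} {g : Fun N} → Deg 0 g → ∀ x → g x ≡ 0ℚ
Deg0⇒≡0 null        x = refl
Deg0⇒≡0 (add p q)   x = cong₂ ℚ._+_ (Deg0⇒≡0 p x) (Deg0⇒≡0 q x)
Deg0⇒≡0 (scale c p) x = trans (cong (c ℚ.*_) (Deg0⇒≡0 p x)) (ℚ.*-zeroʳ c)
Deg0⇒≡0 (ext eq p)  x = trans (sym (eq x)) (Deg0⇒≡0 p x)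

sum-replicate-0 : ∀ N → Vec.sum (Vec.replicate N 0) ≡ 0
sum-replicate-0 zero    = refl
sum-replicate-0 (suc N) = sum-replicate-0 N

mono-replicate-0 : ∀ {N} (x : Vec Sign N) → mono (Vec.replicate N 0) x ≡ 1ℚ
mono-replicate-0 []      = refl
mono-replicate-0 (s ∷ x) = trans (ℚ.*-identityˡ _) (mono-replicate-0 x)

Deg-const : ∀ {N} c → Deg {N} 1 (λ _ → c)
Deg-const {N} c = ext (λ x → trans (cong (c ℚ.*_) (mono-replicate-0 x)) (ℚ.*-identityʳ c))
  (scale c (monomial (Vec.replicate N 0) (s≤s (ℕ.≤-reflexive (sum-replicate-0 N)))))

unit : ∀ {N} → Fin N → Vec ℕ N
unit zero    = 1 ∷ Vec.replicate _ 0
unit (suc j) = 0 ∷ unit j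

sum-unit : ∀ {N} (j : Fin N) → Vec.sum (unit j) ≡ 1
sum-unit {suc N} zero = cong suc (sum-replicate-0 N)
sum-unit (suc j) = sum-unit j

mono-unit : ∀ {N} (j : Fin N) x → mono (unit j) x ≡ sgn (lookup x j)
mono-unit zero    (s ∷ x) = trans (cong₂ ℚ._*_ (ℚ.*-identityʳ (sgn s)) (mono-replicate-0 x))
  (ℚ.*-identityʳ (sgn s))
mono-unit (suc j) (s ∷ x) = trans (ℚ.*-identityˡ _) (mono-unit j x)

Deg-variable : ∀ {N} (j : Fin N) → Deg 2 (λ x → sgn (lookup x j))
Deg-variable j = ext (mono-unit j) (monomial (unit j) (s≤s (ℕ.≤-reflexive (sum-unit j))))

mono-* : ∀ {N} (e e′ : Vec ℕ N) x →
  mono e x ℚ.* mono e′ x ≡ mono (Vec.zipWith ℕ._+_ e e′) x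
mono-* []      []       []      = refl
mono-* (j ∷ e) (k ∷ e′) (s ∷ x) = trans
  (solve 4 (λ a b c d → (a :* b) :* (c :* d) := (a :* c) :* (b :* d)) refl
    (sgn s ^ j) (mono e x) (sgn s ^ k) (mono e′ x))
  (cong₂ ℚ._*_ (sym (^-+ (sgn s) j k)) (mono-* e e′ x))

sum-zipWith-+ : ∀ {N} (e e′ : Vec ℕ N) →
  Vec.sum (Vec.zipWith ℕ._+_ e e′) ≡ Vec.sum e ℕ.+ Vec.sum e′
sum-zipWith-+ []      []       = refl
sum-zipWith-+ (j ∷ e) (k ∷ e′) = trans (cong (j ℕ.+ k ℕ.+_) (sum-zipWith-+ e e′))
  (interchange j k (Vec.sum e) (Vec.sum e′))
  where
  open import Algebra.Properties.CommutativeSemigroup ℕ.+-commutativeSemigroup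
    using (interchange)

-- Both bounds are strict, so `suc a` and `suc b` mean degrees at most a and b. Exponents simply
-- add: that signs square to 1 could only lower the degree.
Deg-* : ∀ {N a b} {g h : Fun N} → Deg (suc a) g → Deg (suc b) h →
  Deg (suc (a ℕ.+ b)) (λ x → g x ℚ.* h x)
Deg-* {a = a} {b} (monomial e (s≤s lt)) q = by-second q
  where
  by-second : ∀ {h} → Deg (suc b) h → Deg (suc (a ℕ.+ b)) (λ x → mono e x ℚ.* h x)
  by-second (monomial e′ (s≤s lt′)) = ext (λ x → sym (mono-* e e′ x))
    (monomial (Vec.zipWith ℕ._+_ e e′) (s≤s (ℕ.≤-trans (ℕ.≤-reflexive (sum-zipWith-+ e e′)) (ℕ.+-mono-≤ lt lt′))))
  by-second null = ext (λ x → sym (ℚ.*-zeroʳ (mono e x))) null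
  by-second (add {g} {h} p q) = ext (λ x → sym (ℚ.*-distribˡ-+ (mono e x) (g x) (h x)))
    (add (by-second p) (by-second q))
  by-second (scale c {g} p) = ext
    (λ x → solve 3 (λ c m g → c :* (m :* g) := m :* (c :* g)) refl c (mono e x) (g x))
    (scale c (by-second p))
  by-second (ext eq p) = ext (λ x → cong (mono e x ℚ.*_) (eq x)) (by-second p)
Deg-* {h = h} null q = ext (λ x → sym (ℚ.*-zeroˡ (h x))) null
Deg-* {h = k} (add {g} {h} p p′) q = ext (λ x → sym (ℚ.*-distribʳ-+ (k x) (g x) (h x)))
  (add (Deg-* p q) (Deg-* p′ q))
Deg-* {h = h} (scale c {g} p) q = ext (λ x → sym (ℚ.*-assoc c (g x) (h x)))
  (scale c (Deg-* p q))
Deg-* {h = h} (ext eq p) q = ext (λ x → cong (ℚ._* h x) (eq x)) (Deg-* p q)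

Deg-neg : ∀ {N d} {g : Fun N} → Deg d g → Deg d (λ x → ℚ.- g x)
Deg-neg {g = g} p = ext (λ x → solve 1 (λ a → con (ℚ.- 1ℚ) :* a := :- a) refl (g x))
  (scale (ℚ.- 1ℚ) p)

Deg-sub : ∀ {N d} {g h : Fun N} → Deg d g → Deg d h → Deg d (λ x → g x ℚ.- h x)
Deg-sub p q = add p (Deg-neg q)

mono-++ : ∀ {m k} (e : Vec ℕ m) (e′ : Vec ℕ k) x y →
  mono (e Vec.++ e′) (x Vec.++ y) ≡ mono e x ℚ.* mono e′ y
mono-++ []      e′ []      y = sym (ℚ.*-identityˡ _)
mono-++ (j ∷ e) e′ (s ∷ x) y =
  trans (cong (sgn s ^ j ℚ.*_) (mono-++ e e′ x y)) (sym (ℚ.*-assoc (sgn s ^ j) _ _))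

sum-++ : ∀ {m k} (e : Vec ℕ m) (e′ : Vec ℕ k) →
  Vec.sum (e Vec.++ e′) ≡ Vec.sum e ℕ.+ Vec.sum e′
sum-++ []      e′ = refl
sum-++ (j ∷ e) e′ = trans (cong (j ℕ.+_) (sum-++ e e′)) (sym (ℕ.+-assoc j _ _))

-- Real polynomials with rational coefficients

seq-^ : ∀ a k i → seq (a ^ℝ k) i ≡ seq a i ^ k
seq-^ a zero    i = refl
seq-^ a (suc k) i = cong (seq a i ℚ.*_) (seq-^ a k i)

seq-signℝ : ∀ s i → seq (signℝ s) i ≡ sgn s
seq-signℝ Sign.+ i = refl
seq-signℝ Sign.- i = refl

seq-mono : ∀ {N} (e : Vec ℕ N) x i →
  seq (∏ℝ (λ j → lookup (Vec.map signℝ x) j ^ℝ lookup e j)) i ≡ mono e x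
seq-mono []      []      i = refl
seq-mono (k ∷ e) (s ∷ x) i = cong₂ ℚ._*_
  (trans (seq-^ (signℝ s) k i) (cong (_^ k) (seq-signℝ s i))) (seq-mono e x i)

scalePoly : ∀ {N} → ℚ → Polynomial N → Polynomial N
scalePoly c = List.map λ (a , e) → fromℚ c *ℝ a , e

DegreeAtMost-scale : ∀ {N d} c (p : Polynomial N) →
  DegreeAtMost d p → DegreeAtMost d (scalePoly c p)
DegreeAtMost-scale c []      []       = []
DegreeAtMost-scale c (_ ∷ p) (h ∷ hs) = h ∷ DegreeAtMost-scale c p hs

seq-evalPoly-scale : ∀ {N} c (p : Polynomial N) x i →
  seq (evalPoly (scalePoly c p) x) i ≡ c ℚ.* seq (evalPoly p x) i
seq-evalPoly-scale c []            x i = sym (ℚ.*-zeroʳ c)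
seq-evalPoly-scale c ((a , e) ∷ p) x i =
  pull-out (seq a i) (seq (∏ℝ (λ j → lookup x j ^ℝ lookup e j)) i) (seq-evalPoly-scale c p x i)
  where
  pull-out : ∀ a m {r r′} → r′ ≡ c ℚ.* r → c ℚ.* a ℚ.* m ℚ.+ r′ ≡ c ℚ.* (a ℚ.* m ℚ.+ r)
  pull-out a m {r} eq = trans (cong (c ℚ.* a ℚ.* m ℚ.+_) eq)
    (solve 4 (λ c a m r → c :* a :* m :+ c :* r := c :* (a :* m :+ r)) refl c a m r)

seq-evalPoly-++ : ∀ {N} (p q : Polynomial N) x i →
  seq (evalPoly (p ++ q) x) i ≡ seq (evalPoly p x) i ℚ.+ seq (evalPoly q x) i
seq-evalPoly-++ []            q x i = sym (ℚ.+-identityˡ _)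
seq-evalPoly-++ ((a , e) ∷ p) q x i = trans
  (cong (seq (a *ℝ ∏ℝ (λ j → lookup x j ^ℝ lookup e j)) i ℚ.+_) (seq-evalPoly-++ p q x i))
  (sym (ℚ.+-assoc (seq (a *ℝ ∏ℝ (λ j → lookup x j ^ℝ lookup e j)) i) _ _))

scalePoly-correct : ∀ {N} c {g : Fun N} p →
  (∀ x i → seq (evalPoly p (Vec.map signℝ x)) i ≡ g x) →
  ∀ x i → seq (evalPoly (scalePoly c p) (Vec.map signℝ x)) i ≡ c ℚ.* g x
scalePoly-correct c p ep x i =
  trans (seq-evalPoly-scale c p (Vec.map signℝ x) i) (cong (c ℚ.*_) (ep x i))

++-correct : ∀ {N} {g h : Fun N} p q →
  (∀ x i → seq (evalPoly p (Vec.map signℝ x)) i ≡ g x) →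
  (∀ x i → seq (evalPoly q (Vec.map signℝ x)) i ≡ h x) →
  ∀ x i → seq (evalPoly (p ++ q) (Vec.map signℝ x)) i ≡ g x ℚ.+ h x
++-correct {g = g} p q ep eq x i = trans (seq-evalPoly-++ p q (Vec.map signℝ x) i)
  (trans (cong (ℚ._+ seq (evalPoly q (Vec.map signℝ x)) i) (ep x i)) (cong (g x ℚ.+_) (eq x i)))

monomial-correct : ∀ {N} (e : Vec ℕ N) x i →
  seq (evalPoly ((1ℝ , e) ∷ []) (Vec.map signℝ x)) i ≡ mono e x
monomial-correct e x i =
  trans (one-term (seq (∏ℝ (λ j → lookup (Vec.map signℝ x) j ^ℝ lookup e j)) i)) (seq-mono e x i)
  where
  one-term : ∀ a → 1ℚ ℚ.* a ℚ.+ 0ℚ ≡ a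
  one-term a = trans (ℚ.+-identityʳ (1ℚ ℚ.* a)) (ℚ.*-identityˡ a)

-- The coefficients are constant sequences, so the value is the same rational at every index;
-- inequalities between rationals then carry over to `Approximates` from index 0 on.
Deg⇒polynomial : ∀ {N d} {g : Fun N} → Deg (suc d) g → ∃ λ (p : Polynomial N) →
  DegreeAtMost d p × (∀ x i → seq (evalPoly p (Vec.map signℝ x)) i ≡ g x)
Deg⇒polynomial (monomial e (s≤s lt)) = (1ℝ , e) ∷ [] , lt ∷ [] , monomial-correct e
Deg⇒polynomial null = [] , [] , λ _ _ → refl
Deg⇒polynomial (add {g} {h} P Q) =
  let p , dp , ep = Deg⇒polynomial P
      q , dq , eq = Deg⇒polynomial Q
  in p ++ q , ++⁺ dp dq , ++-correct {g = g} {h} p q ep eq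
Deg⇒polynomial (scale c {g} P) =
  let p , dp , ep = Deg⇒polynomial P
  in scalePoly c p , DegreeAtMost-scale c p dp , scalePoly-correct c {g} p ep
Deg⇒polynomial (ext g≗h P) =
  let p , dp , ep = Deg⇒polynomial P
  in p , dp , λ x i → trans (ep x i) (g≗h x)

-- Farkas' lemma by Fourier–Motzkin elimination

-- The step of Fourier-Motzkin elimination that chooses a value for one unknown. It starts below all
-- upper bounds and is raised to each lower bound in turn; the hypothesis keeps it below the upper
-- bounds.
between : ∀ {C : Set} (l u : C → ℚ) ps ns →
  All (λ p → All (λ n → l p ℚ.≤ u n) ns) ps →
  ∃ λ c → All (λ p → l p ℚ.≤ c) ps × All (λ n → c ℚ.≤ u n) ns
between l u []       ns hs = let c , c≤ = below ns in c , [] , c≤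
  where
  below : ∀ ns → ∃ λ c → All (λ n → c ℚ.≤ u n) ns
  below []       = 0ℚ , []
  below (n ∷ ns) =
    let c , c≤ = below ns
    in c ℚ.⊓ u n , ℚ.p⊓q≤q c (u n) ∷ All.map (ℚ.≤-trans (ℚ.p⊓q≤p c (u n))) c≤
between l u (p ∷ ps) ns (h ∷ hs) =
  let c , ≤c , c≤ = between l u ps ns hs
  in c ℚ.⊔ l p ,
     ℚ.p≤q⊔p c (l p) ∷ All.map (λ q → ℚ.≤-trans q (ℚ.p≤p⊔q c (l p))) ≤c ,
     All.zipWith (λ (a , b) → ℚ.⊔-lub a b) (c≤ , h)

-- A constraint c stands for the inequality rhs c ≤ Σ_e x_e · coef e c in
-- unknowns x_e.
module Farkas {E C : Set} (coef : E → C → ℚ) (rhs : C → ℚ)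
  (_⊕_ : C → C → C) (_⊙_ : ℚ → C → C)
  (coef-⊕ : ∀ e a b → coef e (a ⊕ b) ≡ coef e a ℚ.+ coef e b)
  (coef-⊙ : ∀ e q a → coef e (q ⊙ a) ≡ q ℚ.* coef e a)
  (rhs-⊕ : ∀ a b → rhs a ℚ.+ rhs b ℚ.≤ rhs (a ⊕ b))
  (rhs-⊙ : ∀ q a → 0ℚ ℚ.< q → q ℚ.* rhs a ℚ.≤ rhs (q ⊙ a))
  where

  value : List (ℚ × E) → C → ℚ
  value []            a = 0ℚ
  value ((x , e) ∷ s) a = x ℚ.* coef e a ℚ.+ value s a

  Satisfies : List (ℚ × E) → C → Set
  Satisfies s a = rhs a ℚ.≤ value s a

  value-⊕ : ∀ s a b → value s (a ⊕ b) ≡ value s a ℚ.+ value s b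
  value-⊕ []            a b = sym (ℚ.+-identityʳ 0ℚ)
  value-⊕ ((x , e) ∷ s) a b = trans
    (cong₂ (λ u v → x ℚ.* u ℚ.+ v) (coef-⊕ e a b) (value-⊕ s a b))
    (solve 5 (λ x u u′ v v′ → x :* (u :+ u′) :+ (v :+ v′) := (x :* u :+ v) :+ (x :* u′ :+ v′))
      refl x (coef e a) (coef e b) (value s a) (value s b))

  value-⊙ : ∀ s q a → value s (q ⊙ a) ≡ q ℚ.* value s a
  value-⊙ []            q a = sym (ℚ.*-zeroʳ q)
  value-⊙ ((x , e) ∷ s) q a = trans
    (cong₂ (λ u v → x ℚ.* u ℚ.+ v) (coef-⊙ e q a) (value-⊙ s q a))
    (solve 4 (λ x q u v → x :* (q :* u) :+ q :* v := q :* (x :* u :+ v))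
      refl x q (coef e a) (value s a))

  Satisfies-⊙⁻ : ∀ s q a → 0ℚ ℚ.< q → Satisfies s (q ⊙ a) → Satisfies s a
  Satisfies-⊙⁻ s q a 0<q h = ℚ.*-cancelˡ-≤-pos q {{ℚ.positive 0<q}}
    (ℚ.≤-trans (rhs-⊙ q a 0<q) (subst (rhs (q ⊙ a) ℚ.≤_) (value-⊙ s q a) h))

  record Convex (P : C → Set) : Set where
    field
      ⊕-closed : ∀ {a b} → P a → P b → P (a ⊕ b)
      ⊙-closed : ∀ {q a} → 0ℚ ℚ.< q → P a → P (q ⊙ a)

  open Convex

  -- Scaling the coefficient of `e` to ±1 makes the plain sum of a positive and a negative
  -- constraint free of `e`. The field `satisfied` leads back from the scaled constraints to the
  -- given ones.
  record Split (P : C → Set) (e : E) (as : List C) : Set where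
    field
      zs ps ns  : List C
      zs-P      : All (λ a → P a × coef e a ≡ 0ℚ) zs
      ps-P      : All (λ a → P a × coef e a ≡ 1ℚ) ps
      ns-P      : All (λ a → P a × coef e a ≡ ℚ.- 1ℚ) ns
      satisfied : ∀ s → All (Satisfies s) zs → All (Satisfies s) ps → All (Satisfies s) ns →
                  All (Satisfies s) as

  split : ∀ {P} → Convex P → ∀ e as → All P as → Split P e as
  split conv e [] [] = record
    { zs = [] ; ps = [] ; ns = [] ; zs-P = [] ; ps-P = [] ; ns-P = []
    ; satisfied = λ _ _ _ _ → [] }
  split {P} conv e (a ∷ as) (pa ∷ pas) = by-sign (ℚ.<-cmp (coef e a) 0ℚ)
    where
    open Split (split conv e as pas)

    by-sign : _ → Split P e (a ∷ as)
    by-sign (tri≈ _ eq _) = record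
      { zs = a ∷ zs ; ps = ps ; ns = ns
      ; zs-P = (pa , eq) ∷ zs-P ; ps-P = ps-P ; ns-P = ns-P
      ; satisfied = λ { s (h ∷ hz) hp hn → h ∷ satisfied s hz hp hn } }
    by-sign (tri> _ _ 0<c) =
      let q , 0<q , q*c≡1 = 1/-scale (coef e a) 0<c in record
      { zs = zs ; ps = q ⊙ a ∷ ps ; ns = ns
      ; zs-P = zs-P ; ns-P = ns-P
      ; ps-P = (⊙-closed conv 0<q pa , trans (coef-⊙ e q a) q*c≡1) ∷ ps-P
      ; satisfied = λ { s hz (h ∷ hp) hn → Satisfies-⊙⁻ s q a 0<q h ∷ satisfied s hz hp hn } }
    by-sign (tri< c<0 _ _) =
      let q , 0<q , q*-c≡1 = 1/-scale (ℚ.- coef e a) (ℚ.neg-antimono-< c<0) in record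
      { zs = zs ; ps = ps ; ns = q ⊙ a ∷ ns
      ; zs-P = zs-P ; ps-P = ps-P
      ; ns-P = (⊙-closed conv 0<q pa , trans (coef-⊙ e q a)
          (trans (solve 2 (λ q c → q :* c := :- (q :* (:- c))) refl q (coef e a))
            (cong ℚ.-_ q*-c≡1))) ∷ ns-P
      ; satisfied = λ { s hz hp (h ∷ hn) → Satisfies-⊙⁻ s q a 0<q h ∷ satisfied s hz hp hn } }

  combos : List C → List C → List C
  combos []       ns = []
  combos (p ∷ ps) ns = List.map (p ⊕_) ns ++ combos ps ns

  combos⁺ : ∀ {P Q R : C → Set} → (∀ {a b} → P a → Q b → R (a ⊕ b)) →
    ∀ {ps ns} → All P ps → All Q ns → All R (combos ps ns)
  combos⁺ f []       hn = []
  combos⁺ f (h ∷ hp) hn = ++⁺ (map⁺ (All.map (f h) hn)) (combos⁺ f hp hn)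

  combos⁻ : ∀ {R : C → Set} ps ns → All R (combos ps ns) → All (λ p → All (λ n → R (p ⊕ n)) ns) ps
  combos⁻ []       ns h = []
  combos⁻ (p ∷ ps) ns h =
    map⁻ (++⁻ˡ (List.map (p ⊕_) ns) h) ∷ combos⁻ ps ns (++⁻ʳ (List.map (p ⊕_) ns) h)

  satisfies-cons : ∀ x e s a k → coef e a ≡ k → rhs a ℚ.≤ x ℚ.* k ℚ.+ value s a →
    Satisfies ((x , e) ∷ s) a
  satisfies-cons x e s a k eq = subst (λ k → rhs a ℚ.≤ x ℚ.* k ℚ.+ value s a) (sym eq)

  -- Derived constraints arise by sums and positive multiples only, so any property closed under
  -- both survives to the certificate. The induction exploits this: each elimination strengthens `P`
  -- by the vanishing of one more coefficient.
  farkas : ∀ es {P} → Convex P → ∀ as → All P as →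
    (∃ λ s → List.map proj₂ s ≡ es × All (Satisfies s) as) ⊎
    (∃ λ a → P a × All (λ e → coef e a ≡ 0ℚ) es × 0ℚ ℚ.< rhs a)
  farkas [] conv [] [] = inj₁ ([] , refl , [])
  farkas [] conv (a ∷ as) (pa ∷ pas) with rhs a ℚ.≤? 0ℚ | farkas [] conv as pas
  ... | no  rhs≰0 | _                      = inj₂ (a , pa , [] , ℚ.≰⇒> rhs≰0)
  ... | yes _     | inj₂ r                 = inj₂ r
  ... | yes rhs≤0 | inj₁ ([] , refl , sat) = inj₁ ([] , refl , rhs≤0 ∷ sat)
  farkas (e ∷ es) {P} conv as pas = finish
    (farkas es conv′ (zs ++ combos ps ns) (++⁺ zs-P (combos⁺ cancel ps-P ns-P)))
    where
    open Split (split conv e as pas)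

    P′ : C → Set
    P′ a = P a × coef e a ≡ 0ℚ

    conv′ : Convex P′
    conv′ .⊕-closed {a} {b} (pa , za) (pb , zb) =
      ⊕-closed conv pa pb ,
      trans (coef-⊕ e a b) (trans (cong₂ ℚ._+_ za zb) (ℚ.+-identityʳ 0ℚ))
    conv′ .⊙-closed {q} {a} 0<q (pa , za) =
      ⊙-closed conv 0<q pa ,
      trans (coef-⊙ e q a) (trans (cong (q ℚ.*_) za) (ℚ.*-zeroʳ q))

    cancel : ∀ {a b} → P a × coef e a ≡ 1ℚ → P b × coef e b ≡ ℚ.- 1ℚ → P′ (a ⊕ b)
    cancel {a} {b} (pa , eq) (pb , eq′) =
      ⊕-closed conv pa pb ,
      trans (coef-⊕ e a b) (trans (cong₂ ℚ._+_ eq eq′) (ℚ.+-inverseʳ 1ℚ))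

    extend : ∀ s → All (Satisfies s) (zs ++ combos ps ns) →
      ∃ λ x → All (Satisfies ((x , e) ∷ s)) as
    extend s sat = x , satisfied ((x , e) ∷ s)
      (All.zipWith (λ {a} ((_ , eq) , h) → satisfies-cons x e s a 0ℚ eq (at-zero x h))
        (zs-P , ++⁻ˡ zs sat))
      (All.zipWith (λ {a} ((_ , eq) , h) → satisfies-cons x e s a 1ℚ eq (at-pos x h))
        (ps-P , proj₁ (proj₂ choice)))
      (All.zipWith (λ {a} ((_ , eq) , h) → satisfies-cons x e s a (ℚ.- 1ℚ) eq (at-neg x h))
        (ns-P , proj₂ (proj₂ choice)))
      where
      -- With coefficients 1 in `a` and -1 in `b`, the left side is the lower bound that `a` puts on
      -- the eliminated unknown, and the right side the upper bound that `b` puts on it.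
      gap : ∀ {a b} → Satisfies s (a ⊕ b) → rhs a ℚ.- value s a ℚ.≤ value s b ℚ.- rhs b
      gap {a} {b} h = ≤-by (value s a ℚ.+ value s b ℚ.- (rhs a ℚ.+ rhs b))
        (solve 4 (λ ra va rb vb → (ra :- va) :+ (va :+ vb :- (ra :+ rb)) := vb :- rb) refl
          (rhs a) (value s a) (rhs b) (value s b))
        (0≤-diff (ℚ.≤-trans (rhs-⊕ a b) (subst (rhs (a ⊕ b) ℚ.≤_) (value-⊕ s a b) h)))

      choice = between (λ a → rhs a ℚ.- value s a) (λ a → value s a ℚ.- rhs a) ps ns
        (All.map (All.map gap) (combos⁻ ps ns (++⁻ʳ zs sat)))

      x = proj₁ choice

      at-zero : ∀ x {r v} → r ℚ.≤ v → r ℚ.≤ x ℚ.* 0ℚ ℚ.+ v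
      at-zero x {r} {v} = subst (r ℚ.≤_)
        (solve 2 (λ x v → v := x :* con 0ℚ :+ v) refl x v)

      at-pos : ∀ x {r v} → r ℚ.- v ℚ.≤ x → r ℚ.≤ x ℚ.* 1ℚ ℚ.+ v
      at-pos x {r} {v} h = ≤-by (x ℚ.- (r ℚ.- v))
        (solve 3 (λ x r v → r :+ (x :- (r :- v)) := x :* con 1ℚ :+ v) refl x r v) (0≤-diff h)

      at-neg : ∀ x {r v} → x ℚ.≤ v ℚ.- r → r ℚ.≤ x ℚ.* (ℚ.- 1ℚ) ℚ.+ v
      at-neg x {r} {v} h = ≤-by (v ℚ.- r ℚ.- x)
        (solve 3 (λ x r v → r :+ (v :- r :- x) := x :* con (ℚ.- 1ℚ) :+ v) refl x r v) (0≤-diff h)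

    finish : _ → _
    finish (inj₁ (s , eq , sat)) =
      let x , sat′ = extend s sat in inj₁ ((x , e) ∷ s , cong (e ∷_) eq , sat′)
    finish (inj₂ (a , (pa , za) , zs , 0<rhs)) = inj₂ (a , pa , za ∷ zs , 0<rhs)

-- Finitely supported signed measures

Measure : Set → Set
Measure X = List (ℚ × X)

∫ : ∀ {X} → Measure X → (X → ℚ) → ℚ
∫ []            g = 0ℚ
∫ ((w , x) ∷ μ) g = w ℚ.* g x ℚ.+ ∫ μ g

-- Points may repeat, and weights at the same point do not cancel here. So this is an upper bound
-- for the total variation, exact for nonnegative weights, and it is additive under concatenation.
norm : ∀ {X} → Measure X → ℚ
norm []            = 0ℚ
norm ((w , _) ∷ μ) = ℚ.∣ w ∣ ℚ.+ norm μ

infixr 7 _⊛_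
_⊛_ : ∀ {X} → ℚ → Measure X → Measure X
q ⊛ μ = List.map (λ (w , x) → q ℚ.* w , x) μ

NonNeg : ∀ {X} → Measure X → Set
NonNeg = All (λ (w , _) → 0ℚ ℚ.≤ w)

∫-cong : ∀ {X} (μ : Measure X) {g h} → (∀ x → g x ≡ h x) → ∫ μ g ≡ ∫ μ h
∫-cong []            eq = refl
∫-cong ((w , x) ∷ μ) eq = cong₂ (λ a b → w ℚ.* a ℚ.+ b) (eq x) (∫-cong μ eq)

∫-0 : ∀ {X} (μ : Measure X) → ∫ μ (λ _ → 0ℚ) ≡ 0ℚ
∫-0 []            = refl
∫-0 ((w , x) ∷ μ) = cong₂ ℚ._+_ (ℚ.*-zeroʳ w) (∫-0 μ)

∫-+ : ∀ {X} (μ : Measure X) g h → ∫ μ (λ x → g x ℚ.+ h x) ≡ ∫ μ g ℚ.+ ∫ μ h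
∫-+ []            g h = sym (ℚ.+-identityʳ 0ℚ)
∫-+ ((w , x) ∷ μ) g h = trans (cong (w ℚ.* (g x ℚ.+ h x) ℚ.+_) (∫-+ μ g h))
  (solve 5 (λ w a b c d → w :* (a :+ b) :+ (c :+ d) := (w :* a :+ c) :+ (w :* b :+ d)) refl
    w (g x) (h x) (∫ μ g) (∫ μ h))

∫-* : ∀ {X} (μ : Measure X) c g → ∫ μ (λ x → c ℚ.* g x) ≡ c ℚ.* ∫ μ g
∫-* []            c g = sym (ℚ.*-zeroʳ c)
∫-* ((w , x) ∷ μ) c g = trans (cong (w ℚ.* (c ℚ.* g x) ℚ.+_) (∫-* μ c g))
  (solve 4 (λ w c a b → w :* (c :* a) :+ c :* b := c :* (w :* a :+ b)) refl w c (g x) (∫ μ g))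

∫-sub : ∀ {X} (μ : Measure X) g h → ∫ μ (λ x → g x ℚ.- h x) ≡ ∫ μ g ℚ.- ∫ μ h
∫-sub []            g h = sym (ℚ.+-inverseʳ 0ℚ)
∫-sub ((w , x) ∷ μ) g h = trans (cong (w ℚ.* (g x ℚ.- h x) ℚ.+_) (∫-sub μ g h))
  (solve 5 (λ w a b c d → w :* (a :- b) :+ (c :- d) := (w :* a :+ c) :- (w :* b :+ d)) refl
    w (g x) (h x) (∫ μ g) (∫ μ h))

∫-++ : ∀ {X} (μ ν : Measure X) g → ∫ (μ ++ ν) g ≡ ∫ μ g ℚ.+ ∫ ν g
∫-++ []            ν g = sym (ℚ.+-identityˡ (∫ ν g))
∫-++ ((w , x) ∷ μ) ν g = trans (cong (w ℚ.* g x ℚ.+_) (∫-++ μ ν g))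
  (sym (ℚ.+-assoc (w ℚ.* g x) (∫ μ g) (∫ ν g)))

∫-⊛ : ∀ {X} q (μ : Measure X) g → ∫ (q ⊛ μ) g ≡ q ℚ.* ∫ μ g
∫-⊛ q []            g = sym (ℚ.*-zeroʳ q)
∫-⊛ q ((w , x) ∷ μ) g = trans (cong (q ℚ.* w ℚ.* g x ℚ.+_) (∫-⊛ q μ g))
  (solve 4 (λ q w a b → q :* w :* a :+ q :* b := q :* (w :* a :+ b)) refl q w (g x) (∫ μ g))

norm-++ : ∀ {X} (μ ν : Measure X) → norm (μ ++ ν) ≡ norm μ ℚ.+ norm ν
norm-++ []            ν = sym (ℚ.+-identityˡ (norm ν))
norm-++ ((w , _) ∷ μ) ν = trans (cong (ℚ.∣ w ∣ ℚ.+_) (norm-++ μ ν))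
  (sym (ℚ.+-assoc ℚ.∣ w ∣ (norm μ) (norm ν)))

norm-⊛ : ∀ {X} q (μ : Measure X) → 0ℚ ℚ.≤ q → norm (q ⊛ μ) ≡ q ℚ.* norm μ
norm-⊛ q []            0≤q = sym (ℚ.*-zeroʳ q)
norm-⊛ q ((w , _) ∷ μ) 0≤q = trans
  (cong₂ ℚ._+_
    (trans (ℚ.∣p*q∣≡∣p∣*∣q∣ q w) (cong (ℚ._* ℚ.∣ w ∣) (ℚ.0≤p⇒∣p∣≡p 0≤q)))
    (norm-⊛ q μ 0≤q))
  (sym (ℚ.*-distribˡ-+ q ℚ.∣ w ∣ (norm μ)))

0≤norm : ∀ {X} (μ : Measure X) → 0ℚ ℚ.≤ norm μ
0≤norm []            = ℚ.≤-refl
0≤norm ((w , _) ∷ μ) = 0≤+ (ℚ.0≤∣p∣ w) (0≤norm μ)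

NonNeg-⊛ : ∀ {X} {q} {μ : Measure X} → 0ℚ ℚ.≤ q → NonNeg μ → NonNeg (q ⊛ μ)
NonNeg-⊛ 0≤q h = map⁺ (All.map (0≤* 0≤q) h)

∫-bound : ∀ {X} (μ : Measure X) {g B} → (∀ x → ℚ.∣ g x ∣ ℚ.≤ B) → ℚ.∣ ∫ μ g ∣ ℚ.≤ norm μ ℚ.* B
∫-bound []            {B = B} h = ℚ.≤-reflexive (sym (ℚ.*-zeroˡ B))
∫-bound ((w , x) ∷ μ) {g} {B} h = subst (ℚ.∣ w ℚ.* g x ℚ.+ ∫ μ g ∣ ℚ.≤_) (sym (ℚ.*-distribʳ-+ B ℚ.∣ w ∣ (norm μ)))
  (∣+∣≤ (∣*∣≤ w (h x)) (∫-bound μ h))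

∫-lower : ∀ {X} (μ : Measure X) {g β} → NonNeg μ → (∀ x → β ℚ.≤ g x) → norm μ ℚ.* β ℚ.≤ ∫ μ g
∫-lower []            {β = β} []       h = ℚ.≤-reflexive (ℚ.*-zeroˡ β)
∫-lower ((w , x) ∷ μ) {g} {β} (0≤w ∷ n) h =
  subst (ℚ._≤ w ℚ.* g x ℚ.+ ∫ μ g) (sym (ℚ.*-distribʳ-+ β ℚ.∣ w ∣ (norm μ)))
    (ℚ.+-mono-≤ (subst (λ v → v ℚ.* β ℚ.≤ w ℚ.* g x) (sym (ℚ.0≤p⇒∣p∣≡p 0≤w)) (*-monoˡ 0≤w (h x)))
      (∫-lower μ n h))

-- Duality for one function

DomainPoint : ∀ {m} → PartialBoolean m → Set
DomainPoint f = ∃ λ x → ∃ λ s → eval f x ≡ just s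

-- Integrating this against λ gives the pairing of `g` with fλ.
signed : ∀ {m} {f : PartialBoolean m} → Fun m → DomainPoint f → ℚ
signed g (x , s , _) = sgn s ℚ.* g x

-- A dual polynomial f·λ + ν orthogonal to degree < D, with λ a probability
-- measure on the domain of f and ν small.
record Dual {m} (f : PartialBoolean m) (δ : ℚ) (D : ℕ) : Set where
  field
    signal        : Measure (DomainPoint f)
    noise         : Measure (Vec Sign m)
    signal-nonNeg : NonNeg signal
    signal-norm   : norm signal ≡ 1ℚ
    noise-norm    : norm noise ℚ.≤ δ
    orthogonal    : ∀ e → Vec.sum e ℕ.< D →
                    ∫ signal (signed {f = f} (mono e)) ℚ.+ ∫ noise (mono e) ≡ 0ℚ

cube : ∀ N → List (Vec Sign N)
cube zero    = [] ∷ []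
cube (suc N) = List.map (Sign.+ ∷_) (cube N) ++ List.map (Sign.- ∷_) (cube N)

cube-all : ∀ {N} {Q : Vec Sign N → Set} → All Q (cube N) → ∀ x → Q x
cube-all (q ∷ []) []           = q
cube-all {suc N} h (Sign.+ ∷ x) = cube-all (map⁻ (++⁻ˡ (List.map (Sign.+ ∷_) (cube N)) h)) x
cube-all {suc N} h (Sign.- ∷ x) = cube-all (map⁻ (++⁻ʳ (List.map (Sign.+ ∷_) (cube N)) h)) x

sucHead : ∀ {N} → Vec ℕ (suc N) → Vec ℕ (suc N)
sucHead (k ∷ e) = suc k ∷ e

exponents : ∀ N → ℕ → List (Vec ℕ N)
exponents zero    zero    = []
exponents zero    (suc D) = [] ∷ []
exponents (suc N) zero    = []
exponents (suc N) (suc D) =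
  List.map (0 ∷_) (exponents N (suc D)) ++ List.map sucHead (exponents (suc N) D)

exponents-sum : ∀ N D → All (λ e → Vec.sum e ℕ.< D) (exponents N D)
exponents-sum zero    zero    = []
exponents-sum zero    (suc D) = s≤s z≤n ∷ []
exponents-sum (suc N) zero    = []
exponents-sum (suc N) (suc D) = ++⁺ (map⁺ (exponents-sum N (suc D)))
  (map⁺ (All.map (λ { {_ ∷ _} lt → s≤s lt }) (exponents-sum (suc N) D)))

exponents-all : ∀ {N} D {Q : Vec ℕ N → Set} → All Q (exponents N D) →
  ∀ e → Vec.sum e ℕ.< D → Q e
exponents-all (suc D) (q ∷ []) [] lt = q
exponents-all {suc N} (suc D) h (zero ∷ e) lt =
  exponents-all (suc D) (map⁻ (++⁻ˡ (List.map (0 ∷_) (exponents N (suc D))) h)) e lt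
exponents-all {suc N} (suc D) h (suc k ∷ e) (s≤s lt) =
  exponents-all D (map⁻ (++⁻ʳ (List.map (0 ∷_) (exponents N (suc D))) h)) (k ∷ e) lt

Separates : ∀ {m} → PartialBoolean m → ℚ → Fun m → Set
Separates f M p = (∀ x s → eval f x ≡ just s → 1ℚ ℚ.≤ sgn s ℚ.* p x) × (∀ x → ℚ.∣ p x ∣ ℚ.≤ M)

module _ {m} (f : PartialBoolean m) (δ M : ℚ) (0≤δ : 0ℚ ℚ.≤ δ) (0≤M : 0ℚ ℚ.≤ M)
  (δ*M≡1 : δ ℚ.* M ≡ 1ℚ) where

  private
    C : Set
    C = Measure (DomainPoint f) × Measure (Vec Sign m)

    pair : Fun m → C → ℚ
    pair p (σ , ν) = ∫ σ (signed {f = f} p) ℚ.+ ∫ ν p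

    -- A unit mass in σ encodes f·p ≥ 1 at a point; a mass 1 or -1 in ν encodes p ≥ -M or -p ≥ -M
    -- there. As `norm` is additive, this formula gives the right-hand side of every combination
    -- too, and its positivity is the comparison of norms that a dual polynomial requires.
    rhs : C → ℚ
    rhs (σ , ν) = norm σ ℚ.- M ℚ.* norm ν

    _⊕_ : C → C → C
    (σ , ν) ⊕ (σ′ , ν′) = σ ++ σ′ , ν ++ ν′

    _⊡_ : ℚ → C → C
    q ⊡ (σ , ν) = q ⊛ σ , q ⊛ ν

    pair-⊕ : ∀ p a b → pair p (a ⊕ b) ≡ pair p a ℚ.+ pair p b
    pair-⊕ p (σ , ν) (σ′ , ν′) = trans
      (cong₂ ℚ._+_ (∫-++ σ σ′ (signed {f = f} p)) (∫-++ ν ν′ p))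
      (solve 4 (λ a b c d → (a :+ b) :+ (c :+ d) := (a :+ c) :+ (b :+ d)) refl
        (∫ σ (signed {f = f} p)) (∫ σ′ (signed {f = f} p)) (∫ ν p) (∫ ν′ p))

    pair-⊙ : ∀ p q a → pair p (q ⊡ a) ≡ q ℚ.* pair p a
    pair-⊙ p q (σ , ν) = trans
      (cong₂ ℚ._+_ (∫-⊛ q σ (signed {f = f} p)) (∫-⊛ q ν p))
      (sym (ℚ.*-distribˡ-+ q (∫ σ (signed {f = f} p)) (∫ ν p)))

    rhs-⊕ : ∀ a b → rhs a ℚ.+ rhs b ≡ rhs (a ⊕ b)
    rhs-⊕ (σ , ν) (σ′ , ν′) = sym (trans
      (cong₂ (λ u v → u ℚ.- M ℚ.* v) (norm-++ σ σ′) (norm-++ ν ν′))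
      (solve 5 (λ M a b c d → (a :+ b) :- M :* (c :+ d) := (a :- M :* c) :+ (b :- M :* d)) refl
        M (norm σ) (norm σ′) (norm ν) (norm ν′)))

    rhs-⊙ : ∀ q a → 0ℚ ℚ.< q → q ℚ.* rhs a ≡ rhs (q ⊡ a)
    rhs-⊙ q (σ , ν) 0<q = sym (trans
      (cong₂ (λ u v → u ℚ.- M ℚ.* v) (norm-⊛ q σ (ℚ.<⇒≤ 0<q)) (norm-⊛ q ν (ℚ.<⇒≤ 0<q)))
      (solve 4 (λ M q a b → q :* a :- M :* (q :* b) := q :* (a :- M :* b)) refl
        M q (norm σ) (norm ν)))

    open Farkas (λ e → pair (mono e)) rhs _⊕_ _⊡_
      (λ e → pair-⊕ (mono e)) (λ e → pair-⊙ (mono e))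
      (λ a b → ℚ.≤-reflexive (rhs-⊕ a b)) (λ q a 0<q → ℚ.≤-reflexive (rhs-⊙ q a 0<q))

    boundsAt : Vec Sign m → List C
    boundsAt x = ([] , (1ℚ , x) ∷ []) ∷ ([] , (ℚ.- 1ℚ , x) ∷ []) ∷ []

    constraintsAt : ∀ x y → eval f x ≡ y → List C
    constraintsAt x (just s) eq = ((1ℚ , x , s , eq) ∷ [] , []) ∷ boundsAt x
    constraintsAt x nothing  eq = boundsAt x

    constraints : List C
    constraints = List.concat (List.map (λ x → constraintsAt x (eval f x) refl) (cube m))

    P : C → Set
    P (σ , ν) = NonNeg σ

    P-convex : Convex P
    P-convex = record
      { ⊕-closed = ++⁺
      ; ⊙-closed = λ {_} {a} 0<q → NonNeg-⊛ {μ = proj₁ a} (ℚ.<⇒≤ 0<q) }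

    constraints-P : All P constraints
    constraints-P = concat⁺ (map⁺ (All.universal (λ x → at x (eval f x) refl) (cube m)))
      where
      at : ∀ x y eq → All P (constraintsAt x y eq)
      at x (just s) eq = (0≤1 ∷ []) ∷ [] ∷ [] ∷ []
      at x nothing  eq = [] ∷ [] ∷ []

    poly : List (ℚ × Vec ℕ m) → Fun m
    poly []            x = 0ℚ
    poly ((c , e) ∷ s) x = c ℚ.* mono e x ℚ.+ poly s x

    Deg-poly : ∀ {D} s → All (λ (_ , e) → Vec.sum e ℕ.< D) s → Deg D (poly s)
    Deg-poly []            []       = null
    Deg-poly ((c , e) ∷ s) (h ∷ hs) = add (scale c (monomial e h)) (Deg-poly s hs)

    value≡pair : ∀ s a → value s a ≡ pair (poly s) a
    value≡pair []            (σ , ν) = sym (cong₂ ℚ._+_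
      (trans (∫-cong σ (λ (_ , t , _) → ℚ.*-zeroʳ (sgn t))) (∫-0 σ)) (∫-0 ν))
    value≡pair ((c , e) ∷ s) (σ , ν) = trans
      (cong (c ℚ.* pair (mono e) (σ , ν) ℚ.+_) (value≡pair s (σ , ν)))
      (trans
        (solve 5 (λ c a b u v → c :* (a :+ b) :+ (u :+ v) := (c :* a :+ u) :+ (c :* b :+ v)) refl
          c (∫ σ (signed {f = f} (mono e))) (∫ ν (mono e)) (∫ σ (signed {f = f} (poly s))) (∫ ν (poly s)))
        (sym (cong₂ ℚ._+_
          (trans (∫-cong σ λ (x , t , _) →
              solve 4 (λ t c a b → t :* (c :* a :+ b) := c :* (t :* a) :+ t :* b) refl
                (sgn t) c (mono e x) (poly s x))
            (trans (∫-+ σ (λ z → c ℚ.* signed {f = f} (mono e) z) (signed {f = f} (poly s)))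
              (cong (ℚ._+ ∫ σ (signed {f = f} (poly s))) (∫-* σ c (signed {f = f} (mono e))))))
          (trans (∫-+ ν (λ x → c ℚ.* mono e x) (poly s))
            (cong (ℚ._+ ∫ ν (poly s)) (∫-* ν c (mono e)))))))

    at-noise : ∀ p w x → rhs ([] , (w , x) ∷ []) ℚ.≤ pair p ([] , (w , x) ∷ []) →
      ℚ.∣ w ∣ ≡ 1ℚ → ℚ.- (w ℚ.* p x) ℚ.≤ M
    at-noise p w x h ∣w∣≡1 = ≤-by _
      (solve 3 (λ M w p → :- (w :* p) :+ ((con 0ℚ :+ (w :* p :+ con 0ℚ)) :-
        (con 0ℚ :- M :* (con 1ℚ :+ con 0ℚ))) := M) refl M w (p x))
      (0≤-diff (subst (λ v → 0ℚ ℚ.- M ℚ.* (v ℚ.+ 0ℚ) ℚ.≤ pair p ([] , (w , x) ∷ [])) ∣w∣≡1 h))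

    at-signal : ∀ p x s eq → rhs ((1ℚ , x , s , eq) ∷ [] , []) ℚ.≤ pair p ((1ℚ , x , s , eq) ∷ [] , []) →
      1ℚ ℚ.≤ sgn s ℚ.* p x
    at-signal p x s eq = subst₂ ℚ._≤_
      (solve 1 (λ M → con 1ℚ :+ con 0ℚ :- M :* con 0ℚ := con 1ℚ) refl M)
      (solve 1 (λ a → con 1ℚ :* a :+ con 0ℚ :+ con 0ℚ := a) refl (sgn s ℚ.* p x))

    separates : ∀ s → All (Satisfies s) constraints → Separates f M (poly s)
    separates s sat = (λ x t eq → proj₁ (at x) t eq) , (λ x → proj₂ (at x))
      where
      p = poly s

      to-pair : ∀ {a} → Satisfies s a → rhs a ℚ.≤ pair p a
      to-pair {a} = subst (rhs a ℚ.≤_) (value≡pair s a)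

      bounded-at : ∀ x → Satisfies s ([] , (1ℚ , x) ∷ []) → Satisfies s ([] , (ℚ.- 1ℚ , x) ∷ []) →
        ℚ.∣ p x ∣ ℚ.≤ M
      bounded-at x h⁺ h⁻ = ∣∣≤-from
        (subst (ℚ._≤ M) (solve 1 (λ a → :- (con (ℚ.- 1ℚ) :* a) := a) refl (p x))
          (at-noise p (ℚ.- 1ℚ) x (to-pair h⁻) refl))
        (subst (ℚ._≤ M) (solve 1 (λ a → :- (con 1ℚ :* a) := :- a) refl (p x))
          (at-noise p 1ℚ x (to-pair h⁺) refl))

      from-constraints : ∀ x y eq → All (Satisfies s) (constraintsAt x y eq) →
        (∀ t → y ≡ just t → 1ℚ ℚ.≤ sgn t ℚ.* p x) × ℚ.∣ p x ∣ ℚ.≤ M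
      from-constraints x (just t) eq (h ∷ h⁺ ∷ h⁻ ∷ []) =
        (λ { _ refl → at-signal p x t eq (to-pair h) }) , bounded-at x h⁺ h⁻
      from-constraints x nothing  eq (h⁺ ∷ h⁻ ∷ []) = (λ _ ()) , bounded-at x h⁺ h⁻

      at : ∀ x → (∀ t → eval f x ≡ just t → 1ℚ ℚ.≤ sgn t ℚ.* p x) × ℚ.∣ p x ∣ ℚ.≤ M
      at x = from-constraints x (eval f x) refl
        (cube-all {Q = λ x → All (Satisfies s) (constraintsAt x (eval f x) refl)}
          (map⁻ (concat⁻ sat)) x)

    -- A positive right-hand side says ‖σ‖ > M‖ν‖. Hence ‖σ‖ can be divided out, which leaves a
    -- probability measure and a noise of norm at most 1/M = δ.
    normalise : ∀ D a → P a → All (λ e → pair (mono e) a ≡ 0ℚ) (exponents m D) → 0ℚ ℚ.< rhs a →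
      Dual f δ D
    normalise D (σ , ν) 0≤σ orth 0<rhs = record
      { signal = q ⊛ σ ; noise = q ⊛ ν
      ; signal-nonNeg = NonNeg-⊛ {μ = σ} 0≤q 0≤σ
      ; signal-norm = trans (norm-⊛ q σ 0≤q) q*norm≡1
      ; noise-norm = subst (ℚ._≤ δ) (sym (norm-⊛ q ν 0≤q)) small
      ; orthogonal = λ e lt → trans (pair-⊙ (mono e) q (σ , ν))
          (trans (cong (q ℚ.*_) (exponents-all D {Q = λ e → pair (mono e) (σ , ν) ≡ 0ℚ} orth e lt))
            (ℚ.*-zeroʳ q)) }
      where
      0<norm : 0ℚ ℚ.< norm σ
      0<norm = ℚ.<-≤-trans 0<rhs (≤-by (M ℚ.* norm ν)
        (solve 2 (λ a b → a :- b :+ b := a) refl (norm σ) (M ℚ.* norm ν)) (0≤* 0≤M (0≤norm ν)))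
      inverse = 1/-scale (norm σ) 0<norm
      q = proj₁ inverse
      0≤q = ℚ.<⇒≤ (proj₁ (proj₂ inverse))
      q*norm≡1 = proj₂ (proj₂ inverse)
      small : q ℚ.* norm ν ℚ.≤ δ
      small = subst₂ ℚ._≤_
        (trans (solve 4 (λ δ M q a → δ :* (q :* (M :* a)) := (δ :* M) :* (q :* a)) refl δ M q (norm ν))
          (trans (cong (ℚ._* (q ℚ.* norm ν)) δ*M≡1) (ℚ.*-identityˡ (q ℚ.* norm ν))))
        (trans (cong (δ ℚ.*_) q*norm≡1) (ℚ.*-identityʳ δ))
        (*-monoˡ 0≤δ (*-monoˡ 0≤q (≤-by (rhs (σ , ν))
          (solve 2 (λ a b → b :+ (a :- b) := a) refl (norm σ) (M ℚ.* norm ν)) (ℚ.<⇒≤ 0<rhs))))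

    polynomial-case : ∀ D s → List.map proj₂ s ≡ exponents m D → All (Satisfies s) constraints →
      ∃ λ p → Deg D p × Separates f M p
    polynomial-case D s eq sat = poly s ,
      Deg-poly s (map⁻ (subst (All (λ e → Vec.sum e ℕ.< D)) (sym eq) (exponents-sum m D))) ,
      separates s sat

  duality : ∀ D → (∃ λ p → Deg D p × Separates f M p) ⊎ Dual f δ D
  duality D = Sum.map (λ (s , eq , sat) → polynomial-case D s eq sat)
    (λ (a , pa , orth , 0<rhs) → normalise D a pa orth 0<rhs)
    (farkas (exponents m D) {P} P-convex constraints constraints-P)

-- Amplification

ι : ℕ → ℚ
ι zero    = 0ℚ
ι (suc k) = 1ℚ ℚ.+ ι k

0≤ι : ∀ k → 0ℚ ℚ.≤ ι k
0≤ι zero    = ℚ.≤-refl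
0≤ι (suc k) = 0≤+ 0≤1 (0≤ι k)

ι-+ : ∀ j k → ι (j ℕ.+ k) ≡ ι j ℚ.+ ι k
ι-+ zero    k = sym (ℚ.+-identityˡ (ι k))
ι-+ (suc j) k = trans (cong (1ℚ ℚ.+_) (ι-+ j k)) (sym (ℚ.+-assoc 1ℚ (ι j) (ι k)))

ι-* : ∀ j k → ι (j ℕ.* k) ≡ ι j ℚ.* ι k
ι-* zero    k = sym (ℚ.*-zeroˡ (ι k))
ι-* (suc j) k = trans (ι-+ k (j ℕ.* k)) (trans (cong (ι k ℚ.+_) (ι-* j k))
  (solve 2 (λ j k → k :+ j :* k := (con 1ℚ :+ j) :* k) refl (ι j) (ι k)))

-- The induction rests on (1 - b)(1 + (k+1)b) = 1 + kb - (k+1)b². It bounds a decaying power without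
-- logarithms or division.
bernoulli : ∀ b k → 0ℚ ℚ.≤ b → b ℚ.≤ 1ℚ → (1ℚ ℚ.- b) ^ k ℚ.* (1ℚ ℚ.+ ι k ℚ.* b) ℚ.≤ 1ℚ
bernoulli b zero    0≤b b≤1 = ℚ.≤-reflexive
  (solve 1 (λ b → con 1ℚ :* (con 1ℚ :+ con 0ℚ :* b) := con 1ℚ) refl b)
bernoulli b (suc k) 0≤b b≤1 = ℚ.≤-trans
  (≤-by (p ℚ.* (b ℚ.* b ℚ.* (1ℚ ℚ.+ ι k)))
    (solve 3 (λ b p i → (con 1ℚ :- b) :* p :* (con 1ℚ :+ (con 1ℚ :+ i) :* b) :+ p :* (b :* b :* (con 1ℚ :+ i))
      := p :* (con 1ℚ :+ i :* b)) refl b p (ι k))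
    (0≤* (0≤^ (0≤-diff b≤1) k) (0≤* (0≤* 0≤b 0≤b) (0≤ι (suc k)))))
  (bernoulli b k 0≤b b≤1)
  where p = (1ℚ ℚ.- b) ^ k

-- The odd cubic with fixed points ±1 and zero slope there: 1 - amp u = ½(1 - u)²(2 + u). It
-- therefore maps [-1, 1] to itself and pushes positive values towards 1, negative ones towards -1.
amp : ℚ → ℚ
amp u = ½ ℚ.* (ι 3 ℚ.* u ℚ.- u ℚ.* (u ℚ.* u))

amp^ : ℕ → ℚ → ℚ
amp^ zero    u = u
amp^ (suc k) u = amp (amp^ k u)

amp-sign : ∀ s u → amp (sgn s ℚ.* u) ≡ sgn s ℚ.* amp u
amp-sign Sign.+ u = trans (cong amp (ℚ.*-identityˡ u)) (sym (ℚ.*-identityˡ (amp u)))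
amp-sign Sign.- u = solve 1 (λ u →
  con ½ :* (con (ι 3) :* (con (ℚ.- 1ℚ) :* u) :-
    (con (ℚ.- 1ℚ) :* u) :* ((con (ℚ.- 1ℚ) :* u) :* (con (ℚ.- 1ℚ) :* u)))
  := con (ℚ.- 1ℚ) :* (con ½ :* (con (ι 3) :* u :- u :* (u :* u)))) refl u

amp^-sign : ∀ s k u → amp^ k (sgn s ℚ.* u) ≡ sgn s ℚ.* amp^ k u
amp^-sign s zero    u = refl
amp^-sign s (suc k) u = trans (cong amp (amp^-sign s k u)) (amp-sign s (amp^ k u))

0≤½ : 0ℚ ℚ.≤ ½
0≤½ = ℚ.nonNegative⁻¹ ½

amp-upper : ∀ {u} → ℚ.- 1ℚ ℚ.≤ u → amp u ℚ.≤ 1ℚ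
amp-upper {u} -1≤u = ≤-by (½ ℚ.* (((1ℚ ℚ.- u) ℚ.* (1ℚ ℚ.- u)) ℚ.* (1ℚ ℚ.+ (u ℚ.- ℚ.- 1ℚ))))
  (solve 1 (λ u → con ½ :* (con (ι 3) :* u :- u :* (u :* u)) :+
    con ½ :* (((con 1ℚ :- u) :* (con 1ℚ :- u)) :* (con 1ℚ :+ (u :- con (ℚ.- 1ℚ)))) := con 1ℚ) refl u)
  (0≤* 0≤½ (0≤* (0≤square (1ℚ ℚ.- u)) (0≤+ 0≤1 (0≤-diff -1≤u))))
  where
  0≤square : ∀ a → 0ℚ ℚ.≤ a ℚ.* a
  0≤square a with ℚ.≤-total 0ℚ a
  ... | inj₁ 0≤a = 0≤* 0≤a 0≤a
  ... | inj₂ a≤0 = subst (0ℚ ℚ.≤_) (solve 1 (λ a → (:- a) :* (:- a) := a :* a) refl a)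
    (0≤* (ℚ.neg-antimono-≤ a≤0) (ℚ.neg-antimono-≤ a≤0))

amp-lower : ∀ {u} → u ℚ.≤ 1ℚ → ℚ.- 1ℚ ℚ.≤ amp u
amp-lower {u} u≤1 = subst₂ ℚ._≤_ refl (trans (cong ℚ.-_ (amp-sign Sign.- u))
    (solve 1 (λ a → :- (con (ℚ.- 1ℚ) :* a) := a) refl (amp u)))
  (ℚ.neg-antimono-≤ (amp-upper { (ℚ.- 1ℚ) ℚ.* u }
    (subst (ℚ.- 1ℚ ℚ.≤_) (solve 1 (λ a → :- a := con (ℚ.- 1ℚ) :* a) refl u) (ℚ.neg-antimono-≤ u≤1))))

amp^-bounds : ∀ k {u} → ℚ.- 1ℚ ℚ.≤ u → u ℚ.≤ 1ℚ → ℚ.- 1ℚ ℚ.≤ amp^ k u × amp^ k u ℚ.≤ 1ℚ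
amp^-bounds zero    -1≤u u≤1 = -1≤u , u≤1
amp^-bounds (suc k) -1≤u u≤1 =
  let l , u = amp^-bounds k -1≤u u≤1 in amp-lower u , amp-upper l

amp-≥ : ∀ {a u} → 0ℚ ℚ.≤ a → a ℚ.≤ u → u ℚ.≤ 1ℚ → a ℚ.≤ amp u
amp-≥ {a} {u} 0≤a a≤u u≤1 = ℚ.≤-trans a≤u
  (≤-by (½ ℚ.* (u ℚ.* ((1ℚ ℚ.- u) ℚ.* (1ℚ ℚ.+ u))))
    (solve 1 (λ u → u :+ con ½ :* (u :* ((con 1ℚ :- u) :* (con 1ℚ :+ u))) :=
      con ½ :* (con (ι 3) :* u :- u :* (u :* u))) refl u)
    (0≤* 0≤½ (0≤* 0≤u (0≤* (0≤-diff u≤1) (0≤+ 0≤1 0≤u)))))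
  where 0≤u = ℚ.≤-trans 0≤a a≤u

-- 1 - amp u = (1 - u)(1 - ½u - ½u²)
amp-gap : ∀ {a u} → 0ℚ ℚ.≤ a → a ℚ.≤ u → u ℚ.≤ 1ℚ →
  1ℚ ℚ.- amp u ℚ.≤ (1ℚ ℚ.- ½ ℚ.* a) ℚ.* (1ℚ ℚ.- u)
amp-gap {a} {u} 0≤a a≤u u≤1 = ≤-by ((1ℚ ℚ.- u) ℚ.* (½ ℚ.* (u ℚ.- a) ℚ.+ ½ ℚ.* (u ℚ.* u)))
  (solve 2 (λ a u → con 1ℚ :- con ½ :* (con (ι 3) :* u :- u :* (u :* u)) :+
      (con 1ℚ :- u) :* (con ½ :* (u :- a) :+ con ½ :* (u :* u))
    := (con 1ℚ :- con ½ :* a) :* (con 1ℚ :- u)) refl a u)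
  (0≤* (0≤-diff u≤1) (0≤+ (0≤* 0≤½ (0≤-diff a≤u)) (0≤* 0≤½ (0≤* 0≤u 0≤u))))
  where 0≤u = ℚ.≤-trans 0≤a a≤u

-- The iterates never fall below `a`, so every step contracts the distance to 1 by the same factor 1
-- - ½a.
amp^-gap : ∀ k {a u} → 0ℚ ℚ.≤ a → a ℚ.≤ u → u ℚ.≤ 1ℚ →
  a ℚ.≤ amp^ k u × 1ℚ ℚ.- amp^ k u ℚ.≤ (1ℚ ℚ.- ½ ℚ.* a) ^ k ℚ.* (1ℚ ℚ.- u)
amp^-gap zero {u = u} 0≤a a≤u u≤1 = a≤u , ℚ.≤-reflexive (sym (ℚ.*-identityˡ (1ℚ ℚ.- u)))
amp^-gap (suc k) {a} {u} 0≤a a≤u u≤1 =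
  amp-≥ 0≤a (proj₁ ih) v≤1 ,
  ℚ.≤-trans (amp-gap 0≤a (proj₁ ih) v≤1)
    (subst ((1ℚ ℚ.- ½ ℚ.* a) ℚ.* (1ℚ ℚ.- amp^ k u) ℚ.≤_)
      (sym (ℚ.*-assoc (1ℚ ℚ.- ½ ℚ.* a) ((1ℚ ℚ.- ½ ℚ.* a) ^ k) (1ℚ ℚ.- u)))
      (*-monoˡ 0≤1-½a (proj₂ ih)))
  where
  ih = amp^-gap k 0≤a a≤u u≤1
  v≤1 = proj₂ (amp^-bounds k (ℚ.≤-trans (ℚ.≤-trans (ℚ.neg-antimono-≤ 0≤1) 0≤a) a≤u) u≤1)
  0≤1-½a : 0ℚ ℚ.≤ 1ℚ ℚ.- ½ ℚ.* a
  0≤1-½a = subst (0ℚ ℚ.≤_)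
    (solve 1 (λ a → con ½ :* (con 1ℚ :- a) :+ con ½ := con 1ℚ :- con ½ :* a) refl a)
    (0≤+ (0≤* 0≤½ (0≤-diff (ℚ.≤-trans a≤u u≤1))) 0≤½)

⅓ : ℚ
⅓ = + 1 ℚ./ 3

-- With k = 4j steps, k·½a = 2, so the Bernoulli bound gives (1 - ½a)^k ≤ 1/(1 + 2), exactly the
-- required third.
amplified : ∀ j a → a ℚ.* ι j ≡ 1ℚ → 0ℚ ℚ.≤ a → ∀ u → a ℚ.≤ u → u ℚ.≤ 1ℚ →
  1ℚ ℚ.- amp^ (4 ℕ.* j) u ℚ.≤ ⅓
amplified j a aj≡1 0≤a u a≤u u≤1 = ℚ.≤-trans (proj₂ (amp^-gap k 0≤a a≤u u≤1))
  (ℚ.≤-trans (*-monoˡ 0≤p (≤-by u (solve 1 (λ u → con 1ℚ :- u :+ u := con 1ℚ) refl u) (ℚ.≤-trans 0≤a a≤u)))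
    (subst (ℚ._≤ ⅓) (sym (ℚ.*-identityʳ p)) p≤⅓))
  where
  k = 4 ℕ.* j
  p = (1ℚ ℚ.- ½ ℚ.* a) ^ k
  0≤b : 0ℚ ℚ.≤ ½ ℚ.* a
  0≤b = 0≤* 0≤½ 0≤a
  b≤1 : ½ ℚ.* a ℚ.≤ 1ℚ
  b≤1 = ≤-by (½ ℚ.* (1ℚ ℚ.- a) ℚ.+ ½)
    (solve 1 (λ a → con ½ :* a :+ (con ½ :* (con 1ℚ :- a) :+ con ½) := con 1ℚ) refl a)
    (0≤+ (0≤* 0≤½ (0≤-diff (ℚ.≤-trans a≤u u≤1))) 0≤½)
  0≤p : 0ℚ ℚ.≤ p
  0≤p = 0≤^ (0≤-diff b≤1) k
  kb≡2 : ι k ℚ.* (½ ℚ.* a) ≡ ι 2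
  kb≡2 = trans (cong (ℚ._* (½ ℚ.* a)) (ι-* 4 j))
    (trans (solve 2 (λ j a → con (ι 4) :* j :* (con ½ :* a) := con (ι 2) :* (a :* j)) refl (ι j) a)
      (trans (cong (ι 2 ℚ.*_) aj≡1) (ℚ.*-identityʳ (ι 2))))
  p≤⅓ : p ℚ.≤ ⅓
  p≤⅓ = subst₂ ℚ._≤_
    (trans (cong (λ z → ⅓ ℚ.* (p ℚ.* (1ℚ ℚ.+ z))) kb≡2)
      (solve 1 (λ p → con ⅓ :* (p :* con (ι 3)) := p) refl p))
    (ℚ.*-identityʳ ⅓)
    (*-monoˡ (ℚ.nonNegative⁻¹ ⅓) (bernoulli (½ ℚ.* a) k 0≤b b≤1))

Deg-amp : ∀ {N e} {g : Fun N} → Deg (suc e) g → Deg (suc (3 ℕ.* e)) (λ x → amp (g x))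
Deg-amp {e = e} {g} p = scale ½ (Deg-sub
  (Deg-mono (s≤s (ℕ.m≤m+n e (2 ℕ.* e))) (scale (ι 3) p))
  (Deg-mono (s≤s (ℕ.≤-reflexive (cong (e ℕ.+_) (cong (e ℕ.+_) (sym (ℕ.+-identityʳ e))))))
    (Deg-* p (Deg-* p p))))

Deg-amp^ : ∀ {N e} {g : Fun N} k → Deg (suc e) g → Deg (suc (3 ℕ.^ k ℕ.* e)) (λ x → amp^ k (g x))
Deg-amp^ {e = e} zero    p = Deg-mono (s≤s (ℕ.≤-reflexive (sym (ℕ.*-identityˡ e)))) p
Deg-amp^ {e = e} (suc k) p = Deg-mono
  (s≤s (ℕ.≤-reflexive (sym (ℕ.*-assoc 3 (3 ℕ.^ k) e)))) (Deg-amp (Deg-amp^ k p))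

ampDegree : ℕ → ℕ
ampDegree j = 3 ℕ.^ (4 ℕ.* j)

1≤ampDegree : ∀ j → 1 ≤ ampDegree j
1≤ampDegree j = ℕ.m^n>0 3 (4 ℕ.* j)

module _ {m} (f : PartialBoolean m) (δ : ℚ) (j : ℕ) (0≤δ : 0ℚ ℚ.≤ δ) (δ*j≡1 : δ ℚ.* ι j ≡ 1ℚ) where

  -- Scaled by δ, the separating polynomial lies in [-1, 1] on the cube and has f·p ≥ δ on the
  -- domain. Amplification then closes the gap to f on the domain, and off the domain the values
  -- stay in [-1, 1]. Oddness of `amp` reduces the value -1 of f to the value 1.
  Separates⇒approximation : ∀ {e p} → Deg (suc e) p → Separates f (ι j) p →
    ∃ λ (q : Polynomial m) → DegreeAtMost (ampDegree j ℕ.* e) q × Approximates ⅓ℝ f q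
  Separates⇒approximation {e} {p} dp (on , everywhere) = q , dq ,
    (λ x s eq ε 0<ε → 0 , λ i _ → ≤-slack 0<ε (subst (ℚ._≤ ⅓)
      (sym (cong₂ (λ a b → ℚ.∣ a ℚ.- b ∣) (seq-signℝ s i) (q≡ x i))) (close x s eq))) ,
    (λ x eq ε 0<ε → 0 , λ i _ → ≤-slack 0<ε (subst (ℚ._≤ 1ℚ ℚ.+ ⅓)
      (sym (cong ℚ.∣_∣ (q≡ x i))) (ℚ.≤-trans (∣g∣≤1 x) (≤-by ⅓ refl (ℚ.nonNegative⁻¹ ⅓)))))
    where
    K = 4 ℕ.* j
    u : Fun m
    u x = δ ℚ.* p x
    g : Fun m
    g x = amp^ K (u x)
    poly-g = Deg⇒polynomial (Deg-amp^ K (scale δ dp))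
    q = proj₁ poly-g
    dq = proj₁ (proj₂ poly-g)
    q≡ = proj₂ (proj₂ poly-g)

    ≤-slack : ∀ {a b ε} → 0ℚ ℚ.< ε → a ℚ.≤ b → a ℚ.≤ b ℚ.+ ε
    ≤-slack {b = b} {ε} 0<ε a≤b = ℚ.≤-trans a≤b (≤-by ε refl (ℚ.<⇒≤ 0<ε))

    u≤1 : ∀ x → u x ℚ.≤ 1ℚ
    u≤1 x = subst (u x ℚ.≤_) δ*j≡1 (*-monoˡ 0≤δ (ℚ.≤-trans (p≤∣p∣ (p x)) (everywhere x)))

    -u≤1 : ∀ x → ℚ.- u x ℚ.≤ 1ℚ
    -u≤1 x = subst₂ ℚ._≤_ (sym (ℚ.neg-distribʳ-* δ (p x))) δ*j≡1
      (*-monoˡ 0≤δ (ℚ.≤-trans (-p≤∣p∣ (p x)) (everywhere x)))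

    neg-swap : ∀ {a} → ℚ.- a ℚ.≤ 1ℚ → ℚ.- 1ℚ ℚ.≤ a
    neg-swap {a} h = subst (ℚ.- 1ℚ ℚ.≤_) (solve 1 (λ a → :- (:- a) := a) refl a) (ℚ.neg-antimono-≤ h)

    ∣g∣≤1 : ∀ x → ℚ.∣ g x ∣ ℚ.≤ 1ℚ
    ∣g∣≤1 x = let l , h = amp^-bounds K (neg-swap (-u≤1 x)) (u≤1 x) in
      ∣∣≤-from h (ℚ.neg-antimono-≤ l)

    signed-u≤1 : ∀ s x → sgn s ℚ.* u x ℚ.≤ 1ℚ
    signed-u≤1 Sign.+ x = subst (ℚ._≤ 1ℚ) (sym (ℚ.*-identityˡ (u x))) (u≤1 x)
    signed-u≤1 Sign.- x = subst (ℚ._≤ 1ℚ)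
      (solve 1 (λ a → :- a := con (ℚ.- 1ℚ) :* a) refl (u x)) (-u≤1 x)

    ∣s-a∣ : ∀ s a → ℚ.∣ sgn s ℚ.- a ∣ ≡ ℚ.∣ 1ℚ ℚ.- sgn s ℚ.* a ∣
    ∣s-a∣ Sign.+ a = cong (λ z → ℚ.∣ 1ℚ ℚ.- z ∣) (sym (ℚ.*-identityˡ a))
    ∣s-a∣ Sign.- a = trans (sym (ℚ.∣-p∣≡∣p∣ (ℚ.- 1ℚ ℚ.- a))) (cong ℚ.∣_∣
      (solve 1 (λ a → :- (con (ℚ.- 1ℚ) :- a) := con 1ℚ :- con (ℚ.- 1ℚ) :* a) refl a))

    close : ∀ x s → eval f x ≡ just s → ℚ.∣ sgn s ℚ.- g x ∣ ℚ.≤ ⅓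
    close x s eq = subst (ℚ._≤ ⅓)
      (sym (trans (∣s-a∣ s (g x)) (cong (λ z → ℚ.∣ 1ℚ ℚ.- z ∣) (sym (amp^-sign s K (u x))))))
      (∣∣≤-from (amplified j δ δ*j≡1 0≤δ v δ≤v v≤1)
        (ℚ.≤-trans (subst (ℚ._≤ 0ℚ)
            (solve 1 (λ a → a :- con 1ℚ := :- (con 1ℚ :- a)) refl (amp^ K v))
            (≤-by (1ℚ ℚ.- amp^ K v)
              (solve 1 (λ a → a :- con 1ℚ :+ (con 1ℚ :- a) := con 0ℚ) refl (amp^ K v))
              (0≤-diff (proj₂ (amp^-bounds K -1≤v v≤1)))))
          (ℚ.nonNegative⁻¹ ⅓)))
      where
      v = sgn s ℚ.* u x
      v≤1 = signed-u≤1 s x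
      δ≤v : δ ℚ.≤ v
      δ≤v = subst₂ ℚ._≤_ (ℚ.*-identityʳ δ)
        (solve 3 (λ d s p → d :* (s :* p) := s :* (d :* p)) refl δ (sgn s) (p x))
        (*-monoˡ 0≤δ (on x s eq))
      -1≤v = ℚ.≤-trans (ℚ.≤-trans (ℚ.neg-antimono-≤ 0≤1) 0≤δ) δ≤v

  -- The other alternative of `duality`, a separating polynomial of degree at most D - 1, would be
  -- amplified to an approximation of degree below `d`, against minimality.
  approximate-degree⇒dual : ∀ {d} → ApproxDegree ⅓ℝ f d → ∀ D → (∀ e → e ℕ.< D → ampDegree j ℕ.* e ℕ.< d) →
    Dual f δ D
  approximate-degree⇒dual {d} (_ , least) D below =
    from D below (duality f δ (ι j) 0≤δ (0≤ι j) δ*j≡1 D)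
    where
    from : ∀ D → (∀ e → e ℕ.< D → ampDegree j ℕ.* e ℕ.< d) →
      (∃ λ p → Deg D p × Separates f (ι j) p) ⊎ Dual f δ D → Dual f δ D
    from D below (inj₂ dual) = dual
    -- For D = 0 the separating polynomial would be the zero function, which fails at any point of
    -- the domain; a point exists because domains are nonempty.
    from zero below (inj₁ (p , dp , on , _)) =
      let x , s , eq = nonempty f in
      ⊥-elim (ℚ.<-irrefl refl (ℚ.<-≤-trans (ℚ.positive⁻¹ 1ℚ) (subst (1ℚ ℚ.≤_)
        (trans (cong (sgn s ℚ.*_) (Deg0⇒≡0 dp x)) (ℚ.*-zeroʳ (sgn s))) (on x s eq))))
    from (suc e) below (inj₁ (p , dp , sep)) =
      ⊥-elim (ℕ.<⇒≱ (below e ℕ.≤-refl) (least (ampDegree j ℕ.* e) (Separates⇒approximation dp sep)))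

-- The truncated product of the dual polynomials

Deg-restrict : ∀ {m k d} {g : Fun (m ℕ.+ k)} (x : Vec Sign m) → Deg d g → Deg d (λ y → g (x Vec.++ y))
Deg-restrict {m} {d = d} x (monomial e lt) with Vec.splitAt m e
... | e₁ , e₂ , refl = ext (λ y → sym (mono-++ e₁ e₂ x y))
  (scale (mono e₁ x) (monomial e₂
    (ℕ.≤-<-trans (ℕ.m≤n+m (Vec.sum e₂) (Vec.sum e₁)) (subst (ℕ._< d) (sum-++ e₁ e₂) lt))))
Deg-restrict x null        = null
Deg-restrict x (add p q)   = add (Deg-restrict x p) (Deg-restrict x q)
Deg-restrict x (scale c p) = scale c (Deg-restrict x p)
Deg-restrict x (ext eq p)  = ext (λ y → eq (x Vec.++ y)) (Deg-restrict x p)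

∣sgn*∣ : ∀ s a → ℚ.∣ sgn s ℚ.* a ∣ ≡ ℚ.∣ a ∣
∣sgn*∣ Sign.+ a = cong ℚ.∣_∣ (ℚ.*-identityˡ a)
∣sgn*∣ Sign.- a = trans (ℚ.∣p*q∣≡∣p∣*∣q∣ (ℚ.- 1ℚ) a) (ℚ.*-identityˡ ℚ.∣ a ∣)

sgn-* : ∀ s t → sgn (s Sign.* t) ≡ sgn s ℚ.* sgn t
sgn-* Sign.+ t      = sym (ℚ.*-identityˡ (sgn t))
sgn-* Sign.- Sign.+ = refl
sgn-* Sign.- Sign.- = refl

-- The products below are functionals defined by recursion on the blocks, not lists of weighted
-- points. Linearity is what allows them to be exchanged with a finite integral over another block;
-- `respects` stands in for function extensionality.
record Linear {X : Set} (L : (X → ℚ) → ℚ) : Set where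
  field
    respects : ∀ {g h} → (∀ x → g x ≡ h x) → L g ≡ L h
    plus     : ∀ g h → L (λ x → g x ℚ.+ h x) ≡ L g ℚ.+ L h
    times    : ∀ c g → L (λ x → c ℚ.* g x) ≡ c ℚ.* L g

  zero-map : L (λ _ → 0ℚ) ≡ 0ℚ
  zero-map = trans (times 0ℚ (λ _ → 0ℚ)) (ℚ.*-zeroˡ (L (λ _ → 0ℚ)))

  interchange-∫ : ∀ {Z} (μ : Measure Z) (H : Z → X → ℚ) →
    L (λ x → ∫ μ (λ z → H z x)) ≡ ∫ μ (λ z → L (H z))
  interchange-∫ []            H = zero-map
  interchange-∫ ((w , z) ∷ μ) H = trans
    (plus (λ x → w ℚ.* H z x) (λ x → ∫ μ (λ z → H z x)))
    (trans (cong (ℚ._+ L (λ x → ∫ μ (λ z → H z x))) (times w (H z)))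
      (cong (w ℚ.* L (H z) ℚ.+_) (interchange-∫ μ H)))

open Linear

module _ {Y : Set} {L L′ : (Y → ℚ) → ℚ} where

  linear-sub : Linear L → Linear L′ → Linear (λ g → L g ℚ.- L′ g)
  linear-sub l l′ .respects eq = cong₂ (λ a b → a ℚ.- b) (respects l eq) (respects l′ eq)
  linear-sub l l′ .plus g h = trans (cong₂ (λ a b → a ℚ.- b) (plus l g h) (plus l′ g h))
    (solve 4 (λ a b c d → (a :+ b) :- (c :+ d) := (a :- c) :+ (b :- d)) refl (L g) (L h) (L′ g) (L′ h))
  linear-sub l l′ .times c g = trans (cong₂ (λ a b → a ℚ.- b) (times l c g) (times l′ c g))
    (solve 3 (λ c a b → c :* a :- c :* b := c :* (a :- b)) refl c (L g) (L′ g))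

  linear-add : Linear L → Linear L′ → Linear (λ g → L g ℚ.+ L′ g)
  linear-add l l′ .respects eq = cong₂ (λ a b → a ℚ.+ b) (respects l eq) (respects l′ eq)
  linear-add l l′ .plus g h = trans (cong₂ (λ a b → a ℚ.+ b) (plus l g h) (plus l′ g h))
    (solve 4 (λ a b c d → (a :+ b) :+ (c :+ d) := (a :+ c) :+ (b :+ d)) refl (L g) (L h) (L′ g) (L′ h))
  linear-add l l′ .times c g = trans (cong₂ (λ a b → a ℚ.+ b) (times l c g) (times l′ c g))
    (sym (ℚ.*-distribˡ-+ c (L g) (L′ g)))

linear-scale : ∀ {Y : Set} {L : (Y → ℚ) → ℚ} k → Linear L → Linear (λ g → k ℚ.* L g)
linear-scale k l .respects eq = cong (k ℚ.*_) (respects l eq)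
linear-scale {L = L} k l .plus g h = trans (cong (k ℚ.*_) (plus l g h)) (ℚ.*-distribˡ-+ k (L g) (L h))
linear-scale {L = L} k l .times c g = trans (cong (k ℚ.*_) (times l c g))
  (solve 3 (λ k c a → k :* (c :* a) := c :* (k :* a)) refl k c (L g))

linear-pullback : ∀ {X Y : Set} {L : (Y → ℚ) → ℚ} (φ : Y → X) → Linear L → Linear (λ g → L (λ y → g (φ y)))
linear-pullback φ l .respects eq = respects l (λ y → eq (φ y))
linear-pullback φ l .plus g h = plus l (λ y → g (φ y)) (λ y → h (φ y))
linear-pullback φ l .times c g = times l c (λ y → g (φ y))

linear-∫ : ∀ {Z Y : Set} (μ : Measure Z) {L : Z → (Y → ℚ) → ℚ} → (∀ z → Linear (L z)) →
  Linear (λ g → ∫ μ (λ z → L z g))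
linear-∫ μ l .respects eq = ∫-cong μ (λ z → respects (l z) eq)
linear-∫ μ {L} l .plus g h = trans (∫-cong μ (λ z → plus (l z) g h)) (∫-+ μ (λ z → L z g) (λ z → L z h))
linear-∫ μ {L} l .times c g = trans (∫-cong μ (λ z → times (l z) c g)) (∫-* μ c (λ z → L z g))

module _ {m} {f : PartialBoolean m} {δ D} (dual : Dual f δ D) where
  open Dual dual

  signalPart noisePart : Fun m → ℚ
  signalPart g = ∫ signal (signed {f = f} g)
  noisePart g  = ∫ noise g

  signalPart-sub : ∀ g h → signalPart (λ x → g x ℚ.- h x) ≡ signalPart g ℚ.- signalPart h
  signalPart-sub g h = trans
    (∫-cong signal λ (x , s , _) →
      solve 3 (λ s a b → s :* (a :- b) := s :* a :- s :* b) refl (sgn s) (g x) (h x))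
    (∫-sub signal (signed {f = f} g) (signed {f = f} h))

  signalPart-bound : ∀ {g B} → (∀ x → ℚ.∣ g x ∣ ℚ.≤ B) → ℚ.∣ signalPart g ∣ ℚ.≤ B
  signalPart-bound {g} {B} h = subst (ℚ.∣ signalPart g ∣ ℚ.≤_)
    (trans (cong (ℚ._* B) signal-norm) (ℚ.*-identityˡ B))
    (∫-bound signal λ (x , s , _) → subst (ℚ._≤ B) (sym (∣sgn*∣ s (g x))) (h x))

  noisePart-bound : ∀ {g B} → 0ℚ ℚ.≤ B → (∀ x → ℚ.∣ g x ∣ ℚ.≤ B) → ℚ.∣ noisePart g ∣ ℚ.≤ δ ℚ.* B
  noisePart-bound 0≤B h = ℚ.≤-trans (∫-bound noise h) (*-monoʳ 0≤B noise-norm)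

  -- Integrating out one block lowers the degree by D: a monomial of degree below D in that block
  -- integrates to zero, and any other has spent at least D there. Since `Deg 0` contains only the
  -- zero function, the truncated subtraction is right also for d ≤ D.
  Deg-project : ∀ {k d} {g : Fun (m ℕ.+ k)} → Deg d g →
    Deg (d ℕ.∸ D) (λ y → signalPart (λ x → g (x Vec.++ y)) ℚ.+ noisePart (λ x → g (x Vec.++ y)))
  Deg-project {k} {d} (monomial e lt) with Vec.splitAt m e
  ... | e₁ , e₂ , refl = ext (λ y → factor y) (case-split (ℕ.<-≤-connex (Vec.sum e₁) D))
    where
    c : ℚ
    c = signalPart (mono e₁) ℚ.+ noisePart (mono e₁)

    factor : ∀ y → c ℚ.* mono e₂ y ≡
      signalPart (λ x → mono (e₁ Vec.++ e₂) (x Vec.++ y)) ℚ.+ noisePart (λ x → mono (e₁ Vec.++ e₂) (x Vec.++ y))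
    factor y = sym (trans (cong₂ (λ a b → a ℚ.+ b)
        (trans (∫-cong signal λ (x , s , _) → trans (cong (sgn s ℚ.*_) (mono-++ e₁ e₂ x y))
            (solve 3 (λ s a b → s :* (a :* b) := b :* (s :* a)) refl (sgn s) (mono e₁ x) (mono e₂ y)))
          (∫-* signal (mono e₂ y) (signed {f = f} (mono e₁))))
        (trans (∫-cong noise λ x → trans (mono-++ e₁ e₂ x y) (ℚ.*-comm (mono e₁ x) (mono e₂ y)))
          (∫-* noise (mono e₂ y) (mono e₁))))
      (solve 3 (λ z a b → z :* a :+ z :* b := (a :+ b) :* z) refl
        (mono e₂ y) (signalPart (mono e₁)) (noisePart (mono e₁))))

    case-split : Vec.sum e₁ ℕ.< D ⊎ D ℕ.≤ Vec.sum e₁ → Deg (d ℕ.∸ D) (λ y → c ℚ.* mono e₂ y)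
    case-split (inj₁ small) = ext
      (λ y → sym (trans (cong (ℚ._* mono e₂ y) (orthogonal e₁ small)) (ℚ.*-zeroˡ (mono e₂ y)))) null
    case-split (inj₂ large) = scale c (monomial e₂ (ℕ.m+n≤o⇒m≤o∸n (suc (Vec.sum e₂))
      (ℕ.≤-trans (ℕ.+-monoʳ-≤ (suc (Vec.sum e₂)) large)
        (subst (ℕ._≤ d) (cong suc (trans (sum-++ e₁ e₂) (ℕ.+-comm (Vec.sum e₁) (Vec.sum e₂)))) lt))))
  Deg-project null = ext (λ y → sym (cong₂ (λ a b → a ℚ.+ b)
    (trans (∫-cong signal λ (x , s , _) → ℚ.*-zeroʳ (sgn s)) (∫-0 signal)) (∫-0 noise))) null
  Deg-project (add {g} {h} p q) = ext (λ y → sym (split-+ (λ x → g (x Vec.++ y)) (λ x → h (x Vec.++ y))))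
    (add (Deg-project p) (Deg-project q))
    where
    split-+ : ∀ g h → signalPart (λ x → g x ℚ.+ h x) ℚ.+ noisePart (λ x → g x ℚ.+ h x) ≡
      (signalPart g ℚ.+ noisePart g) ℚ.+ (signalPart h ℚ.+ noisePart h)
    split-+ g h = trans (cong₂ (λ a b → a ℚ.+ b)
        (trans (∫-cong signal λ (x , s , _) → ℚ.*-distribˡ-+ (sgn s) (g x) (h x))
          (∫-+ signal (signed {f = f} g) (signed {f = f} h)))
        (∫-+ noise g h))
      (solve 4 (λ a b c d → (a :+ b) :+ (c :+ d) := (a :+ c) :+ (b :+ d)) refl
        (signalPart g) (signalPart h) (noisePart g) (noisePart h))
  Deg-project (scale c {g} p) = ext (λ y → sym (pull-* (λ x → g (x Vec.++ y)))) (scale c (Deg-project p))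
    where
    pull-* : ∀ g → signalPart (λ x → c ℚ.* g x) ℚ.+ noisePart (λ x → c ℚ.* g x) ≡
      c ℚ.* (signalPart g ℚ.+ noisePart g)
    pull-* g = trans (cong₂ (λ a b → a ℚ.+ b)
        (trans (∫-cong signal λ (x , s , _) →
            solve 3 (λ s c a → s :* (c :* a) := c :* (s :* a)) refl (sgn s) c (g x))
          (∫-* signal c (signed {f = f} g)))
        (∫-* noise c g))
      (sym (ℚ.*-distribˡ-+ c (signalPart g) (noisePart g)))
  Deg-project (ext eq p) = ext (λ y → cong₂ (λ a b → a ℚ.+ b)
    (∫-cong signal λ (x , s , _) → cong (sgn s ℚ.*_) (eq (x Vec.++ y)))
    (∫-cong noise λ x → eq (x Vec.++ y))) (Deg-project p)

block-++-zero : ∀ {n m} (x : Vec Sign m) (y : Vec Sign (n ℕ.* m)) → block {suc n} {m} (x Vec.++ y) zero ≡ x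
block-++-zero x y = trans (tabulate-cong (lookup-++ˡ x y)) (tabulate∘lookup x)

block-++-suc : ∀ {n m} (x : Vec Sign m) (y : Vec Sign (n ℕ.* m)) i →
  block {suc n} {m} (x Vec.++ y) (suc i) ≡ block {n} {m} y i
block-++-suc x y i = tabulate-cong λ j → lookup-++ʳ x y (combine i j)

eval-⨂-++ : ∀ {n m} (f : Fin (suc n) → PartialBoolean m) x y →
  eval (⨂ f) (x Vec.++ y) ≡ Maybe.zipWith Sign._*_ (eval (f zero) x) (eval (⨂ (f ∘ suc)) y)
eval-⨂-++ {n} {m} f x y = cong₂ (Maybe.zipWith Sign._*_)
  (cong (eval (f zero)) (block-++-zero {n} x y))
  (cong (Vec.foldr′ (Maybe.zipWith Sign._*_) (just Sign.+))
    (tabulate-cong λ i → cong (eval (f (suc i))) (block-++-suc {n} x y i)))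

module _ {m : ℕ} {δ : ℚ} where

  Duals : ∀ {n} → (Fin n → PartialBoolean m) → (Fin n → ℕ) → Set
  Duals f D = ∀ i → Dual (f i) δ (D i)

  -- truncated r n is Σ_{|B| < r} (-1)^|B| ⨂_{i ∈ B} νᵢ ⨂_{i ∉ B} (λᵢfᵢ + νᵢ).
  truncated : ∀ (r n : ℕ) {f : Fin n → PartialBoolean m} {D} → Duals f D → Fun (n ℕ.* m) → ℚ
  truncated zero    n       dual g = 0ℚ
  truncated (suc r) zero    dual g = g []
  truncated (suc r) (suc n) dual g =
    signalPart (dual zero) (λ x → truncated (suc r) n (dual ∘ suc) (λ y → g (x Vec.++ y))) ℚ.+
    noisePart (dual zero) (λ x → truncated (suc r) n (dual ∘ suc) (λ y → g (x Vec.++ y)) ℚ.-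
                                 truncated r n (dual ∘ suc) (λ y → g (x Vec.++ y)))

  signalProduct : ∀ n {f : Fin n → PartialBoolean m} {D} → Duals f D → Fun (n ℕ.* m) → ℚ
  signalProduct zero    dual g = g []
  signalProduct (suc n) dual g =
    signalPart (dual zero) (λ x → signalProduct n (dual ∘ suc) (λ y → g (x Vec.++ y)))

  truncated-linear : ∀ r n {f : Fin n → PartialBoolean m} {D} (dual : Duals f D) →
    Linear (truncated r n dual)
  truncated-linear zero n dual .respects eq  = refl
  truncated-linear zero n dual .plus g h     = sym (ℚ.+-identityʳ 0ℚ)
  truncated-linear zero n dual .times c g    = sym (ℚ.*-zeroʳ c)
  truncated-linear (suc r) zero dual .respects eq = eq []
  truncated-linear (suc r) zero dual .plus g h    = refl
  truncated-linear (suc r) zero dual .times c g   = refl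
  truncated-linear (suc r) (suc n) dual = linear-add
    (linear-∫ (Dual.signal (dual zero)) λ (x , s , _) →
      linear-scale (sgn s) (linear-pullback (x Vec.++_) (truncated-linear (suc r) n (dual ∘ suc))))
    (linear-∫ (Dual.noise (dual zero)) λ x →
      linear-sub (linear-pullback (x Vec.++_) (truncated-linear (suc r) n (dual ∘ suc)))
                 (linear-pullback (x Vec.++_) (truncated-linear r n (dual ∘ suc))))

  signalProduct-linear : ∀ n {f : Fin n → PartialBoolean m} {D} (dual : Duals f D) →
    Linear (signalProduct n dual)
  signalProduct-linear zero    dual .respects eq = eq []
  signalProduct-linear zero    dual .plus g h    = refl
  signalProduct-linear zero    dual .times c g   = refl
  signalProduct-linear (suc n) dual = linear-∫ (Dual.signal (dual zero)) λ (x , s , _) →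
    linear-scale (sgn s) (linear-pullback (x Vec.++_) (signalProduct-linear n (dual ∘ suc)))

  -- Each term of truncated r n keeps fewer than r noise factors, hence more than
  -- n - r orthogonal ones.
  truncated-vanishes : ∀ r n {f : Fin n → PartialBoolean m} {D} (dual : Duals f D) {d g} → Deg d g →
    (∀ (S : Subset n) → n ℕ.< ∣ S ∣ ℕ.+ r → d ℕ.≤ sumOver S D) → truncated r n dual g ≡ 0ℚ
  truncated-vanishes zero    n       dual dg small = refl
  -- With no blocks left, the empty subset is admissible and forces d ≤ 0, so `g` is zero.
  truncated-vanishes (suc r) zero    dual {d} {g} dg small =
    Deg0⇒≡0 (Deg-mono (small [] (s≤s z≤n)) dg) []
  truncated-vanishes (suc r) (suc n) {f} {D} dual {d} {g} dg small = trans
    (regroup {s = S⁺} {a = V⁺} {b = V⁻}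
      (∫-sub (Dual.noise (dual zero)) (λ x → T⁺ (at x)) (λ x → T⁻ (at x))))
    (cong₂ (λ a b → a ℚ.- b) first second)
    where
    T⁺ T⁻ : Fun (n ℕ.* m) → ℚ
    T⁺ = truncated (suc r) n (dual ∘ suc)
    T⁻ = truncated r n (dual ∘ suc)

    at : Vec Sign m → Fun (n ℕ.* m)
    at x y = g (x Vec.++ y)

    S⁺ V⁺ V⁻ : ℚ
    S⁺ = signalPart (dual zero) (λ x → T⁺ (at x))
    V⁺ = noisePart (dual zero) (λ x → T⁺ (at x))
    V⁻ = noisePart (dual zero) (λ x → T⁻ (at x))

    projected : Fun (n ℕ.* m)
    projected y = signalPart (dual zero) (λ x → at x y) ℚ.+ noisePart (dual zero) (λ x → at x y)

    regroup : ∀ {s v a b} → v ≡ a ℚ.- b → s ℚ.+ v ≡ (s ℚ.+ a) ℚ.- b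
    regroup {s} {v} {a} {b} eq = trans (cong (s ℚ.+_) eq)
      (solve 3 (λ s a b → s :+ (a :- b) := (s :+ a) :- b) refl s a b)

    lin = truncated-linear (suc r) n (dual ∘ suc)

    -- The terms whose B omits the first block carry its whole dual polynomial, so they integrate
    -- that block out and lower the degree: this is the case `inside` of S. The terms whose B
    -- contains it make up -V⁻, keep the degree and use up one unit of `r`: the case `outside`.
    T⁺-projected : T⁺ projected ≡ S⁺ ℚ.+ V⁺
    T⁺-projected = trans
      (plus lin (λ y → signalPart (dual zero) (λ x → at x y)) (λ y → noisePart (dual zero) (λ x → at x y)))
      (cong₂ (λ a b → a ℚ.+ b)
        (trans (interchange-∫ lin (Dual.signal (dual zero)) (λ (x , s , _) y → sgn s ℚ.* at x y))
          (∫-cong (Dual.signal (dual zero)) λ (x , s , _) → times lin (sgn s) (at x)))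
        (interchange-∫ lin (Dual.noise (dual zero)) at))

    first : S⁺ ℚ.+ V⁺ ≡ 0ℚ
    first = trans (sym T⁺-projected) (truncated-vanishes (suc r) n (dual ∘ suc) (Deg-project (dual zero) dg)
      λ S n<S → ℕ.m≤n+o⇒m∸n≤o d (D zero) (small (inside ∷ S) (s≤s n<S)))

    second : V⁻ ≡ 0ℚ
    second = trans (∫-cong (Dual.noise (dual zero)) λ x →
        truncated-vanishes r n (dual ∘ suc) (Deg-restrict x dg)
          λ S n<S → small (outside ∷ S) (subst (suc n ℕ.<_) (sym (ℕ.+-suc ∣ S ∣ r)) (s≤s n<S)))
      (∫-0 (Dual.noise (dual zero)))

  -- A probability measure averages a function that is at least β, one block at a time; the sign `t`
  -- accumulates the values of the functions on the blocks already fixed.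
  signalProduct-lower : ∀ n {f : Fin n → PartialBoolean m} {D} (dual : Duals f D) {g} β t →
    (∀ z s → eval (⨂ f) z ≡ just s → β ℚ.≤ sgn t ℚ.* (sgn s ℚ.* g z)) →
    β ℚ.≤ sgn t ℚ.* signalProduct n dual g
  signalProduct-lower zero    dual {g} β t h =
    subst (λ a → β ℚ.≤ sgn t ℚ.* a) (ℚ.*-identityˡ (g [])) (h [] Sign.+ refl)
  signalProduct-lower (suc n) {f} dual {g} β t h = subst₂ ℚ._≤_
    (trans (cong (ℚ._* β) signal-norm) (ℚ.*-identityˡ β))
    (∫-* signal (sgn t) (signed {f = f zero} (λ x → signalProduct n (dual ∘ suc) (λ y → g (x Vec.++ y)))))
    (∫-lower signal signal-nonNeg at)
    where
    open Dual (dual zero)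
    at : ∀ z → β ℚ.≤ sgn t ℚ.* signed {f = f zero} (λ x → signalProduct n (dual ∘ suc) (λ y → g (x Vec.++ y))) z
    at (x , s , eq) = subst (β ℚ.≤_)
      (trans (cong (ℚ._* v) (sgn-* t s)) (ℚ.*-assoc (sgn t) (sgn s) v))
      (signalProduct-lower n (dual ∘ suc) β (t Sign.* s) λ y s′ eq′ → subst (β ℚ.≤_)
        (trans (cong (λ a → sgn t ℚ.* (a ℚ.* g (x Vec.++ y))) (sgn-* s s′))
          (trans (solve 4 (λ t s s′ g → t :* ((s :* s′) :* g) := (t :* s) :* (s′ :* g)) refl
              (sgn t) (sgn s) (sgn s′) (g (x Vec.++ y)))
            (cong (ℚ._* (sgn s′ ℚ.* g (x Vec.++ y))) (sym (sgn-* t s)))))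
        (h (x Vec.++ y) (s Sign.* s′)
          (trans (eval-⨂-++ f x y) (cong₂ (Maybe.zipWith Sign._*_) eq eq′))))
      where v = signalProduct n (dual ∘ suc) (λ y → g (x Vec.++ y))

  -- Distance of the truncated product from the product of the signals

  module _ (0≤δ : 0ℚ ℚ.≤ δ) (δ≤1 : δ ℚ.≤ 1ℚ) where

    -- The part |B| = r of Ψ, sign included.
    layer : ∀ r n {f : Fin n → PartialBoolean m} {D} → Duals f D → Fun (n ℕ.* m) → ℚ
    layer r n dual g = truncated (suc r) n dual g ℚ.- truncated r n dual g

    -- A layer has norm at most binom(n, r)·δ^r·(1 + δ)^(n - r); for δ ≤ 1 the binomial theorem
    -- bounds the factor beside δ^r by (1 + 2)^n.
    weight : ℕ → ℕ → ℚ
    weight r n = δ ^ r ℚ.* ι 3 ^ n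

    0≤weight : ∀ r n → 0ℚ ℚ.≤ weight r n
    0≤weight r n = 0≤* (0≤^ 0≤δ r) (0≤^ (0≤ι 3) n)

    layer-step : ∀ r n {f : Fin (suc n) → PartialBoolean m} {D} (dual : Duals f D) g →
      layer (suc r) (suc n) dual g ≡
        (signalPart (dual zero) (λ x → layer (suc r) n (dual ∘ suc) (λ y → g (x Vec.++ y))) ℚ.+
         noisePart (dual zero) (λ x → layer (suc r) n (dual ∘ suc) (λ y → g (x Vec.++ y)))) ℚ.-
         noisePart (dual zero) (λ x → layer r n (dual ∘ suc) (λ y → g (x Vec.++ y)))
    layer-step r n dual g = regroup
      {s₂ = signalPart (dual zero) T₂} {s₁ = signalPart (dual zero) T₁}
      {v = noisePart (dual zero) (λ x → T₂ x ℚ.- T₁ x)}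
      {w = noisePart (dual zero) (λ x → T₁ x ℚ.- T₀ x)}
      (signalPart-sub (dual zero) T₂ T₁)
      where
      T₂ T₁ T₀ : Vec Sign m → ℚ
      T₂ x = truncated (suc (suc r)) n (dual ∘ suc) (λ y → g (x Vec.++ y))
      T₁ x = truncated (suc r) n (dual ∘ suc) (λ y → g (x Vec.++ y))
      T₀ x = truncated r n (dual ∘ suc) (λ y → g (x Vec.++ y))
      regroup : ∀ {s s₂ s₁ v w} → s ≡ s₂ ℚ.- s₁ → (s₂ ℚ.+ v) ℚ.- (s₁ ℚ.+ w) ≡ (s ℚ.+ v) ℚ.- w
      regroup {s} {s₂} {s₁} {v} {w} eq = trans
        (solve 4 (λ s₂ s₁ v w → (s₂ :+ v) :- (s₁ :+ w) := ((s₂ :- s₁) :+ v) :- w) refl s₂ s₁ v w)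
        (cong (λ s → (s ℚ.+ v) ℚ.- w) (sym eq))

    -- One more block contributes its signal, its noise outside B and its noise inside B. Each is at
    -- most the old weight, in the last case because the factor δ makes up for the lower layer;
    -- hence the factor 3.
    layer-bound : ∀ r n {f : Fin n → PartialBoolean m} {D} (dual : Duals f D) {g B} → 0ℚ ℚ.≤ B →
      (∀ y → ℚ.∣ g y ∣ ℚ.≤ B) → ℚ.∣ layer r n dual g ∣ ℚ.≤ weight r n ℚ.* B
    layer-bound zero zero dual {g} {B} 0≤B h = subst₂ ℚ._≤_
      (cong ℚ.∣_∣ (solve 1 (λ a → a := a :- con 0ℚ) refl (g [])))
      (sym (ℚ.*-identityˡ B)) (h [])
    layer-bound (suc r) zero dual {g} {B} 0≤B h = subst (ℚ._≤ weight (suc r) 0 ℚ.* B)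
      (cong ℚ.∣_∣ (sym (ℚ.+-inverseʳ (g [])))) (0≤* (0≤weight (suc r) 0) 0≤B)
    layer-bound zero (suc n) dual {g} {B} 0≤B h = subst (ℚ._≤ weight 0 (suc n) ℚ.* B)
      (cong ℚ.∣_∣ drop-0)
      (ℚ.≤-trans (∣+∣≤ (signalPart-bound (dual zero) at) (noisePart-bound (dual zero) 0≤w at))
        (≤-by (w ℚ.+ (1ℚ ℚ.- δ) ℚ.* w)
          (solve 3 (λ δ k B → con 1ℚ :* k :* B :+ δ :* (con 1ℚ :* k :* B) :+
              (con 1ℚ :* k :* B :+ (con 1ℚ :- δ) :* (con 1ℚ :* k :* B)) := con 1ℚ :* (con (ι 3) :* k) :* B)
            refl δ (ι 3 ^ n) B)
          (0≤+ 0≤w (0≤* (0≤-diff δ≤1) 0≤w))))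
      where
      w = weight 0 n ℚ.* B
      0≤w = 0≤* (0≤weight 0 n) 0≤B
      at : ∀ x → ℚ.∣ layer 0 n (dual ∘ suc) (λ y → g (x Vec.++ y)) ∣ ℚ.≤ w
      at x = layer-bound 0 n (dual ∘ suc) 0≤B (λ y → h (x Vec.++ y))
      T : Vec Sign m → ℚ
      T x = truncated 1 n (dual ∘ suc) (λ y → g (x Vec.++ y))
      minus-0 : ∀ a → a ≡ a ℚ.- 0ℚ
      minus-0 = solve 1 (λ a → a := a :- con 0ℚ) refl
      drop-0 : signalPart (dual zero) (λ x → T x ℚ.- 0ℚ) ℚ.+ noisePart (dual zero) (λ x → T x ℚ.- 0ℚ) ≡
        (signalPart (dual zero) T ℚ.+ noisePart (dual zero) (λ x → T x ℚ.- 0ℚ)) ℚ.- 0ℚ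
      drop-0 = trans
        (cong (ℚ._+ noisePart (dual zero) (λ x → T x ℚ.- 0ℚ))
          (∫-cong (Dual.signal (dual zero)) λ (x , s , _) → cong (sgn s ℚ.*_) (sym (minus-0 (T x)))))
        (minus-0 (signalPart (dual zero) T ℚ.+ noisePart (dual zero) (λ x → T x ℚ.- 0ℚ)))
    layer-bound (suc r) (suc n) dual {g} {B} 0≤B h = subst (ℚ._≤ weight (suc r) (suc n) ℚ.* B)
      (cong ℚ.∣_∣ (sym (layer-step r n dual g)))
      (ℚ.≤-trans
        (∣+∣≤ (∣+∣≤ (signalPart-bound (dual zero) at) (noisePart-bound (dual zero) 0≤w at))
          (subst (ℚ._≤ δ ℚ.* (weight r n ℚ.* B)) (sym (ℚ.∣-p∣≡∣p∣ (noisePart (dual zero) (λ x → layer r n (dual ∘ suc) (λ y → g (x Vec.++ y))))))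
            (noisePart-bound (dual zero) (0≤* (0≤weight r n) 0≤B) at⁻)))
        (≤-by ((1ℚ ℚ.- δ) ℚ.* w)
          (solve 4 (λ δ d k B → (δ :* d :* k :* B :+ δ :* (δ :* d :* k :* B)) :+ δ :* (d :* k :* B) :+
              (con 1ℚ :- δ) :* (δ :* d :* k :* B) := δ :* d :* (con (ι 3) :* k) :* B)
            refl δ (δ ^ r) (ι 3 ^ n) B)
          (0≤* (0≤-diff δ≤1) 0≤w)))
      where
      w = weight (suc r) n ℚ.* B
      0≤w = 0≤* (0≤weight (suc r) n) 0≤B
      at : ∀ x → ℚ.∣ layer (suc r) n (dual ∘ suc) (λ y → g (x Vec.++ y)) ∣ ℚ.≤ w
      at x = layer-bound (suc r) n (dual ∘ suc) 0≤B (λ y → h (x Vec.++ y))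
      at⁻ : ∀ x → ℚ.∣ layer r n (dual ∘ suc) (λ y → g (x Vec.++ y)) ∣ ℚ.≤ weight r n ℚ.* B
      at⁻ x = layer-bound r n (dual ∘ suc) 0≤B (λ y → h (x Vec.++ y))

    -- Here the cancellation takes place. The noise of the first block meets only the difference of
    -- two consecutive truncations, that is a layer, which is already of order δ^r; with its own
    -- factor δ it yields order r + 1. The signal of that block passes on the error of the remaining
    -- blocks.
    truncation-error : ∀ r n {f : Fin n → PartialBoolean m} {D} (dual : Duals f D) {g B} → 0ℚ ℚ.≤ B →
      (∀ y → ℚ.∣ g y ∣ ℚ.≤ B) →
      ℚ.∣ truncated (suc r) n dual g ℚ.- signalProduct n dual g ∣ ℚ.≤ weight (suc r) n ℚ.* B
    truncation-error r zero    dual {g} {B} 0≤B h = subst (ℚ._≤ weight (suc r) 0 ℚ.* B)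
      (cong ℚ.∣_∣ (sym (ℚ.+-inverseʳ (g [])))) (0≤* (0≤weight (suc r) 0) 0≤B)
    truncation-error r (suc n) dual {g} {B} 0≤B h = subst (ℚ._≤ weight (suc r) (suc n) ℚ.* B)
      (cong ℚ.∣_∣ (regroup {a = signalPart (dual zero) T} {b = signalPart (dual zero) P} {v = noisePart (dual zero) V}
        (signalPart-sub (dual zero) T P)))
      (ℚ.≤-trans (∣+∣≤ (signalPart-bound (dual zero) {λ x → T x ℚ.- P x} at)
          (noisePart-bound (dual zero) {V} (0≤* (0≤weight r n) 0≤B) at⁻))
        (≤-by w
          (solve 4 (λ δ d k B → δ :* d :* k :* B :+ δ :* (d :* k :* B) :+ δ :* d :* k :* B
              := δ :* d :* (con (ι 3) :* k) :* B)
            refl δ (δ ^ r) (ι 3 ^ n) B)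
          0≤w))
      where
      w = weight (suc r) n ℚ.* B
      0≤w = 0≤* (0≤weight (suc r) n) 0≤B
      T P V : Vec Sign m → ℚ
      T x = truncated (suc r) n (dual ∘ suc) (λ y → g (x Vec.++ y))
      P x = signalProduct n (dual ∘ suc) (λ y → g (x Vec.++ y))
      V x = layer r n (dual ∘ suc) (λ y → g (x Vec.++ y))
      regroup : ∀ {s a b v} → s ≡ a ℚ.- b → s ℚ.+ v ≡ (a ℚ.+ v) ℚ.- b
      regroup {s} {a} {b} {v} eq = trans (cong (ℚ._+ v) eq)
        (solve 3 (λ a b v → (a :- b) :+ v := (a :+ v) :- b) refl a b v)
      at : ∀ x → ℚ.∣ T x ℚ.- P x ∣ ℚ.≤ w
      at x = truncation-error r n (dual ∘ suc) 0≤B (λ y → h (x Vec.++ y))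
      at⁻ : ∀ x → ℚ.∣ V x ∣ ℚ.≤ weight r n ℚ.* B
      at⁻ x = layer-bound r n (dual ∘ suc) 0≤B (λ y → h (x Vec.++ y))

-- Amplitudes are low-degree polynomials

module _ {N : ℕ} (i : ℕ) where

  -- The i-th terms of the Cauchy sequences representing a complex function.
  DegC : ℕ → (Vec Sign N → ℂ) → Set
  DegC d z = Deg d (λ x → seq (re (z x)) i) × Deg d (λ x → seq (im (z x)) i)

  DegC-mono : ∀ {d d′ z} → d ≤ d′ → DegC d z → DegC d′ z
  DegC-mono d≤d′ (p , q) = Deg-mono d≤d′ p , Deg-mono d≤d′ q

  DegC-const : ∀ c → DegC 1 (λ _ → c)
  DegC-const c = Deg-const (seq (re c) i) , Deg-const (seq (im c) i)

  DegC-+ : ∀ {d z w} → DegC d z → DegC d w → DegC d (λ x → z x +ℂ w x)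
  DegC-+ (p , q) (p′ , q′) = add p p′ , add q q′

  DegC-* : ∀ {a b z w} → DegC (suc a) z → DegC (suc b) w → DegC (suc (a ℕ.+ b)) (λ x → z x *ℂ w x)
  DegC-* (p , q) (p′ , q′) = Deg-sub (Deg-* p p′) (Deg-* q q′) , add (Deg-* p q′) (Deg-* q p′)

  DegC-conj : ∀ {d z} → DegC d z → DegC d (λ x → conj (z x))
  DegC-conj (p , q) = p , Deg-neg q

  DegC-∑ℂ : ∀ {n d} (z : Fin n → Vec Sign N → ℂ) → (∀ j → DegC d (z j)) → DegC d (λ x → ∑ℂ (λ j → z j x))
  DegC-∑ℂ {zero}  z h = null , null
  DegC-∑ℂ {suc n} z h = DegC-+ {z = z zero} {w = λ x → ∑ℂ (λ j → z (suc j) x)}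
    (h zero) (DegC-∑ℂ (z ∘ suc) (h ∘ suc))

  module _ {W : ℕ} where

    DegC-∑ : ∀ {d} (z : Basis N W → Vec Sign N → ℂ) → (∀ a → DegC d (z a)) → DegC d (λ x → ∑ (λ a → z a x))
    DegC-∑ z h = DegC-∑ℂ (λ j x → ∑ℂ (λ w → z (j , false , w) x) +ℂ ∑ℂ (λ w → z (j , true , w) x))
      λ j → DegC-+ {z = λ x → ∑ℂ (λ w → z (j , false , w) x)} {w = λ x → ∑ℂ (λ w → z (j , true , w) x)}
        (DegC-∑ℂ (λ w → z (j , false , w)) (λ w → h (j , false , w)))
        (DegC-∑ℂ (λ w → z (j , true , w)) (λ w → h (j , true , w)))

    DegC-· : ∀ {d} (A : Operator N W) (Ψ : Vec Sign N → State N W) →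
      (∀ a → DegC (suc d) (λ x → Ψ x a)) → ∀ a → DegC (suc d) (λ x → (A · Ψ x) a)
    DegC-· A Ψ h a = DegC-∑ (λ b x → A a b *ℂ Ψ x b) λ b →
      DegC-* {z = λ _ → A a b} {w = λ x → Ψ x b} (DegC-const (A a b)) (h b)

    DegC-oracle : ∀ {d} (Ψ : Vec Sign N → State N W) →
      (∀ a → DegC (suc d) (λ x → Ψ x a)) → ∀ a → DegC (suc (suc d)) (λ x → oracle x (Ψ x) a)
    DegC-oracle {d} Ψ h (j , b , w) =
      select (λ x c → seq (re (Ψ x (j , c , w))) i) b (λ c → proj₁ (h (j , c , w))) ,
      select (λ x c → seq (im (Ψ x (j , c , w))) i) b (λ c → proj₂ (h (j , c , w)))
      where
      -- A value selected by the query bit: ½(v₀ + v₁) + ½ xⱼ (v₀ - v₁).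
      select : ∀ (v : Vec Sign N → Bool → ℚ) b → (∀ c → Deg (suc d) (λ x → v x c)) →
        Deg (suc (suc d)) (λ x → v x (b xor bit {N} {W} (lookup x j)))
      select v b dv = ext (λ x → chosen (v x) b (lookup x j))
        (scale ½ (add (Deg-mono (ℕ.n≤1+n (suc d)) (add (dv (b xor false)) (dv (b xor true))))
          (Deg-* (Deg-variable j) (Deg-sub (dv (b xor false)) (dv (b xor true))))))
        where
        chosen : ∀ (v : Bool → ℚ) b s →
          ½ ℚ.* ((v (b xor false) ℚ.+ v (b xor true)) ℚ.+ sgn s ℚ.* (v (b xor false) ℚ.- v (b xor true))) ≡
          v (b xor bit {N} {W} s)
        chosen v b Sign.+ = solve 2
          (λ p q → con ½ :* ((p :+ q) :+ con 1ℚ :* (p :- q)) := p) refl (v (b xor false)) (v (b xor true))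
        chosen v b Sign.- = solve 2
          (λ p q → con ½ :* ((p :+ q) :+ con (ℚ.- 1ℚ) :* (p :- q)) := q) refl (v (b xor false)) (v (b xor true))

    DegC-run : ∀ {d} T U (Ψ : Vec Sign N → State N W) → (∀ a → DegC (suc d) (λ x → Ψ x a)) →
      ∀ a → DegC (suc (T ℕ.+ d)) (λ x → run T U x (Ψ x) a)
    DegC-run zero U Ψ h a = DegC-· (U zero) Ψ h a
    DegC-run {d} (suc T) U Ψ h a =
      DegC-mono {z = λ x → run T (U ∘ suc) x (oracle x (U zero · Ψ x)) a}
        (s≤s (ℕ.≤-reflexive (ℕ.+-suc T d)))
        (DegC-run T (U ∘ suc) (λ x → oracle x (U zero · Ψ x))
          (DegC-oracle (λ x → U zero · Ψ x) (DegC-· (U zero) Ψ h)) a)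

  -- Each query raises the degree of the amplitudes by one, and a probability is quadratic in them.
  -- Real arithmetic acts termwise, so this is exact at every index `i`, whereas the size of
  -- probabilities is controlled only for large `i`.
  Deg-probability : ∀ {T} (A : QueryAlgorithm N T) s →
    Deg (suc (T ℕ.+ T)) (λ x → seq (QueryAlgorithm.probability A x s) i)
  Deg-probability {T} A s = proj₁ (DegC-∑ (λ a x → conj (final x a) *ℂ (E s · final x) a) λ a →
    DegC-* {z = λ x → conj (final x a)} {w = λ x → (E s · final x) a}
      (DegC-conj {z = λ x → final x a} (Deg-final a)) (DegC-· (E s) final Deg-final a))
    where
    open QueryAlgorithm A
    Deg-final : ∀ a → DegC (suc T) (λ x → final x a)
    Deg-final a = DegC-mono {z = λ x → final x a} (s≤s (ℕ.≤-reflexive (ℕ.+-identityʳ T)))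
      (DegC-run T U (λ _ → start) (λ b → DegC-const (start b)) a)

-- The complex numbers as a semiring

pointwise⇒≈ℝ : ∀ {x y} → (∀ i → seq x i ≡ seq y i) → x ≈ℝ y
pointwise⇒≈ℝ {x} {y} eq ε 0<ε = 0 , λ i _ → subst (ℚ._≤ ε)
  (sym (trans (cong (λ a → ℚ.∣ a ℚ.- seq y i ∣) (eq i)) (cong ℚ.∣_∣ (ℚ.+-inverseʳ (seq y i))))) (ℚ.<⇒≤ 0<ε)

both : ∀ {P Q : ℕ → Set} → Eventually P → Eventually Q → Eventually (λ i → P i × Q i)
both (M , p) (N , q) = M ℕ.⊔ N , λ i h → p i (ℕ.m⊔n≤o⇒m≤o M N h) , q i (ℕ.m⊔n≤o⇒n≤o M N h)

eventually-map : ∀ {P Q : ℕ → Set} → (∀ i → P i → Q i) → Eventually P → Eventually Q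
eventually-map f (N , p) = N , λ i h → f i (p i h)

halve : ∀ ε → 0ℚ ℚ.< ε → 0ℚ ℚ.< ½ ℚ.* ε
halve ε 0<ε = 0<* (ℚ.positive⁻¹ ½) 0<ε

halves : ∀ ε → ½ ℚ.* ε ℚ.+ ½ ℚ.* ε ≡ ε
halves = solve 1 (λ ε → con ½ :* ε :+ con ½ :* ε := ε) refl

≈ℝ-sym : ∀ {x y} → x ≈ℝ y → y ≈ℝ x
≈ℝ-sym {x} {y} h ε 0<ε = eventually-map (λ i → subst (ℚ._≤ ε)
  (trans (sym (ℚ.∣-p∣≡∣p∣ (seq x i ℚ.- seq y i)))
    (cong ℚ.∣_∣ (solve 2 (λ a b → :- (a :- b) := b :- a) refl (seq x i) (seq y i))))) (h ε 0<ε)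

combine-≤ : ∀ {a b c ε} → c ≡ a ℚ.+ b → ℚ.∣ a ∣ ℚ.≤ ½ ℚ.* ε → ℚ.∣ b ∣ ℚ.≤ ½ ℚ.* ε → ℚ.∣ c ∣ ℚ.≤ ε
combine-≤ {ε = ε} eq p q = subst₂ ℚ._≤_ (cong ℚ.∣_∣ (sym eq)) (halves ε) (∣+∣≤ p q)

≈ℝ-trans : ∀ {x y z} → x ≈ℝ y → y ≈ℝ z → x ≈ℝ z
≈ℝ-trans {x} {y} {z} h k ε 0<ε = eventually-map
  (λ i (p , q) → combine-≤ {a = seq x i ℚ.- seq y i} {b = seq y i ℚ.- seq z i}
    (solve 3 (λ a b c → a :- c := (a :- b) :+ (b :- c)) refl (seq x i) (seq y i) (seq z i)) p q)
  (both (h (½ ℚ.* ε) (halve ε 0<ε)) (k (½ ℚ.* ε) (halve ε 0<ε)))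

+ℝ-cong : ∀ {x x′ y y′} → x ≈ℝ x′ → y ≈ℝ y′ → x +ℝ y ≈ℝ x′ +ℝ y′
+ℝ-cong {x} {x′} {y} {y′} h k ε 0<ε = eventually-map
  (λ i (p , q) → combine-≤ {a = seq x i ℚ.- seq x′ i} {b = seq y i ℚ.- seq y′ i}
    (solve 4 (λ a a′ b b′ → (a :+ b) :- (a′ :+ b′) := (a :- a′) :+ (b :- b′)) refl
      (seq x i) (seq x′ i) (seq y i) (seq y′ i)) p q)
  (both (h (½ ℚ.* ε) (halve ε 0<ε)) (k (½ ℚ.* ε) (halve ε 0<ε)))

-ℝ-cong : ∀ {x y} → x ≈ℝ y → -ℝ x ≈ℝ -ℝ y
-ℝ-cong {x} {y} h ε 0<ε = eventually-map (λ i → subst (ℚ._≤ ε)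
  (trans (sym (ℚ.∣-p∣≡∣p∣ (seq x i ℚ.- seq y i)))
    (cong ℚ.∣_∣ (solve 2 (λ a b → :- (a :- b) := (:- a) :- (:- b)) refl (seq x i) (seq y i))))) (h ε 0<ε)

bounded : ∀ x → ∃ λ B → 0ℚ ℚ.< B × Eventually λ i → ℚ.∣ seq x i ∣ ℚ.≤ B
bounded x with cauchy x 1ℚ (ℚ.positive⁻¹ 1ℚ)
... | N , close = 1ℚ ℚ.+ ℚ.∣ seq x N ∣ ,
  ℚ.<-≤-trans (ℚ.positive⁻¹ 1ℚ) (≤-by ℚ.∣ seq x N ∣ refl (ℚ.0≤∣p∣ (seq x N))) ,
  N , λ i N≤i → subst (λ a → ℚ.∣ a ∣ ℚ.≤ 1ℚ ℚ.+ ℚ.∣ seq x N ∣)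
    (solve 2 (λ a b → (a :- b) :+ b := a) refl (seq x i) (seq x N))
    (∣+∣≤ (close i N N≤i ℕ.≤-refl) ℚ.≤-refl)

*ℝ-congˡ : ∀ x {y y′} → y ≈ℝ y′ → x *ℝ y ≈ℝ x *ℝ y′
*ℝ-congˡ x {y} {y′} h ε 0<ε =
  let B , 0<B , x≤B = bounded x
      B⁻¹ , 0<B⁻¹ , inv = 1/-scale B 0<B
      0<B⁻¹ε = 0<* 0<B⁻¹ 0<ε
  in eventually-map (λ i (p , q) → subst₂ ℚ._≤_
      (trans (sym (ℚ.∣p*q∣≡∣p∣*∣q∣ (seq x i) (seq y i ℚ.- seq y′ i)))
        (cong ℚ.∣_∣ (solve 3 (λ x y y′ → x :* (y :- y′) := x :* y :- x :* y′) refl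
          (seq x i) (seq y i) (seq y′ i))))
      (trans (solve 3 (λ b c e → b :* (c :* e) := (c :* b) :* e) refl B B⁻¹ ε)
        (trans (cong (ℚ._* ε) inv) (ℚ.*-identityˡ ε)))
      (*-mono (ℚ.0≤∣p∣ (seq x i)) (ℚ.<⇒≤ 0<B⁻¹ε) p q))
    (both x≤B (h (B⁻¹ ℚ.* ε) 0<B⁻¹ε))

*ℝ-comm : ∀ x y → x *ℝ y ≈ℝ y *ℝ x
*ℝ-comm x y = pointwise⇒≈ℝ {x *ℝ y} {y *ℝ x} (λ i → ℚ.*-comm (seq x i) (seq y i))

*ℝ-cong : ∀ {x x′ y y′} → x ≈ℝ x′ → y ≈ℝ y′ → x *ℝ y ≈ℝ x′ *ℝ y′
*ℝ-cong {x} {x′} {y} {y′} h k =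
  ≈ℝ-trans {x *ℝ y} {x *ℝ y′} {x′ *ℝ y′} (*ℝ-congˡ x {y} {y′} k)
    (≈ℝ-trans {x *ℝ y′} {y′ *ℝ x} {x′ *ℝ y′} (*ℝ-comm x y′)
      (≈ℝ-trans {y′ *ℝ x} {y′ *ℝ x′} {x′ *ℝ y′} (*ℝ-congˡ y′ {x} {x′} h) (*ℝ-comm y′ x′)))

-- A wrapper around _≈ℂ_, so that both sides can be inferred from a proof.
infix 4 _≃_
infix 5 _&_
record _≃_ (z w : ℂ) : Set where
  constructor _&_
  field
    re≈ : re z ≈ℝ re w
    im≈ : im z ≈ℝ im w

open _≃_

pointwise⇒≃ : ∀ {z w} → (∀ i → seq (re z) i ≡ seq (re w) i) → (∀ i → seq (im z) i ≡ seq (im w) i) → z ≃ w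
pointwise⇒≃ {z} {w} p q = (pointwise⇒≈ℝ {re z} {re w} p &
      pointwise⇒≈ℝ {im z} {im w} q)

≃-isEquivalence : IsEquivalence _≃_
≃-isEquivalence = record
  { refl  = λ {z} → pointwise⇒≃ {z} {z} (λ _ → refl) (λ _ → refl)
  ; sym   = λ {z} {w} (p & q) → (≈ℝ-sym {re z} {re w} p &
      ≈ℝ-sym {im z} {im w} q)
  ; trans = λ {z} {w} {v} (p & q) (p′ & q′) →
      (≈ℝ-trans {re z} {re w} {re v} p p′ &
      ≈ℝ-trans {im z} {im w} {im v} q q′) }

+ℂ-cong : ∀ {z z′ w w′} → z ≃ z′ → w ≃ w′ → z +ℂ w ≃ z′ +ℂ w′
+ℂ-cong {z} {z′} {w} {w′} (p & q) (p′ & q′) =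
  (+ℝ-cong {re z} {re z′} {re w} {re w′} p p′ &
      +ℝ-cong {im z} {im z′} {im w} {im w′} q q′)

*ℂ-cong : ∀ {z z′ w w′} → z ≃ z′ → w ≃ w′ → z *ℂ w ≃ z′ *ℂ w′
*ℂ-cong {a +i b} {a′ +i b′} {c +i d} {c′ +i d′} (p & q) (p′ & q′) =
  (+ℝ-cong {a *ℝ c} {a′ *ℝ c′} { -ℝ (b *ℝ d)} { -ℝ (b′ *ℝ d′)}
      (*ℝ-cong {a} {a′} {c} {c′} p p′)
      (-ℝ-cong {b *ℝ d} {b′ *ℝ d′} (*ℝ-cong {b} {b′} {d} {d′} q q′)) &
      +ℝ-cong {a *ℝ d} {a′ *ℝ d′} {b *ℝ c} {b′ *ℝ c′}
      (*ℝ-cong {a} {a′} {d} {d′} p q′) (*ℝ-cong {b} {b′} {c} {c′} q p′))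

conj-cong : ∀ {z w} → z ≃ w → conj z ≃ conj w
conj-cong {z} {w} (p & q) = (p &
      -ℝ-cong {im z} {im w} q)

+ℂ-comm : ∀ z w → z +ℂ w ≃ w +ℂ z
+ℂ-comm z w = pointwise⇒≃ {z +ℂ w} {w +ℂ z}
  (λ i → ℚ.+-comm (seq (re z) i) (seq (re w) i)) (λ i → ℚ.+-comm (seq (im z) i) (seq (im w) i))

*ℂ-comm : ∀ z w → z *ℂ w ≃ w *ℂ z
*ℂ-comm (a +i b) (c +i d) = pointwise⇒≃
  (λ i → solve 4 (λ a b c d → a :* c :- b :* d := c :* a :- d :* b) refl
    (seq a i) (seq b i) (seq c i) (seq d i))
  (λ i → solve 4 (λ a b c d → a :* d :+ b :* c := c :* b :+ d :* a) refl
    (seq a i) (seq b i) (seq c i) (seq d i))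

*ℂ-assoc : ∀ z w v → (z *ℂ w) *ℂ v ≃ z *ℂ (w *ℂ v)
*ℂ-assoc (a +i b) (c +i d) (e +i f) = pointwise⇒≃
  (λ i → solve 6 (λ a b c d e f →
      (a :* c :- b :* d) :* e :- (a :* d :+ b :* c) :* f := a :* (c :* e :- d :* f) :- b :* (c :* f :+ d :* e))
    refl (seq a i) (seq b i) (seq c i) (seq d i) (seq e i) (seq f i))
  (λ i → solve 6 (λ a b c d e f →
      (a :* c :- b :* d) :* f :+ (a :* d :+ b :* c) :* e := a :* (c :* f :+ d :* e) :+ b :* (c :* e :- d :* f))
    refl (seq a i) (seq b i) (seq c i) (seq d i) (seq e i) (seq f i))

*ℂ-distribˡ : ∀ z w v → z *ℂ (w +ℂ v) ≃ z *ℂ w +ℂ z *ℂ v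
*ℂ-distribˡ (a +i b) (c +i d) (e +i f) = pointwise⇒≃
  (λ i → solve 6 (λ a b c d e f → a :* (c :+ e) :- b :* (d :+ f) := (a :* c :- b :* d) :+ (a :* e :- b :* f))
    refl (seq a i) (seq b i) (seq c i) (seq d i) (seq e i) (seq f i))
  (λ i → solve 6 (λ a b c d e f → a :* (d :+ f) :+ b :* (c :+ e) := (a :* d :+ b :* c) :+ (a :* f :+ b :* e))
    refl (seq a i) (seq b i) (seq c i) (seq d i) (seq e i) (seq f i))

*ℂ-identityˡ : ∀ z → 1ℂ *ℂ z ≃ z
*ℂ-identityˡ (a +i b) = pointwise⇒≃
  (λ i → solve 2 (λ a b → con 1ℚ :* a :- con 0ℚ :* b := a) refl (seq a i) (seq b i))
  (λ i → solve 2 (λ a b → con 1ℚ :* b :+ con 0ℚ :* a := b) refl (seq a i) (seq b i))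

*ℂ-zeroˡ : ∀ z → 0ℂ *ℂ z ≃ 0ℂ
*ℂ-zeroˡ (a +i b) = pointwise⇒≃
  (λ i → solve 2 (λ a b → con 0ℚ :* a :- con 0ℚ :* b := con 0ℚ) refl (seq a i) (seq b i))
  (λ i → solve 2 (λ a b → con 0ℚ :* b :+ con 0ℚ :* a := con 0ℚ) refl (seq a i) (seq b i))

conj-* : ∀ z w → conj (z *ℂ w) ≃ conj z *ℂ conj w
conj-* (a +i b) (c +i d) = pointwise⇒≃
  (λ i → solve 4 (λ a b c d → a :* c :- b :* d := a :* c :- (:- b) :* (:- d)) refl
    (seq a i) (seq b i) (seq c i) (seq d i))
  (λ i → solve 4 (λ a b c d → :- (a :* d :+ b :* c) := a :* (:- d) :+ (:- b) :* c) refl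
    (seq a i) (seq b i) (seq c i) (seq d i))

conj-+ : ∀ z w → conj (z +ℂ w) ≃ conj z +ℂ conj w
conj-+ (a +i b) (c +i d) = pointwise⇒≃ (λ i → refl) (λ i → ℚ.neg-distrib-+ (seq b i) (seq d i))

+ℂ-assoc : ∀ z w v → (z +ℂ w) +ℂ v ≃ z +ℂ (w +ℂ v)
+ℂ-assoc (a +i b) (c +i d) (e +i f) = pointwise⇒≃
  (λ i → ℚ.+-assoc (seq a i) (seq c i) (seq e i)) (λ i → ℚ.+-assoc (seq b i) (seq d i) (seq f i))

+ℂ-identityˡ : ∀ z → 0ℂ +ℂ z ≃ z
+ℂ-identityˡ (a +i b) = pointwise⇒≃ (λ i → ℚ.+-identityˡ (seq a i)) (λ i → ℚ.+-identityˡ (seq b i))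

+ℂ-identityʳ : ∀ z → z +ℂ 0ℂ ≃ z
+ℂ-identityʳ (a +i b) = pointwise⇒≃ (λ i → ℚ.+-identityʳ (seq a i)) (λ i → ℚ.+-identityʳ (seq b i))

*ℂ-identityʳ : ∀ z → z *ℂ 1ℂ ≃ z
*ℂ-identityʳ (a +i b) = pointwise⇒≃
  (λ i → solve 2 (λ a b → a :* con 1ℚ :- b :* con 0ℚ := a) refl (seq a i) (seq b i))
  (λ i → solve 2 (λ a b → a :* con 0ℚ :+ b :* con 1ℚ := b) refl (seq a i) (seq b i))

*ℂ-zeroʳ : ∀ z → z *ℂ 0ℂ ≃ 0ℂ
*ℂ-zeroʳ (a +i b) = pointwise⇒≃
  (λ i → solve 2 (λ a b → a :* con 0ℚ :- b :* con 0ℚ := con 0ℚ) refl (seq a i) (seq b i))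
  (λ i → solve 2 (λ a b → a :* con 0ℚ :+ b :* con 0ℚ := con 0ℚ) refl (seq a i) (seq b i))

*ℂ-distribʳ : ∀ z w v → (w +ℂ v) *ℂ z ≃ w *ℂ z +ℂ v *ℂ z
*ℂ-distribʳ (a +i b) (c +i d) (e +i f) = pointwise⇒≃
  (λ i → solve 6 (λ a b c d e f → (c :+ e) :* a :- (d :+ f) :* b := (c :* a :- d :* b) :+ (e :* a :- f :* b))
    refl (seq a i) (seq b i) (seq c i) (seq d i) (seq e i) (seq f i))
  (λ i → solve 6 (λ a b c d e f → (c :+ e) :* b :+ (d :+ f) :* a := (c :* b :+ d :* a) :+ (e :* b :+ f :* a))
    refl (seq a i) (seq b i) (seq c i) (seq d i) (seq e i) (seq f i))

ℂ-isSemiring : IsSemiring _≃_ _+ℂ_ _*ℂ_ 0ℂ 1ℂ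
ℂ-isSemiring = record
  { isSemiringWithoutAnnihilatingZero = record
    { +-isCommutativeMonoid = record
      { isMonoid = record
        { isSemigroup = record
          { isMagma = record { isEquivalence = ≃-isEquivalence ; ∙-cong = +ℂ-cong }
          ; assoc = +ℂ-assoc }
        ; identity = +ℂ-identityˡ , +ℂ-identityʳ }
      ; comm = +ℂ-comm }
    ; *-cong = *ℂ-cong
    ; *-assoc = *ℂ-assoc
    ; *-identity = *ℂ-identityˡ , *ℂ-identityʳ
    ; distrib = *ℂ-distribˡ , *ℂ-distribʳ }
  ; zero = *ℂ-zeroˡ , *ℂ-zeroʳ }

-- Unitary evolution preserves inner products

-- The arithmetic is that of an abstract semiring with involution, which keeps unification
-- from unfolding real and complex numbers.
module Evolution {Carrier : Set} {_≋_ : Rel Carrier 0ℓ}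
  {add mul : Carrier → Carrier → Carrier} {0′ 1′ : Carrier}
  (isSemiring : IsSemiring _≋_ add mul 0′ 1′)
  (∑′ : ∀ n → (Fin n → Carrier) → Carrier)
  (sum-zero : ∀ (g : Fin 0 → Carrier) → ∑′ 0 g ≋ 0′)
  (sum-suc : ∀ {n} (g : Fin (suc n) → Carrier) → ∑′ (suc n) g ≋ add (g zero) (∑′ n (λ j → g (suc j))))
  (bar : Carrier → Carrier)
  (*-comm : ∀ x y → mul x y ≋ mul y x)
  (bar-cong : ∀ {x y} → x ≋ y → bar x ≋ bar y)
  (bar-0 : bar 0′ ≋ 0′)
  (bar-+ : ∀ x y → bar (add x y) ≋ add (bar x) (bar y))
  (bar-* : ∀ x y → bar (mul x y) ≋ mul (bar x) (bar y))
  (N W : ℕ) where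

  private
    R : Semiring 0ℓ 0ℓ
    R = record { isSemiring = isSemiring }

  open Semiring R hiding (zero; Carrier; isSemiring) renaming (refl to ≈-refl; sym to ≈-sym; trans to ≈-trans)
  private module Sums = SemiringSum R
  open SetoidReasoning setoid

  sum : ∀ {n} → (Fin n → Carrier) → Carrier
  sum {n} = ∑′ n

  -- The abstract sum is known only through its two recursion equations; this carries the library's
  -- lemmas over to it.
  sum≈ : ∀ {n} (g : Fin n → Carrier) → sum g ≈ Sums.sum g
  sum≈ {zero}  g = (sum-zero g)
  sum≈ {suc n} g = ≈-trans ((sum-suc g)) (+-congˡ (sum≈ (g ∘ suc)))

  sum-cong-≋ : ∀ {n} {g h : Fin n → Carrier} → (∀ j → g j ≈ h j) → sum g ≈ sum h
  sum-cong-≋ {g = g} {h} eq = ≈-trans (sum≈ g) (≈-trans (Sums.sum-cong-≋ eq) (≈-sym (sum≈ h)))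

  ∑-distrib-+ : ∀ {n} (g h : Fin n → Carrier) → sum (λ j → g j + h j) ≈ sum g + sum h
  ∑-distrib-+ g h = ≈-trans (sum≈ (λ j → g j + h j))
    (≈-trans (Sums.∑-distrib-+ g h) (≈-sym (+-cong (sum≈ g) (sum≈ h))))

  *-distribˡ-sum : ∀ {n} c (g : Fin n → Carrier) → c * sum g ≈ sum (λ j → c * g j)
  *-distribˡ-sum c g = ≈-trans (*-congˡ (sum≈ g))
    (≈-trans (Sums.*-distribˡ-sum c g) (≈-sym (sum≈ (λ j → c * g j))))

  B : Set
  B = Basis N W

  total : (B → Carrier) → Carrier
  total g = ∑′ N λ i → add (∑′ W (λ w → g (i , false , w))) (∑′ W (λ w → g (i , true , w)))

  interchange : ∀ a b c d → (a + b) + (c + d) ≈ (a + c) + (b + d)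
  interchange a b c d = begin
    (a + b) + (c + d)  ≈⟨ +-assoc a b (c + d) ⟩
    a + (b + (c + d))  ≈⟨ +-congˡ (≈-sym (+-assoc b c d)) ⟩
    a + ((b + c) + d)  ≈⟨ +-congˡ (+-congʳ (+-comm b c)) ⟩
    a + ((c + b) + d)  ≈⟨ +-congˡ (+-assoc c b d) ⟩
    a + (c + (b + d))  ≈⟨ ≈-sym (+-assoc a c (b + d)) ⟩
    (a + c) + (b + d)  ∎

  total-cong : ∀ {g h : B → Carrier} → (∀ a → g a ≈ h a) → total g ≈ total h
  total-cong eq = sum-cong-≋ λ i →
    +-cong (sum-cong-≋ λ w → eq (i , false , w)) (sum-cong-≋ λ w → eq (i , true , w))

  total-+ : ∀ g h → total (λ a → g a + h a) ≈ total g + total h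
  total-+ g h = ≈-trans
    (sum-cong-≋ λ i → ≈-trans
      (+-cong (∑-distrib-+ (λ w → g (i , false , w)) (λ w → h (i , false , w)))
              (∑-distrib-+ (λ w → g (i , true , w)) (λ w → h (i , true , w))))
      (interchange _ _ _ _))
    (∑-distrib-+ (λ i → sum (λ w → g (i , false , w)) + sum (λ w → g (i , true , w)))
                 (λ i → sum (λ w → h (i , false , w)) + sum (λ w → h (i , true , w))))

  total-* : ∀ c g → c * total g ≈ total (λ a → c * g a)
  total-* c g = ≈-trans (*-distribˡ-sum c (λ i → sum (λ w → g (i , false , w)) + sum (λ w → g (i , true , w))))
    (sum-cong-≋ λ i → ≈-trans (distribˡ c _ _)
      (+-cong (*-distribˡ-sum c (λ w → g (i , false , w))) (*-distribˡ-sum c (λ w → g (i , true , w)))))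

  total-*ʳ : ∀ c g → total g * c ≈ total (λ a → g a * c)
  total-*ʳ c g = ≈-trans (*-comm (total g) c) (≈-trans (total-* c g) (total-cong λ a → *-comm c (g a)))

  sum-0 : ∀ {n} (g : Fin n → Carrier) → (∀ j → g j ≈ 0#) → sum g ≈ 0#
  sum-0 {n} g eq = ≈-trans (sum≈ g) (≈-trans (Sums.sum-cong-≋ eq) (Sums.sum-replicate-zero n))

  total-0 : ∀ g → (∀ a → g a ≈ 0#) → total g ≈ 0#
  total-0 g eq = sum-0 _ λ i → ≈-trans
    (+-cong (sum-0 _ λ w → eq (i , false , w)) (sum-0 _ λ w → eq (i , true , w))) (+-identityˡ 0#)

  sum-total : ∀ {n} (F : Fin n → B → Carrier) → sum (λ j → total (F j)) ≈ total (λ a → sum (λ j → F j a))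
  sum-total {zero}  F = ≈-trans ((sum-zero _))
    (≈-sym (total-0 (λ a → sum (λ j → F j a)) (λ a → (sum-zero (λ j → F j a)))))
  sum-total {suc n} F = ≈-trans ((sum-suc (λ j → total (F j))))
    (≈-trans (+-congˡ (sum-total (F ∘ suc)))
      (≈-trans (≈-sym (total-+ (F zero) (λ a → sum (λ j → F (suc j) a))))
        (total-cong λ a → ≈-sym ((sum-suc (λ j → F j a))))))

  total-comm : ∀ (F : B → B → Carrier) → total (λ a → total (F a)) ≈ total (λ b → total (λ a → F a b))
  total-comm F = ≈-trans
    (sum-cong-≋ λ i → ≈-trans
      (+-cong (sum-total (λ w → F (i , false , w))) (sum-total (λ w → F (i , true , w))))
      (≈-sym (total-+ (λ b → sum (λ w → F (i , false , w) b)) (λ b → sum (λ w → F (i , true , w) b)))))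
    (sum-total (λ i b → sum (λ w → F (i , false , w) b) + sum (λ w → F (i , true , w) b)))

  bar-sum : ∀ {n} (g : Fin n → Carrier) → bar (sum g) ≈ sum (λ j → bar (g j))
  bar-sum {zero}  g = ≈-trans (bar-cong ((sum-zero g)))
    (≈-trans bar-0 (≈-sym ((sum-zero (λ j → bar (g j))))))
  bar-sum {suc n} g = ≈-trans (bar-cong ((sum-suc g)))
    (≈-trans (bar-+ (g zero) (sum (g ∘ suc)))
      (≈-trans (+-congˡ (bar-sum (g ∘ suc))) (≈-sym ((sum-suc (λ j → bar (g j)))))))

  bar-total : ∀ g → bar (total g) ≈ total (λ a → bar (g a))
  bar-total g = ≈-trans (bar-sum (λ i → sum (λ w → g (i , false , w)) + sum (λ w → g (i , true , w))))
    (sum-cong-≋ λ i → ≈-trans (bar-+ _ _)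
      (+-cong (bar-sum (λ w → g (i , false , w))) (bar-sum (λ w → g (i , true , w)))))

  sum-single : ∀ {n} (g : Fin n → Carrier) j → (∀ k → ¬ (j ≡ k) → g k ≈ 0#) → sum g ≈ g j
  sum-single {suc n} g zero    eq = ≈-trans ((sum-suc g)) (≈-trans (+-congˡ (sum-0 (g ∘ suc) λ k → eq (suc k) λ ())) (+-identityʳ (g zero)))
  sum-single {suc n} g (suc j) eq = ≈-trans ((sum-suc g)) (≈-trans
    (+-cong (eq zero λ ()) (sum-single (g ∘ suc) j λ k j≢k → eq (suc k) λ { refl → j≢k refl }))
    (+-identityˡ (g (suc j))))

  total-single : ∀ g a → (∀ b → ¬ (a ≡ b) → g b ≈ 0#) → total g ≈ g a
  total-single g (i , false , w) eq = ≈-trans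
    (sum-single _ i λ k i≢k → ≈-trans
      (+-cong (sum-0 _ λ v → eq (k , false , v) λ { refl → i≢k refl })
              (sum-0 _ λ v → eq (k , true , v) λ ())) (+-identityˡ 0#))
    (≈-trans (+-cong (sum-single (λ v → g (i , false , v)) w λ v w≢v → eq (i , false , v) λ { refl → w≢v refl })
                     (sum-0 _ λ v → eq (i , true , v) λ ()))
      (+-identityʳ (g (i , false , w))))
  total-single g (i , true , w) eq = ≈-trans
    (sum-single _ i λ k i≢k → ≈-trans
      (+-cong (sum-0 _ λ v → eq (k , false , v) λ ())
              (sum-0 _ λ v → eq (k , true , v) λ { refl → i≢k refl })) (+-identityˡ 0#))
    (≈-trans (+-cong (sum-0 _ λ v → eq (i , false , v) λ ())
                     (sum-single (λ v → g (i , true , v)) w λ v w≢v → eq (i , true , v) λ { refl → w≢v refl }))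
      (+-identityˡ (g (i , true , w))))

  Matrix : Set
  Matrix = B → B → Carrier

  inner : (B → Carrier) → (B → Carrier) → Carrier
  inner φ ψ = total λ a → mul (bar (φ a)) (ψ a)

  apply : Matrix → (B → Carrier) → B → Carrier
  apply A ψ a = total λ b → mul (A a b) (ψ b)

  adjoint : Matrix → Matrix
  adjoint A a b = bar (A b a)

  compose : Matrix → Matrix → Matrix
  compose A C a c = total λ b → mul (A a b) (C b c)

  identityMatrix : Matrix
  identityMatrix a b = if does (a ≟ᵇ b) then 1′ else 0′

  inner-congʳ : ∀ φ {ψ χ} → (∀ a → ψ a ≈ χ a) → inner φ ψ ≈ inner φ χ
  inner-congʳ φ {ψ} {χ} eq = total-cong {λ a → bar (φ a) * ψ a} {λ a → bar (φ a) * χ a} λ a → *-congˡ (eq a)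

  apply-cong : ∀ {A C : Matrix} ψ → (∀ a b → A a b ≈ C a b) → ∀ a → apply A ψ a ≈ apply C ψ a
  apply-cong {A} {C} ψ eq a = total-cong {λ b → A a b * ψ b} {λ b → C a b * ψ b} λ b → *-congʳ (eq a b)

  apply-identity : ∀ ψ a → apply identityMatrix ψ a ≈ ψ a
  apply-identity ψ a = ≈-trans (total-single _ a off) on
    where
    on : identityMatrix a a * ψ a ≈ ψ a
    on rewrite dec-true (a ≟ᵇ a) refl = *-identityˡ (ψ a)
    off : ∀ b → ¬ (a ≡ b) → identityMatrix a b * ψ b ≈ 0#
    off b a≢b rewrite dec-false (a ≟ᵇ b) a≢b = zeroˡ (ψ b)

  inner-adjoint : ∀ A ψ φ → inner (apply A ψ) φ ≈ inner ψ (apply (adjoint A) φ)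
  inner-adjoint A ψ φ = begin
    total (λ a → bar (total (λ b → A a b * ψ b)) * φ a)
      ≈⟨ total-cong (λ a → ≈-trans (*-congʳ (bar-total (λ b → A a b * ψ b)))
           (total-*ʳ (φ a) (λ b → bar (A a b * ψ b)))) ⟩
    total (λ a → total (λ b → bar (A a b * ψ b) * φ a))
      ≈⟨ total-comm (λ a b → bar (A a b * ψ b) * φ a) ⟩
    total (λ b → total (λ a → bar (A a b * ψ b) * φ a))
      ≈⟨ total-cong (λ b → ≈-trans
           (total-cong λ a → ≈-trans (*-congʳ (≈-trans (bar-* (A a b) (ψ b)) (*-comm _ _)))
             (*-assoc (bar (ψ b)) (bar (A a b)) (φ a)))
           (≈-sym (total-* (bar (ψ b)) (λ a → bar (A a b) * φ a)))) ⟩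
    total (λ b → bar (ψ b) * total (λ a → bar (A a b) * φ a)) ∎

  apply-compose : ∀ A C ψ a → apply (compose A C) ψ a ≈ apply A (apply C ψ) a
  apply-compose A C ψ a = begin
    total (λ c → total (λ b → A a b * C b c) * ψ c)
      ≈⟨ total-cong (λ c → ≈-trans (total-*ʳ (ψ c) (λ b → A a b * C b c))
           (total-cong λ b → *-assoc (A a b) (C b c) (ψ c))) ⟩
    total (λ c → total (λ b → A a b * (C b c * ψ c)))
      ≈⟨ total-comm (λ c b → A a b * (C b c * ψ c)) ⟩
    total (λ b → total (λ c → A a b * (C b c * ψ c)))
      ≈⟨ total-cong (λ b → ≈-sym (total-* (A a b) (λ c → C b c * ψ c))) ⟩
    total (λ b → A a b * total (λ c → C b c * ψ c)) ∎

  inner-cong : ∀ {φ φ′ ψ ψ′} → (∀ a → φ a ≈ φ′ a) → (∀ a → ψ a ≈ ψ′ a) → inner φ ψ ≈ inner φ′ ψ′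
  inner-cong {φ} {φ′} {ψ} {ψ′} p q =
    total-cong {λ a → bar (φ a) * ψ a} {λ a → bar (φ′ a) * ψ′ a} λ a → *-cong (bar-cong (p a)) (q a)

  -- The image vector and the adjoint are given only up to `≈`, so that the operators of the
  -- concrete model can be supplied without being unfolded.
  isometry : ∀ U U† ψ {φ} → (∀ a → φ a ≈ apply U ψ a) → (∀ a b → U† a b ≈ bar (U b a)) →
    (∀ a b → compose U† U a b ≈ identityMatrix a b) → inner φ φ ≈ inner ψ ψ
  isometry U U† ψ eq eq† unitary = ≈-trans (inner-cong eq eq)
    (≈-trans (inner-adjoint U ψ (apply U ψ)) (inner-congʳ ψ λ a →
      ≈-trans (apply-cong (apply U ψ) (λ b c → ≈-sym (eq† b c)) a)
        (≈-trans (≈-sym (apply-compose U† U ψ a))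
          (≈-trans (apply-cong ψ unitary a) (apply-identity ψ a)))))

  inner-complete : ∀ E F φ {ψ χ} → (∀ a → ψ a ≈ apply E φ a) → (∀ a → χ a ≈ apply F φ a) →
    (∀ a b → (E a b + F a b) ≈ identityMatrix a b) → inner φ ψ + inner φ χ ≈ inner φ φ
  inner-complete E F φ {ψ} {χ} eqE eqF complete = begin
    inner φ ψ + inner φ χ
      ≈⟨ ≈-sym (total-+ (λ a → bar (φ a) * ψ a) (λ a → bar (φ a) * χ a)) ⟩
    total (λ a → bar (φ a) * ψ a + bar (φ a) * χ a)
      ≈⟨ total-cong (λ a → ≈-trans (≈-sym (distribˡ (bar (φ a)) (ψ a) (χ a))) (*-congˡ (at a))) ⟩
    inner φ φ ∎
    where
    at : ∀ a → ψ a + χ a ≈ φ a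
    at a = begin
      ψ a + χ a              ≈⟨ +-cong (eqE a) (eqF a) ⟩
      apply E φ a + apply F φ a  ≈⟨ ≈-sym (total-+ (λ b → E a b * φ b) (λ b → F a b * φ b)) ⟩
      total (λ b → E a b * φ b + F a b * φ b)
        ≈⟨ total-cong (λ b → ≈-trans (≈-sym (distribʳ (φ b) (E a b) (F a b))) (*-congʳ (complete a b))) ⟩
      apply identityMatrix φ a  ≈⟨ apply-identity φ a ⟩
      φ a ∎

  -- An oracle call merely exchanges, for some i, the two halves of the sum given by the query bit.
  inner-permute : ∀ (c : Fin N → Bool) ψ {φ} → (∀ i b w → φ (i , b , w) ≈ ψ (i , b xor c i , w)) → inner φ φ ≈ inner ψ ψ
  inner-permute c ψ {φ} eq = ≈-trans
    (inner-cong {φ} {permuted} {φ} {permuted} (λ (i , b , w) → eq i b w) (λ (i , b , w) → eq i b w))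
    (sum-cong-≋ λ i → swap i (c i))
    where
    permuted : B → Carrier
    permuted (i , b , w) = ψ (i , b xor c i , w)
    half : Fin N → Bool → Carrier
    half i b = sum (λ w → bar (ψ (i , b , w)) * ψ (i , b , w))
    swap : ∀ i c → half i (false xor c) + half i (true xor c) ≈ half i false + half i true
    swap i false = ≈-refl
    swap i true  = +-comm (half i true) (half i false)

conj-0 : conj 0ℂ ≃ 0ℂ
conj-0 = pointwise⇒≃ (λ _ → refl) (λ _ → refl)

≃-refl : ∀ {z} → z ≃ z
≃-refl {z} = IsEquivalence.refl ≃-isEquivalence {z}

≃-trans : ∀ {z w v} → z ≃ w → w ≃ v → z ≃ v
≃-trans {z} {w} {v} (p & q) (p′ & q′) = ≈ℝ-trans {re z} {re w} {re v} p p′ & ≈ℝ-trans {im z} {im w} {im v} q q′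

∑ℂ-zero : ∀ (g : Fin 0 → ℂ) → ∑ℂ g ≃ 0ℂ
∑ℂ-zero g = pointwise⇒≃ {∑ℂ g} {0ℂ} (λ _ → refl) (λ _ → refl)

-- The length is explicit: given ∑ℂ itself, Agda unfolds it further than the sums of
-- Defs, and comparing the two forms ends up comparing proofs of the Cauchy property.
-- For the same reason the endpoints of ≃-trans are spelled out below.
sumℂ : ∀ n → (Fin n → ℂ) → ℂ
sumℂ n g = ∑ℂ g

sumℂ-zero : ∀ g → sumℂ 0 g ≃ 0ℂ
sumℂ-zero g = ∑ℂ-zero g

sumℂ-suc : ∀ {n} g → sumℂ (suc n) g ≃ g zero +ℂ sumℂ n (λ j → g (suc j))
sumℂ-suc {n} g = pointwise⇒≈ℝ {re (sumℂ (suc n) g)} {re (g zero +ℂ sumℂ n (λ j → g (suc j)))} (λ i → refl)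
  & pointwise⇒≈ℝ {im (sumℂ (suc n) g)} {im (g zero +ℂ sumℂ n (λ j → g (suc j)))} (λ i → refl)

module Ev = Evolution ℂ-isSemiring sumℂ sumℂ-zero sumℂ-suc conj *ℂ-comm conj-cong conj-0 conj-+ conj-*

≃-sym : ∀ {z w} → z ≃ w → w ≃ z
≃-sym {z} {w} = IsEquivalence.sym ≃-isEquivalence {z} {w}

module _ {N W : ℕ} where

  private
    total : (Basis N W → ℂ) → ℂ
    total = Ev.total N W

  ∑≃total : ∀ g → ∑ g ≃ total g
  ∑≃total g = ≃-refl {∑ g}

  ⟨∣⟩≃inner : ∀ φ ψ → ⟨ φ ∣ ψ ⟩ ≃ Ev.inner N W φ ψ
  ⟨∣⟩≃inner φ ψ = ∑≃total (λ a → conj (φ a) *ℂ ψ a)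

  ·≃apply : ∀ A ψ a → (A · ψ) a ≃ Ev.apply N W A ψ a
  ·≃apply A ψ a = ∑≃total (λ b → A a b *ℂ ψ b)

  ⊙≃compose : ∀ A C a b → (A ⊙ C) a b ≃ Ev.compose N W A C a b
  ⊙≃compose A C a b = ∑≃total (λ c → A a c *ℂ C c b)

  unitary-norm : ∀ U (ψ : State N W) → Unitary U → ⟨ U · ψ ∣ U · ψ ⟩ ≃ ⟨ ψ ∣ ψ ⟩
  unitary-norm U ψ (u , _) =
    ≃-trans {⟨ U · ψ ∣ U · ψ ⟩} {Ev.inner N W (U · ψ) (U · ψ)} {⟨ ψ ∣ ψ ⟩} (⟨∣⟩≃inner (U · ψ) (U · ψ))
      (≃-trans {Ev.inner N W (U · ψ) (U · ψ)} {Ev.inner N W ψ ψ} {⟨ ψ ∣ ψ ⟩}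
        (Ev.isometry N W U (U †) ψ {U · ψ} (·≃apply U ψ) (λ a b → ≃-refl {conj (U b a)}) orthonormal)
        (≃-sym {⟨ ψ ∣ ψ ⟩} {Ev.inner N W ψ ψ} (⟨∣⟩≃inner ψ ψ)))
    where
    orthonormal : ∀ a b → Ev.compose N W (U †) U a b ≃ Ev.identityMatrix N W a b
    orthonormal a b = ≃-trans
      {Ev.compose N W (U †) U a b} {((U †) ⊙ U) a b} {I a b}
      (≃-sym {((U †) ⊙ U) a b} {Ev.compose N W (U †) U a b} (⊙≃compose (U †) U a b))
      (proj₁ (u a b) & proj₂ (u a b))

  oracle-norm : ∀ x (ψ : State N W) → ⟨ oracle x ψ ∣ oracle x ψ ⟩ ≃ ⟨ ψ ∣ ψ ⟩
  oracle-norm x ψ =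
    ≃-trans {⟨ oracle x ψ ∣ oracle x ψ ⟩} {Ev.inner N W (oracle x ψ) (oracle x ψ)} {⟨ ψ ∣ ψ ⟩}
      (⟨∣⟩≃inner (oracle x ψ) (oracle x ψ))
      (≃-trans {Ev.inner N W (oracle x ψ) (oracle x ψ)} {Ev.inner N W ψ ψ} {⟨ ψ ∣ ψ ⟩}
        (Ev.inner-permute N W (λ i → bit {N} {W} (lookup x i)) ψ {oracle x ψ}
          λ i b w → ≃-refl {ψ (i , b xor bit {N} {W} (lookup x i) , w)})
        (≃-sym {⟨ ψ ∣ ψ ⟩} {Ev.inner N W ψ ψ} (⟨∣⟩≃inner ψ ψ)))

  measurement-complete : ∀ (E F : Operator N W) φ → (E ⊞ F) ≈ᵒ I →
    (⟨ φ ∣ E · φ ⟩ +ℂ ⟨ φ ∣ F · φ ⟩) ≃ ⟨ φ ∣ φ ⟩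
  measurement-complete E F φ complete =
    ≃-trans {⟨ φ ∣ E · φ ⟩ +ℂ ⟨ φ ∣ F · φ ⟩} {Ev.inner N W φ (E · φ) +ℂ Ev.inner N W φ (F · φ)} {⟨ φ ∣ φ ⟩}
      (+ℂ-cong {⟨ φ ∣ E · φ ⟩} {Ev.inner N W φ (E · φ)} {⟨ φ ∣ F · φ ⟩} {Ev.inner N W φ (F · φ)}
        (⟨∣⟩≃inner φ (E · φ)) (⟨∣⟩≃inner φ (F · φ)))
      (≃-trans {Ev.inner N W φ (E · φ) +ℂ Ev.inner N W φ (F · φ)} {Ev.inner N W φ φ} {⟨ φ ∣ φ ⟩}
        (Ev.inner-complete N W E F φ {E · φ} {F · φ} (·≃apply E φ) (·≃apply F φ)
          (λ a b → proj₁ (complete a b) & proj₂ (complete a b)))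
        (≃-sym {⟨ φ ∣ φ ⟩} {Ev.inner N W φ φ} (⟨∣⟩≃inner φ φ)))

  norm-cong : ∀ (φ ψ : State N W) → (∀ a → φ a ≃ ψ a) → ⟨ φ ∣ φ ⟩ ≃ ⟨ ψ ∣ ψ ⟩
  norm-cong φ ψ eq =
    ≃-trans {⟨ φ ∣ φ ⟩} {Ev.inner N W φ φ} {⟨ ψ ∣ ψ ⟩} (⟨∣⟩≃inner φ φ)
      (≃-trans {Ev.inner N W φ φ} {Ev.inner N W ψ ψ} {⟨ ψ ∣ ψ ⟩} (Ev.inner-cong N W {φ} {ψ} {φ} {ψ} eq eq)
        (≃-sym {⟨ ψ ∣ ψ ⟩} {Ev.inner N W ψ ψ} (⟨∣⟩≃inner ψ ψ)))

  run-norm : ∀ T U x (ψ : State N W) → (∀ j → Unitary (U j)) →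
    ⟨ run T U x ψ ∣ run T U x ψ ⟩ ≃ ⟨ ψ ∣ ψ ⟩
  run-norm zero    U x ψ u =
    ≃-trans {⟨ run zero U x ψ ∣ run zero U x ψ ⟩} {⟨ U zero · ψ ∣ U zero · ψ ⟩} {⟨ ψ ∣ ψ ⟩}
      (norm-cong (run zero U x ψ) (U zero · ψ) (λ a → ≃-refl {(U zero · ψ) a}))
      (unitary-norm (U zero) ψ (u zero))
  run-norm (suc T) U x ψ u =
    ≃-trans {⟨ run (suc T) U x ψ ∣ run (suc T) U x ψ ⟩} {⟨ run T (λ j → U (suc j)) x (oracle x (U zero · ψ)) ∣ run T (λ j → U (suc j)) x (oracle x (U zero · ψ)) ⟩} {⟨ ψ ∣ ψ ⟩}
      (norm-cong (run (suc T) U x ψ) (run T (λ j → U (suc j)) x (oracle x (U zero · ψ)))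
        (λ a → ≃-refl {run T (λ j → U (suc j)) x (oracle x (U zero · ψ)) a}))
      (≃-trans {⟨ run T (λ j → U (suc j)) x (oracle x (U zero · ψ)) ∣ run T (λ j → U (suc j)) x (oracle x (U zero · ψ)) ⟩} {⟨ oracle x (U zero · ψ) ∣ oracle x (U zero · ψ) ⟩} {⟨ ψ ∣ ψ ⟩}
        (run-norm T (λ j → U (suc j)) x (oracle x (U zero · ψ)) (λ j → u (suc j)))
        (≃-trans {⟨ oracle x (U zero · ψ) ∣ oracle x (U zero · ψ) ⟩} {⟨ U zero · ψ ∣ U zero · ψ ⟩} {⟨ ψ ∣ ψ ⟩}
          (oracle-norm x (U zero · ψ)) (unitary-norm (U zero) ψ (u zero))))

-- From query algorithms to polynomials

-- The cube is finite, so the largest of the thresholds serves all points.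
eventually-∀ : ∀ {N} {Q : Vec Sign N → ℕ → Set} → (∀ x → Eventually (Q x)) →
  Eventually (λ i → ∀ x → Q x i)
eventually-∀ {zero}  h = eventually-map (λ { i q [] → q }) (h [])
eventually-∀ {suc N} h = eventually-map
  (λ { i (p , q) (Sign.+ ∷ x) → p x ; i (p , q) (Sign.- ∷ x) → q x })
  (both (eventually-∀ (λ x → h (Sign.+ ∷ x))) (eventually-∀ (λ x → h (Sign.- ∷ x))))

module _ {N T} (A : QueryAlgorithm N T) where
  open QueryAlgorithm A

  probability-total : ∀ x ε → 0ℚ ℚ.< ε → Eventually λ i →
    ℚ.∣ seq (probability x Sign.- ) i ℚ.+ seq (probability x Sign.+) i ℚ.- 1ℚ ∣ ℚ.≤ ε
  probability-total x = _≃_.re≈ (≃-trans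
    {⟨ final x ∣ E Sign.- · final x ⟩ +ℂ ⟨ final x ∣ E Sign.+ · final x ⟩} {⟨ final x ∣ final x ⟩} {1ℂ}
    (measurement-complete (E Sign.-) (E Sign.+) (final x) E-complete)
    (≃-trans {⟨ final x ∣ final x ⟩} {⟨ run T U x start ∣ run T U x start ⟩} {1ℂ}
      (norm-cong (final x) (run T U x start) (λ a → ≃-refl {run T U x start a}))
      (≃-trans {⟨ run T U x start ∣ run T U x start ⟩} {⟨ start ∣ start ⟩} {1ℂ}
        (run-norm T U x start U-unitary) (proj₁ start-unit & proj₂ start-unit))))

  bias : ℕ → Fun N
  bias i x = seq (probability x Sign.+) i ℚ.- seq (probability x Sign.-) i

  Deg-bias : ∀ i → Deg (suc (T ℕ.+ T)) (bias i)
  Deg-bias i = Deg-sub (Deg-probability i A Sign.+) (Deg-probability i A Sign.-)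

  -- At a finite index the outcome probabilities p, q satisfy only p, q ≥ -η and p + q ≤ 1 + η. Then
  -- p - q = (p + q) - 2q is at most 1 + 3η, and symmetrically.
  bias-bound : ∀ {η} → 0ℚ ℚ.< η → ∀ x → Eventually λ i → ℚ.∣ bias i x ∣ ℚ.≤ 1ℚ ℚ.+ ι 3 ℚ.* η
  bias-bound {η} 0<η x = eventually-map
    (λ i (t , p⁻ , p⁺) → arithmetic (seq (probability x Sign.+) i) (seq (probability x Sign.-) i) t p⁺ p⁻)
    (both (probability-total x η 0<η) (both (proj₁ (E-psd Sign.- (final x)) η 0<η) (proj₁ (E-psd Sign.+ (final x)) η 0<η)))
    where
    arithmetic : ∀ p q → ℚ.∣ q ℚ.+ p ℚ.- 1ℚ ∣ ℚ.≤ η → 0ℚ ℚ.≤ p ℚ.+ η → 0ℚ ℚ.≤ q ℚ.+ η →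
      ℚ.∣ p ℚ.- q ∣ ℚ.≤ 1ℚ ℚ.+ ι 3 ℚ.* η
    arithmetic p q t 0≤p 0≤q = ∣∣≤-from
      (≤-by ((η ℚ.- (q ℚ.+ p ℚ.- 1ℚ)) ℚ.+ ι 2 ℚ.* (q ℚ.+ η))
        (solve 3 (λ p q η → p :- q :+ ((η :- (q :+ p :- con 1ℚ)) :+ con (ι 2) :* (q :+ η))
          := con 1ℚ :+ con (ι 3) :* η) refl p q η)
        (0≤+ upper (0≤* (0≤ι 2) 0≤q)))
      (≤-by ((η ℚ.- (q ℚ.+ p ℚ.- 1ℚ)) ℚ.+ ι 2 ℚ.* (p ℚ.+ η))
        (solve 3 (λ p q η → :- (p :- q) :+ ((η :- (q :+ p :- con 1ℚ)) :+ con (ι 2) :* (p :+ η))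
          := con 1ℚ :+ con (ι 3) :* η) refl p q η)
        (0≤+ upper (0≤* (0≤ι 2) 0≤p)))
      where
      upper : 0ℚ ℚ.≤ η ℚ.- (q ℚ.+ p ℚ.- 1ℚ)
      upper = 0≤-diff (ℚ.≤-trans (p≤∣p∣ (q ℚ.+ p ℚ.- 1ℚ)) t)

  -- If p is the probability of the correct answer, then p - q = 2p - (p + q) with p ≥ ½ + 2^-n - η
  -- and p + q ≤ 1 + η.
  bias-advantage : ∀ {n} {F : PartialBoolean N} → Computes (½ℝ -ℝ ½ℝ ^ℝ n) F A → ∀ {η} → 0ℚ ℚ.< η →
    ∀ x s → eval F x ≡ just s → Eventually λ i → ι 2 ℚ.* ½ ^ n ℚ.- ι 3 ℚ.* η ℚ.≤ sgn s ℚ.* bias i x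
  bias-advantage {n} computes {η} 0<η x s eq = eventually-map
    (λ i (t , p) → by-sign s i t (subst (λ h → 1ℚ ℚ.- (½ ℚ.- h) ℚ.≤ seq (probability x s) i ℚ.+ η) (seq-^ ½ℝ n i) p))
    (both (probability-total x η 0<η) (computes x s eq η 0<η))
    where
    h = ½ ^ n

    arithmetic : ∀ p q → q ℚ.+ p ℚ.- 1ℚ ℚ.≤ η → 1ℚ ℚ.- (½ ℚ.- h) ℚ.≤ p ℚ.+ η →
      ι 2 ℚ.* h ℚ.- ι 3 ℚ.* η ℚ.≤ p ℚ.- q
    arithmetic p q t l = ≤-by
      (ι 2 ℚ.* (p ℚ.+ η ℚ.- (1ℚ ℚ.- (½ ℚ.- h))) ℚ.+ (η ℚ.- (q ℚ.+ p ℚ.- 1ℚ)))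
      (solve 4 (λ p q h η → con (ι 2) :* h :- con (ι 3) :* η :+
          (con (ι 2) :* (p :+ η :- (con 1ℚ :- (con ½ :- h))) :+ (η :- (q :+ p :- con 1ℚ))) := p :- q)
        refl p q h η)
      (0≤+ (0≤* (0≤ι 2) (0≤-diff l)) (0≤-diff t))

    by-sign : ∀ s i → ℚ.∣ seq (probability x Sign.-) i ℚ.+ seq (probability x Sign.+) i ℚ.- 1ℚ ∣ ℚ.≤ η →
      1ℚ ℚ.- (½ ℚ.- h) ℚ.≤ seq (probability x s) i ℚ.+ η →
      ι 2 ℚ.* h ℚ.- ι 3 ℚ.* η ℚ.≤ sgn s ℚ.* bias i x
    by-sign Sign.+ i = finish (seq (probability x Sign.+) i) (seq (probability x Sign.-) i)
      where
      finish : ∀ p q → ℚ.∣ q ℚ.+ p ℚ.- 1ℚ ∣ ℚ.≤ η → 1ℚ ℚ.- (½ ℚ.- h) ℚ.≤ p ℚ.+ η →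
        ι 2 ℚ.* h ℚ.- ι 3 ℚ.* η ℚ.≤ 1ℚ ℚ.* (p ℚ.- q)
      finish p q t l = subst (ι 2 ℚ.* h ℚ.- ι 3 ℚ.* η ℚ.≤_) (sym (ℚ.*-identityˡ (p ℚ.- q)))
        (arithmetic p q (ℚ.≤-trans (p≤∣p∣ (q ℚ.+ p ℚ.- 1ℚ)) t) l)
    by-sign Sign.- i = finish (seq (probability x Sign.+) i) (seq (probability x Sign.-) i)
      where
      finish : ∀ p q → ℚ.∣ q ℚ.+ p ℚ.- 1ℚ ∣ ℚ.≤ η → 1ℚ ℚ.- (½ ℚ.- h) ℚ.≤ q ℚ.+ η →
        ι 2 ℚ.* h ℚ.- ι 3 ℚ.* η ℚ.≤ (ℚ.- 1ℚ) ℚ.* (p ℚ.- q)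
      finish p q t l = subst (ι 2 ℚ.* h ℚ.- ι 3 ℚ.* η ℚ.≤_)
        (solve 2 (λ p q → q :- p := con (ℚ.- 1ℚ) :* (p :- q)) refl p q)
        (arithmetic q p (subst (ℚ._≤ η) (cong (ℚ._- 1ℚ) (ℚ.+-comm q p))
          (ℚ.≤-trans (p≤∣p∣ (q ℚ.+ p ℚ.- 1ℚ)) t)) l)

  algorithm⇒polynomial : ∀ {n} {F : PartialBoolean N} → Computes (½ℝ -ℝ ½ℝ ^ℝ n) F A → ∀ η → 0ℚ ℚ.< η →
    ∃ λ (g : Fun N) → Deg (suc (T ℕ.+ T)) g × (∀ x → ℚ.∣ g x ∣ ℚ.≤ 1ℚ ℚ.+ ι 3 ℚ.* η) ×
      (∀ x s → eval F x ≡ just s → ι 2 ℚ.* ½ ^ n ℚ.- ι 3 ℚ.* η ℚ.≤ sgn s ℚ.* g x)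
  algorithm⇒polynomial {n} {F} computes η 0<η = bias i , Deg-bias i ,
    (λ x → proj₁ (proj₂ good i ℕ.≤-refl x)) , (λ x s eq → proj₂ (proj₂ good i ℕ.≤-refl x) s eq)
    where
    advantage-at : ∀ x y → eval F x ≡ y → Eventually λ i →
      ∀ s → y ≡ just s → ι 2 ℚ.* ½ ^ n ℚ.- ι 3 ℚ.* η ℚ.≤ sgn s ℚ.* bias i x
    advantage-at x (just s) eq = eventually-map (λ { i h _ refl → h }) (bias-advantage {n} {F} computes 0<η x s eq)
    advantage-at x nothing  eq = 0 , λ _ _ _ ()

    good : Eventually λ i → ∀ x → ℚ.∣ bias i x ∣ ℚ.≤ 1ℚ ℚ.+ ι 3 ℚ.* η ×
      (∀ s → eval F x ≡ just s → ι 2 ℚ.* ½ ^ n ℚ.- ι 3 ℚ.* η ℚ.≤ sgn s ℚ.* bias i x)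
    good = eventually-∀ λ x → both (bias-bound 0<η x) (advantage-at x (eval F x) refl)

    -- The common threshold itself is the one index at which all the sequences are read.
    i = proj₁ good

-- Powers of one sixth

⅙ : ℚ
⅙ = + 1 ℚ./ 6

0<⅙ : 0ℚ ℚ.< ⅙
0<⅙ = ℚ.positive⁻¹ ⅙

0≤⅙ : 0ℚ ℚ.≤ ⅙
0≤⅙ = ℚ.<⇒≤ 0<⅙

⅙≤1 : ⅙ ℚ.≤ 1ℚ
⅙≤1 = ≤-by (+ 5 ℚ./ 6) refl (ℚ.nonNegative⁻¹ (+ 5 ℚ./ 6))

^-≤1 : ∀ {a} → 0ℚ ℚ.≤ a → a ℚ.≤ 1ℚ → ∀ k → a ^ k ℚ.≤ 1ℚ
^-≤1 0≤a a≤1 zero    = ℚ.≤-refl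
^-≤1 {a} 0≤a a≤1 (suc k) = subst (a ^ suc k ℚ.≤_) (ℚ.*-identityʳ 1ℚ) (*-mono 0≤a 0≤1 a≤1 (^-≤1 0≤a a≤1 k))

^-antimono : ∀ {a} → 0ℚ ℚ.≤ a → a ℚ.≤ 1ℚ → ∀ {j k} → j ≤ k → a ^ k ℚ.≤ a ^ j
^-antimono {a} 0≤a a≤1 {j} {k} j≤k = subst₂ ℚ._≤_
  (trans (sym (^-+ a j (k ℕ.∸ j))) (cong (a ^_) (ℕ.m+[n∸m]≡n j≤k)))
  (ℚ.*-identityʳ (a ^ j))
  (*-monoˡ (0≤^ 0≤a j) (^-≤1 0≤a a≤1 (k ℕ.∸ j)))

^-^ : ∀ a j k → (a ^ j) ^ k ≡ a ^ (k ℕ.* j)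
^-^ a j zero    = refl
^-^ a j (suc k) = trans (cong (a ^ j ℚ.*_) (^-^ a j k)) (sym (^-+ a j (k ℕ.* j)))

⅙^-inverse : ∀ k → ⅙ ^ k ℚ.* ι (6 ℕ.^ k) ≡ 1ℚ
⅙^-inverse zero    = refl
⅙^-inverse (suc k) = trans (cong (⅙ ^ suc k ℚ.*_) (ι-* 6 (6 ℕ.^ k)))
  (trans (solve 2 (λ a b → (con ⅙ :* a) :* (con (ι 6) :* b) := a :* b) refl (⅙ ^ k) (ι (6 ℕ.^ k)))
    (⅙^-inverse k))

⅙^*3^ : ∀ n → ⅙ ^ n ℚ.* ι 3 ^ n ≡ ½ ^ n
⅙^*3^ zero    = refl
⅙^*3^ (suc n) = trans
  (solve 2 (λ a b → (con ⅙ :* a) :* (con (ι 3) :* b) := con ½ :* (a :* b)) refl (⅙ ^ n) (ι 3 ^ n))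
  (cong (½ ℚ.*_) (⅙^*3^ n))

0<½^ : ∀ n → 0ℚ ℚ.< ½ ^ n
0<½^ = 0<^ (ℚ.positive⁻¹ ½)

-- The exponent of ⅙ is at least n + 1: n of the factors turn 3^n into 2^-n, and the remaining one
-- makes the inequality strict.
small-weight : ∀ K n r → suc n ≤ suc r ℕ.* K → (⅙ ^ K) ^ suc r ℚ.* ι 3 ^ n ℚ.< ½ ^ n
small-weight K n r large = ℚ.≤-<-trans
  (*-monoʳ (0≤^ (0≤ι 3) n) (subst (ℚ._≤ ⅙ ^ suc n) (sym (^-^ ⅙ K (suc r))) (^-antimono 0≤⅙ ⅙≤1 large)))
  (subst₂ ℚ._<_
    (trans (cong (⅙ ℚ.*_) (sym (⅙^*3^ n))) (sym (ℚ.*-assoc ⅙ (⅙ ^ n) (ι 3 ^ n))))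
    (ℚ.*-identityˡ (½ ^ n))
    (ℚ.*-monoˡ-<-pos (½ ^ n) {{ℚ.positive (0<½^ n)}} ⅙<1))
  where
  ⅙<1 : ⅙ ℚ.< 1ℚ
  ⅙<1 = subst (ℚ._< 1ℚ) (ℚ.+-identityʳ ⅙) (ℚ.+-monoʳ-< ⅙ (ℚ.positive⁻¹ (+ 5 ℚ./ 6)))

/1≡ι : ∀ n → + n ℚ./ 1 ≡ ι n
/1≡ι zero    = refl
/1≡ι (suc n) = trans (ℚ.toℚᵘ-injective (begin
    ℚ.toℚᵘ (+ suc n ℚ./ 1)              ≈⟨ ℚ.toℚᵘ-fromℚᵘ (ℚᵘ.mkℚᵘ (+ suc n) 0) ⟩
    ℚᵘ.mkℚᵘ (+ suc n) 0                 ≈⟨ ℚᵘ.*≡* (solve′ 1 (λ k → (con′ (+ 1) +′ k) *′ con′ (+ 1) =′ (con′ (+ 1) +′ k *′ con′ (+ 1)) *′ con′ (+ 1)) refl (+ n)) ⟩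
    ℚᵘ.1ℚᵘ ℚᵘ.+ ℚᵘ.mkℚᵘ (+ n) 0         ≈⟨ ℚᵘ.+-congʳ ℚᵘ.1ℚᵘ (ℚᵘ.≃-sym (ℚ.toℚᵘ-fromℚᵘ (ℚᵘ.mkℚᵘ (+ n) 0))) ⟩
    ℚ.toℚᵘ 1ℚ ℚᵘ.+ ℚ.toℚᵘ (+ n ℚ./ 1)   ≈⟨ ℚᵘ.≃-sym (ℚ.toℚᵘ-homo-+ 1ℚ (+ n ℚ./ 1)) ⟩
    ℚ.toℚᵘ (1ℚ ℚ.+ + n ℚ./ 1)           ∎))
  (cong (1ℚ ℚ.+_) (/1≡ι n))
  where
  open ℤSolver.+-*-Solver renaming (solve to solve′; _:+_ to _+′_; _:*_ to _*′_; _:=_ to _=′_; con to con′)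
  open SetoidReasoning ℚᵘ.≃-setoid

ι-mono : ∀ {j k} → j ≤ k → ι j ℚ.≤ ι k
ι-mono {j} {k} j≤k = ≤-by (ι (k ℕ.∸ j))
  (trans (sym (ι-+ j (k ℕ.∸ j))) (cong ι (ℕ.m+[n∸m]≡n j≤k))) (0≤ι (k ℕ.∸ j))

-- Subsets and rounding

open import Data.Rational.Unnormalised.Base using (_/_; _*_)

-- The ceiling is the negated floor of -99n/100. Division with remainder, -99n = r + 100q with r ≤
-- 99, gives 100k = r + 99n for k = -q.
ceiling-bound : ∀ n k → + k ≡ ceiling ((+ 99 / 100) * (+ n / 1)) → k ℕ.* 100 ≤ 99 ℕ.+ 99 ℕ.* n
ceiling-bound n k eq = subst (ℕ._≤ 99 ℕ.+ 99 ℕ.* n) (sym (ℤ.+-injective k*100≡))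
  (ℕ.+-monoˡ-≤ (99 ℕ.* n) (ℕ.s≤s⁻¹ (ℤ.n%d<d a (+ 100))))
  where
  open ℤSolver.+-*-Solver renaming (solve to solve′; _:+_ to _+′_; _:*_ to _*′_; _:-_ to _-′_; :-_ to -′_; _:=_ to _=′_)
  open ≡-Reasoning
  a q : ℤ
  a = ℤ.- (+ 99 ℤ.* + n)
  q = a ℤ./ + 100
  r : ℕ
  r = a ℤ.% + 100
  k*100≡ : + (k ℕ.* 100) ≡ + (r ℕ.+ 99 ℕ.* n)
  k*100≡ = begin
    + (k ℕ.* 100)              ≡⟨ ℤ.pos-* k 100 ⟩
    + k ℤ.* + 100              ≡⟨ cong (ℤ._* + 100) eq ⟩
    (ℤ.- q) ℤ.* + 100          ≡⟨ solve′ 3 (λ q r d → (-′ q) *′ d =′ r -′ (r +′ q *′ d)) refl q (+ r) (+ 100) ⟩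
    + r ℤ.- (+ r ℤ.+ q ℤ.* + 100) ≡⟨ cong (λ b → + r ℤ.- b) (sym (ℤ.a≡a%n+[a/n]*n a (+ 100))) ⟩
    + r ℤ.- a                  ≡⟨ cong (λ b → + r ℤ.+ b) (ℤ.neg-involutive (+ 99 ℤ.* + n)) ⟩
    + r ℤ.+ + 99 ℤ.* + n       ≡⟨ cong (λ b → + r ℤ.+ b) (sym (ℤ.pos-* 99 n)) ⟩
    + r ℤ.+ + (99 ℕ.* n)       ≡⟨ sym (ℤ.pos-+ r (99 ℕ.* n)) ⟩
    + (r ℕ.+ 99 ℕ.* n)         ∎

-- For n = k + r the hypothesis reads k ≤ 99 + 99r, whence n ≤ 99 + 100r.
complement-large : ∀ {n k} → k ≤ n → k ℕ.* 100 ≤ 99 ℕ.+ 99 ℕ.* n → suc n ≤ suc (n ℕ.∸ k) ℕ.* 100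
complement-large {n} {k} k≤n h = s≤s (subst₂ _≤_ n≡ (cong (99 ℕ.+_) (ℕ.*-comm 100 r))
  (bound k r (subst (λ n → k ℕ.* 100 ≤ 99 ℕ.+ 99 ℕ.* n) (sym n≡) h)))
  where
  open ℕSolver.+-*-Solver renaming (solve to solve′; _:+_ to _+′_; _:*_ to _*′_; _:=_ to _=′_; con to con′)
  r : ℕ
  r = n ℕ.∸ k
  n≡ : k ℕ.+ r ≡ n
  n≡ = ℕ.m+[n∸m]≡n k≤n
  bound : ∀ k r → k ℕ.* 100 ≤ 99 ℕ.+ 99 ℕ.* (k ℕ.+ r) → k ℕ.+ r ≤ 99 ℕ.+ 100 ℕ.* r
  bound k r h = ℕ.+-cancelˡ-≤ (99 ℕ.* k) (k ℕ.+ r) (99 ℕ.+ 100 ℕ.* r) (subst₂ _≤_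
    (solve′ 2 (λ k r → k *′ con′ 100 +′ r =′ con′ 99 *′ k +′ (k +′ r)) refl k r)
    (solve′ 2 (λ k r → con′ 99 +′ con′ 99 *′ (k +′ r) +′ r =′ con′ 99 *′ k +′ (con′ 99 +′ con′ 100 *′ r)) refl k r)
    (ℕ.+-monoˡ-≤ r h))

-- The vanishing of Ψ involves all sufficiently large subsets, while the minimum ranges over subsets
-- of one exact size; dropping elements does not increase the sum.
shrink : ∀ {n} (S : Subset n) (d : Fin n → ℕ) {k} → k ≤ ∣ S ∣ →
  ∃ λ (S′ : Subset n) → ∣ S′ ∣ ≡ k × sumOver S′ d ≤ sumOver S d
shrink []            d z≤n = [] , refl , z≤n
shrink (outside ∷ S) d k≤ with shrink S (d ∘ suc) k≤
... | S′ , eq , le = outside ∷ S′ , eq , le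
shrink (inside ∷ S)  d {zero} k≤ with shrink S (d ∘ suc) {zero} z≤n
... | S′ , eq , le = outside ∷ S′ , eq , ℕ.≤-trans le (ℕ.m≤n+m (sumOver S (d ∘ suc)) (d zero))
shrink (inside ∷ S)  d {suc k} (s≤s k≤) with shrink S (d ∘ suc) k≤
... | S′ , eq , le = inside ∷ S′ , cong suc eq , ℕ.+-monoʳ-≤ (d zero) le

sumOver-scale : ∀ {n} (S : Subset n) {d D : Fin n → ℕ} κ → (∀ i → d i ≤ κ ℕ.* D i) →
  sumOver S d ≤ κ ℕ.* sumOver S D
sumOver-scale []            κ h = z≤n
sumOver-scale (outside ∷ S) κ h = sumOver-scale S κ (h ∘ suc)
sumOver-scale (inside ∷ S) {d} {D} κ h = subst (d zero ℕ.+ sumOver S (d ∘ suc) ≤_)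
  (sym (ℕ.*-distribˡ-+ κ (D zero) (sumOver S (D ∘ suc))))
  (ℕ.+-mono-≤ (h zero) (sumOver-scale S κ (h ∘ suc)))

-- D is d/κ rounded up. The last clause lets `approximate-degree⇒dual` supply a dual polynomial of
-- order D; the first loses only the factor κ.
ceiling-quotient : ∀ κ → 1 ≤ κ → ∀ d → ∃ λ D → d ≤ κ ℕ.* D × (∀ e → e ℕ.< D → κ ℕ.* e ℕ.< d)
ceiling-quotient κ 1≤κ zero    = 0 , z≤n , λ _ ()
ceiling-quotient κ 1≤κ (suc d) with ceiling-quotient κ 1≤κ d
... | D , le , below with ℕ.m≤n⇒m<n∨m≡n le
...   | inj₁ lt = D , lt , λ e e<D → ℕ.m<n⇒m<1+n (below e e<D)
...   | inj₂ refl = suc D ,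
  subst (suc (κ ℕ.* D) ≤_) (sym (ℕ.*-suc κ D)) (ℕ.+-monoˡ-≤ (κ ℕ.* D) 1≤κ) ,
  λ e e<1+D → s≤s (ℕ.*-monoʳ-≤ κ (ℕ.s≤s⁻¹ e<1+D))

-- c = 1/(2κ)
scaled-bound : ∀ κ → 1 ≤ κ → ∃ λ c → 0ℝ <ℝ c × (∀ μ t → μ ≤ κ ℕ.* (t ℕ.+ t) → c *ℝ fromℕ μ ≤ℝ fromℕ t)
scaled-bound κ 1≤κ = fromℚ c , (c , 0<c , 0 , λ _ _ → ℚ.≤-reflexive (ℚ.+-identityˡ c)) ,
  λ μ t μ≤ ε 0<ε → 0 , λ _ _ → ℚ.≤-trans (bound μ t μ≤) (≤-by ε refl (ℚ.<⇒≤ 0<ε))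
  where
  0<2κ : 0ℚ ℚ.< ι 2 ℚ.* ι κ
  0<2κ = 0<* (ℚ.positive⁻¹ (ι 2)) (ℚ.<-≤-trans (ℚ.positive⁻¹ 1ℚ) (ι-mono 1≤κ))
  inverse = 1/-scale (ι 2 ℚ.* ι κ) 0<2κ
  c = proj₁ inverse
  0<c = proj₁ (proj₂ inverse)
  bound : ∀ μ t → μ ≤ κ ℕ.* (t ℕ.+ t) → c ℚ.* (+ μ ℚ./ 1) ℚ.≤ + t ℚ./ 1
  bound μ t μ≤ = subst₂ ℚ._≤_ (cong (c ℚ.*_) (sym (/1≡ι μ)))
    (trans (cong (c ℚ.*_) (trans (ι-* κ (t ℕ.+ t)) (cong (ι κ ℚ.*_) (ι-+ t t))))
      (trans (solve 3 (λ c k t → c :* (k :* (t :+ t)) := (c :* (con (ι 2) :* k)) :* t) refl c (ι κ) (ι t))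
        (trans (cong (ℚ._* ι t) (proj₂ (proj₂ inverse))) (trans (ℚ.*-identityˡ (ι t)) (sym (/1≡ι t))))))
    (*-monoˡ (ℚ.<⇒≤ 0<c) (ι-mono μ≤))

-- The lower bound for query algorithms

QueryLowerBound : ℝ → Set
QueryLowerBound c = ∀ (n m : ℕ) → 1 ≤ n → 1 ≤ m →
  (f : Fin n → PartialBoolean m) →
  (t : ℕ) → QueryComplexity (½ℝ -ℝ ½ℝ ^ℝ n) (⨂ f) t →
  (d : Fin n → ℕ) → (∀ i → ApproxDegree ⅓ℝ (f i) (d i)) →
  (μ : ℕ) →
  IsLeast (λ k → ∃ λ (S : Subset n) → + ∣ S ∣ ≡ ceiling ((+ 99 / 100) * (+ n / 1)) × sumOver S d ≡ k) μ →
  c *ℝ fromℕ μ ≤ℝ fromℕ t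

module _ (δ : ℚ) (j : ℕ) (0≤δ : 0ℚ ℚ.≤ δ) (δ≤1 : δ ℚ.≤ 1ℚ) (δ*j≡1 : δ ℚ.* ι j ≡ 1ℚ)
  (small : ∀ n r → suc n ≤ suc r ℕ.* 100 → δ ^ suc r ℚ.* ι 3 ^ n ℚ.< ½ ^ n) where

  -- The bias polynomial has degree at most 2t, so Ψ annihilates it; the product of the signals
  -- pairs with it to at least the advantage. The two pairings differ by less than that.
  no-algorithm : ∀ {n m t r} (f : Fin n → PartialBoolean m) {D} (dual : Duals {m} {δ} f D) →
    suc n ≤ suc r ℕ.* 100 → (∀ (S : Subset n) → n ℕ.< ∣ S ∣ ℕ.+ suc r → suc (t ℕ.+ t) ≤ sumOver S D) →
    ¬ (∃ λ (A : QueryAlgorithm (n ℕ.* m) t) → Computes (½ℝ -ℝ ½ℝ ^ℝ n) (⨂ f) A)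
  no-algorithm {n} {m} {t} {r} f dual large degrees (A , computes) =
    ℚ.<-irrefl refl (ℚ.≤-<-trans lower (ℚ.≤-<-trans upper strict))
    where
    h η β B w : ℚ
    h = ½ ^ n
    -- This choice gives β = 3h/2 and B = 1 + h/2 ≤ 3/2, so that w < h alone makes w·B < β.
    η = ⅙ ℚ.* h
    β = ι 2 ℚ.* h ℚ.- ι 3 ℚ.* η
    B = 1ℚ ℚ.+ ι 3 ℚ.* η
    w = δ ^ suc r ℚ.* ι 3 ^ n

    0<h = 0<½^ n
    approximation = algorithm⇒polynomial A {n} {⨂ f} computes η (0<* 0<⅙ 0<h)
    g = proj₁ approximation
    Deg-g = proj₁ (proj₂ approximation)
    g-bound = proj₁ (proj₂ (proj₂ approximation))
    g-advantage = proj₂ (proj₂ (proj₂ approximation))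

    T P : ℚ
    T = truncated (suc r) n dual g
    P = signalProduct n dual g

    0≤B : 0ℚ ℚ.≤ B
    0≤B = 0≤+ 0≤1 (0≤* (0≤ι 3) (0≤* 0≤⅙ (ℚ.<⇒≤ 0<h)))

    B≤3/2 : B ℚ.≤ ι 3 ℚ.* ½
    B≤3/2 = ≤-by (½ ℚ.* (1ℚ ℚ.- h))
      (solve 1 (λ h → (con 1ℚ :+ con (ι 3) :* (con ⅙ :* h)) :+ con ½ :* (con 1ℚ :- h) := con (ι 3) :* con ½) refl h)
      (0≤* 0≤½ (0≤-diff (^-≤1 0≤½ (≤-by ½ refl 0≤½) n)))

    T≡0 : T ≡ 0ℚ
    T≡0 = truncated-vanishes (suc r) n dual Deg-g degrees

    lower : β ℚ.≤ P
    lower = subst (β ℚ.≤_) (ℚ.*-identityˡ P) (signalProduct-lower n dual β Sign.+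
      λ z s eq → subst (β ℚ.≤_) (sym (ℚ.*-identityˡ (sgn s ℚ.* g z))) (g-advantage z s eq))

    upper : P ℚ.≤ w ℚ.* B
    upper = subst (ℚ._≤ w ℚ.* B)
      (trans (cong (λ T → ℚ.- (T ℚ.- P)) T≡0) (solve 1 (λ p → :- (con 0ℚ :- p) := p) refl P))
      (ℚ.≤-trans (-p≤∣p∣ (T ℚ.- P)) (truncation-error 0≤δ δ≤1 r n dual 0≤B g-bound))

    strict : w ℚ.* B ℚ.< β
    strict = ℚ.≤-<-trans (*-monoˡ (0≤* (0≤^ 0≤δ (suc r)) (0≤^ (0≤ι 3) n)) B≤3/2)
      (subst (w ℚ.* (ι 3 ℚ.* ½) ℚ.<_)
        (solve 1 (λ h → h :* (con (ι 3) :* con ½) := con (ι 2) :* h :- con (ι 3) :* (con ⅙ :* h)) refl h)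
        (ℚ.*-monoˡ-<-pos (ι 3 ℚ.* ½) (small n r large)))

  -- If 2κt were below μ, every large subset would have dual orders adding up to more than 2t, and
  -- no algorithm with t queries could exist.
  query-lower-bound : ∀ {n m} (f : Fin n → PartialBoolean m) t →
    QueryComplexity (½ℝ -ℝ ½ℝ ^ℝ n) (⨂ f) t → ∀ d → (∀ i → ApproxDegree ⅓ℝ (f i) (d i)) → ∀ μ →
    IsLeast (λ k → ∃ λ (S : Subset n) → + ∣ S ∣ ≡ ceiling ((+ 99 / 100) * (+ n / 1)) × sumOver S d ≡ k) μ →
    μ ≤ ampDegree j ℕ.* (t ℕ.+ t)
  query-lower-bound {n} f t (algorithm , _) d approx μ ((S₀ , eq₀ , _) , least)
    = ℕ.≮⇒≥ λ κ2t<μ → no-algorithm f dual large (degrees κ2t<μ) algorithm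
    where
    κ : ℕ
    κ = ampDegree j

    -- The size of `S₀` is ⌈0.99n⌉, so this is ⌊n/100⌋, and n < ∣ S ∣ + suc r says that S has at
    -- least as many elements as `S₀`.
    r : ℕ
    r = n ℕ.∸ ∣ S₀ ∣

    n≡ : ∣ S₀ ∣ ℕ.+ r ≡ n
    n≡ = ℕ.m+[n∸m]≡n (∣p∣≤n S₀)

    large : suc n ≤ suc r ℕ.* 100
    large = complement-large (∣p∣≤n S₀) (ceiling-bound n ∣ S₀ ∣ eq₀)

    quotient : ∀ i → ∃ λ D → d i ≤ κ ℕ.* D × (∀ e → e ℕ.< D → κ ℕ.* e ℕ.< d i)
    quotient i = ceiling-quotient κ (1≤ampDegree j) (d i)

    D : Fin n → ℕ
    D i = proj₁ (quotient i)

    dual : Duals f D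
    dual i = approximate-degree⇒dual (f i) δ j 0≤δ δ*j≡1 (approx i) (D i) (proj₂ (proj₂ (quotient i)))

    degrees : κ ℕ.* (t ℕ.+ t) ℕ.< μ → ∀ S → n ℕ.< ∣ S ∣ ℕ.+ suc r → suc (t ℕ.+ t) ≤ sumOver S D
    degrees κ2t<μ S n< with shrink S d {∣ S₀ ∣} (ℕ.+-cancelʳ-≤ r ∣ S₀ ∣ ∣ S ∣
      (subst (ℕ._≤ ∣ S ∣ ℕ.+ r) (sym n≡) (ℕ.s≤s⁻¹ (subst (n ℕ.<_) (ℕ.+-suc ∣ S ∣ r) n<))))
    -- The chain is 2κt < μ ≤ Σ d over S′ ≤ Σ d over S ≤ κ·(Σ D over S), and κ cancels.
    ... | S′ , eq , le = ℕ.*-cancelˡ-< κ (t ℕ.+ t) (sumOver S D) (ℕ.<-≤-trans κ2t<μ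
      (ℕ.≤-trans (least (sumOver S′ d) (S′ , trans (cong +_ eq) eq₀ , refl))
        (ℕ.≤-trans le (sumOver-scale S κ (λ i → proj₁ (proj₂ (quotient i)))))))

  query-lower-bound-constant : ∃ λ c → 0ℝ <ℝ c × QueryLowerBound c
  query-lower-bound-constant =
    let c , 0<c , bound = scaled-bound (ampDegree j) (1≤ampDegree j)
    in c , 0<c , λ n m _ _ f t complexity d approx μ least →
      bound μ t (query-lower-bound f t complexity d approx μ least)

-- The exponent is a variable so that ⅙ ^ 100 and 6 ^ 100 are never evaluated.
constant-exists : ∀ K → K ≡ 100 → ∃ λ c → 0ℝ <ℝ c × QueryLowerBound c
constant-exists K K≡100 = query-lower-bound-constant (⅙ ^ K) (6 ℕ.^ K)
  (0≤^ 0≤⅙ K) (^-≤1 0≤⅙ ⅙≤1 K) (⅙^-inverse K)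
  λ n r large → small-weight K n r (subst (λ K → suc n ≤ suc r ℕ.* K) (sym K≡100) large)

theorem5p3 : ∃ λ (c : ℝ) → 0ℝ <ℝ c ×
    (∀ (n m : ℕ) → 1 ≤ n → 1 ≤ m →
    (f : Fin n → PartialBoolean m) →
    (t : ℕ) → QueryComplexity (½ℝ -ℝ ½ℝ ^ℝ n) (⨂ f) t →
    (d : Fin n → ℕ) → (∀ i → ApproxDegree ⅓ℝ (f i) (d i)) →
    (μ : ℕ) →
    IsLeast (λ k → ∃ λ (S : Subset n) → + ∣ S ∣ ≡ ceiling ((+ 99 / 100) * (+ n / 1)) × sumOver S d ≡ k) μ →
    c *ℝ fromℕ μ ≤ℝ fromℕ t)
theorem5p3 = constant-exists 100 refl
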